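{- Let $G$ be a threshold graph on $\{0,1,\dots,n\}$ labeled by reverse degree sequence, with edges directed from $i$ to $j$ when $i>j$, degree sequence $(d_0,\dots,d_n)$, and let $\mathbf a=(a_1,\dots,a_n)\in\mathbb Z_{>0}^n$. Then \[\operatorname{Ehr}_{q,q^{ -1}}(\mathcal F_G(\mathbf a))=q^{ -F}\prod_{i=1}^n b_i(q),\] where $F=\sum_{i=1}^n\min\{d_i,i\}\,a_i-n$ and \[b_i(q)=\begin{cases}[(i+1)a_i+\sum_{j=i+1}^{d_i}a_j]_q&\text{if }d_i>i,\\ [a_i]_{q^{i+1}}&\text{if }d_i=i,\\ [a_i]_{q^{d_i+1}}[d_i]_q&\text{if }d_i<i.\end{cases}\]
   Context: A threshold graph is built from one vertex by repeatedly adding a dominating vertex or an isolated vertex; labeled by reverse degree sequence means $d_i\ge d_j$ for $i<j$. $\mathcal F_G(\mathbf a)$ is the set of $x\in\mathbb R_{\ge0}^E$ such that for each vertex $k\ge1$ the flow out of $k$ (on edges to smaller vertices) minus the flow into $k$ equals $a_k$, and the net flow at $0$ is $-\sum a_i$. $wt_{q,t}(b)=\frac{q^b-t^b}{q-t}$ for $b>0$, $wt_{q,t}(0)=1$; for an integer flow $A=(a_{ij})$, $wt_{q,t}(A)=(-(1-t)(1-q))^{\#\{a_{ij}>0\}-n}\prod wt_{q,t}(a_{ij})$; $\operatorname{Ehr}_{q,t}(\mathcal F_G(\mathbf a))=\sum_{A\in\mathcal F_G(\mathbf a)\cap\mathbb Z^E}wt_{q,t}(A)$, here evaluated at $t=q^{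 -1}$. $[k]_x=1+x+\dots+x^{k-1}$. -}

module Defs where

open import Data.Bool using (Bool; true; false; if_then_else_; _∧_; _∨_)
open import Data.Nat as ℕ using (ℕ; zero; suc; _≤_; _<_; _∸_; _≡ᵇ_; _<ᵇ_; _≤ᵇ_)
open import Data.Integer as ℤ using (ℤ; +_)
open import Data.Fin as Fin using (Fin; toℕ)
open import Data.Vec as Vec using (Vec; []; _∷_; lookup)
open import Data.Nat.ListAction using (sum)
open import Data.List as List using (List; []; _∷_; _++_; map; concatMap; foldr; upTo; allFin; filterᵇ)
open import Data.Product using (Σ; _×_; _,_)
open import Function.Definitions using (Injective)
open import Relation.Binary.PropositionalEquality using (_≡_)

-- Laurent polynomials in one variable q with integer coefficients,
-- represented as formal sums of monomials  c · q^e  (c , e).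

LP : Set
LP = List (ℤ × ℤ)

mono : ℤ → ℤ → LP
mono c e = (c , e) ∷ []

zeroLP : LP
zeroLP = []

oneLP : LP
oneLP = mono (+ 1) (+ 0)

infixl 6 _⊕_
infixl 7 _⊗_
infixr 8 _^ᴸ_

_⊕_ : LP → LP → LP
p ⊕ r = p ++ r

_⊗_ : LP → LP → LP
p ⊗ r = concatMap (λ { (c , e) → map (λ { (c' , e') → (c ℤ.* c' , e ℤ.+ e') }) r }) p

negLP : LP → LP
negLP p = map (λ { (c , e) → (ℤ.- c , e) }) p

_^ᴸ_ : LP → ℕ → LP
p ^ᴸ zero  = oneLP
p ^ᴸ suc k = p ⊗ (p ^ᴸ k)

sumLP : List LP → LP
sumLP = foldr _⊕_ zeroLP

prodLP : List LP → LP
prodLP = foldr _⊗_ oneLP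

coeff : LP → ℤ → ℤ
coeff p k = foldr ℤ._+_ (+ 0) (map (λ { (c , e) → if ⌊eq⌋ e k then c else + 0 }) p)
  where
  ⌊eq⌋ : ℤ → ℤ → Bool
  ⌊eq⌋ x y = Relation.Nullary.Decidable.Core.does (x ℤ.≟ y)
    where import Relation.Nullary.Decidable.Core

infix 4 _≈ᴸ_
_≈ᴸ_ : LP → LP → Set
p ≈ᴸ r = ∀ k → coeff p k ≡ coeff r k

qL : LP
qL = mono (+ 1) (+ 1)

qinvL : LP
qinvL = mono (+ 1) (ℤ.- (+ 1))

qbr : LP → ℕ → LP
qbr x k = sumLP (map (λ j → x ^ᴸ j) (upTo k))

-- wt_{q,t}(b) = (q^b - t^b)/(q - t) = Σ_{k<b} q^{b-1-k} t^k for b > 0,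
-- wt(0) = 1 ; here specialised at t = q^{-1}.
wtq : ℕ → LP
wtq zero    = oneLP
wtq (suc b) = sumLP (map (λ k → (qL ^ᴸ (b ∸ k)) ⊗ (qinvL ^ᴸ k)) (upTo (suc b)))

sumFin : (m : ℕ) → (Fin m → ℕ) → ℕ
sumFin m f = sum (map f (allFin m))

IsSimpleGraph : {N : ℕ} → (Fin N → Fin N → Bool) → Set
IsSimpleGraph {N} adj = (∀ u v → adj u v ≡ adj v u) × (∀ v → adj v v ≡ false)

-- Threshold graph: there is an order of construction π (step s adds
-- vertex π s) and choices c (c t = true: vertex added at step t is
-- dominating, false: isolated) so that for steps s < t the vertices
-- π s, π t are adjacent iff c t.
IsThreshold : {N : ℕ} → (Fin N → Fin N → Bool) → Set
IsThreshold {N} adj =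
  IsSimpleGraph adj ×
  Σ (Fin N → Fin N) λ π → Injective _≡_ _≡_ π ×
  Σ (Fin N → Bool) λ c → ∀ s t → s Fin.< t → adj (π s) (π t) ≡ c t

deg : {N : ℕ} → (Fin N → Fin N → Bool) → Fin N → ℕ
deg {N} adj v = sumFin N (λ w → if adj v w then 1 else 0)

ReverseDegreeLabeled : {N : ℕ} → (Fin N → Fin N → Bool) → Set
ReverseDegreeLabeled adj = ∀ i j → i Fin.< j → deg adj j ≤ deg adj i

-- Integer flows: a matrix M with M[i][j] = flow on edge i → j
-- (edges are directed from larger to smaller vertex).

Mat : ℕ → Set
Mat N = Vec (Vec ℕ N) N

entry : {N : ℕ} → Mat N → Fin N → Fin N → ℕ
entry M i j = lookup (lookup M i) j

allᶠ : (m : ℕ) → (Fin m → Bool) → Bool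
allᶠ m p = foldr _∧_ true (map p (allFin m))

-- the vertex value: a_0 is unused (vertex 0 is the sink)
vtx : {n : ℕ} → (Fin n → ℕ) → Fin (suc n) → ℕ
vtx a Fin.zero    = 0
vtx a (Fin.suc k) = a k

isFlowᵇ : (n : ℕ) → (Fin (suc n) → Fin (suc n) → Bool) → (Fin n → ℕ) → Mat (suc n) → Bool
isFlowᵇ n adj a M =
  allᶠ (suc n) (λ i → allᶠ (suc n) (λ j →
     (entry M i j ≡ᵇ 0) ∨ ((toℕ j <ᵇ toℕ i) ∧ adj i j)))
  ∧
  (inflow Fin.zero ≡ᵇ (outflow Fin.zero ℕ.+ sumFin n a))
  ∧
  allᶠ n (λ k → outflow (Fin.suc k) ≡ᵇ (a k ℕ.+ inflow (Fin.suc k)))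
  where
  outflow : Fin (suc n) → ℕ
  outflow k = sumFin (suc n) (λ j → entry M k j)
  inflow : Fin (suc n) → ℕ
  inflow k = sumFin (suc n) (λ i → entry M i k)

allVecs : {A : Set} → List A → (m : ℕ) → List (Vec A m)
allVecs xs zero    = [] ∷ []
allVecs xs (suc m) = concatMap (λ x → map (x ∷_) (allVecs xs m)) xs

-- all integer points of F_G(a).  Every entry of an integer flow is at
-- most Σ a (the total flow into the sink), so it suffices to search
-- matrices with entries in {0,…,Σ a}.
flowPoints : (n : ℕ) → (Fin (suc n) → Fin (suc n) → Bool) → (Fin n → ℕ) → List (Mat (suc n))
flowPoints n adj a =
  filterᵇ (isFlowᵇ n adj a)
    (allVecs (allVecs (upTo (suc (sumFin n a))) (suc n)) (suc n))

allEntries : {N : ℕ} → Mat N → List ℕ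
allEntries M = concatMap Vec.toList (Vec.toList M)

-- -(1-t)(1-q) at t = q^{-1}
cfactor : LP
cfactor = negLP ((oneLP ⊕ negLP qinvL) ⊗ (oneLP ⊕ negLP qL))

-- wt_{q,q^{-1}}(A) = (-(1-t)(1-q))^{#{a_ij>0} - n} ∏ wt(a_ij)
-- (for a flow with all a_k > 0, #{a_ij > 0} ≥ n, so ∸ is exact)
wtFlow : (n : ℕ) → Mat (suc n) → LP
wtFlow n M =
  (cfactor ^ᴸ (List.length (filterᵇ (λ x → 0 <ᵇ x) (allEntries M)) ∸ n))
  ⊗ prodLP (map wtq (allEntries M))

Ehr : (n : ℕ) → (Fin (suc n) → Fin (suc n) → Bool) → (Fin n → ℕ) → LP
Ehr n adj a = sumLP (map (wtFlow n) (flowPoints n adj a))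

Fexp : (n : ℕ) → (Fin (suc n) → Fin (suc n) → Bool) → (Fin n → ℕ) → ℤ
Fexp n adj a =
  (+ sumFin n (λ k → ℕ._⊓_ (deg adj (Fin.suc k)) (suc (toℕ k)) ℕ.* a k)) ℤ.- (+ n)

bfac : (n : ℕ) → (Fin (suc n) → Fin (suc n) → Bool) → (Fin n → ℕ) → Fin n → LP
bfac n adj a k =
  if i <ᵇ d then qbr qL ((suc i) ℕ.* a k ℕ.+ sumFin n (λ k' →
                    if (i <ᵇ suc (toℕ k')) ∧ (suc (toℕ k') ≤ᵇ d) then a k' else 0))
  else if d <ᵇ i then qbr (qL ^ᴸ suc d) (a k) ⊗ qbr qL d
  else qbr (qL ^ᴸ suc i) (a k)
  where
  i = suc (toℕ k)
  d = deg adj (Fin.suc k)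

RHS : (n : ℕ) → (Fin (suc n) → Fin (suc n) → Bool) → (Fin n → ℕ) → LP
RHS n adj a = mono (+ 1) (ℤ.- Fexp n adj a) ⊗ prodLP (map (bfac n adj a) (allFin n))

{-# OPTIONS --safe #-}
module Submission where

open import Defs
open import Algebra.Bundles using (CommutativeRing; RawRing)
import Algebra.Properties.Semiring.Exp
import Algebra.Solver.Ring
open import Algebra.Solver.Ring.AlmostCommutativeRing using (fromCommutativeRing; _-Raw-AlmostCommutative⟶_; Induced-equivalence)
open import Data.Bool using (Bool; true; false; if_then_else_; _∧_; _∨_; not)
open import Data.Bool.Properties using (T-≡; ∧-identityʳ; ∨-zeroʳ)
open import Data.Empty using (⊥; ⊥-elim)
open import Data.Fin as Fin using (Fin; toℕ; fromℕ<; punchOut)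
import Data.Fin.Properties as Finₚ
open import Data.Integer as ℤ using (ℤ; +_; ∣_∣)
import Data.Integer.Properties as ℤₚ
open import Data.Integer.Tactic.RingSolver using (solve-∀)
open import Data.List as List using (List; []; _∷_; _++_; allFin; applyUpTo; concatMap; filterᵇ; foldr; length; map; upTo)
open import Data.List.Properties using (map-++; map-cong; map-tabulate)
open import Data.Maybe using (just; nothing)
open import Data.Nat as ℕ using (ℕ; zero; suc; _∸_; _≤_; _<_; z≤n; s≤s; _≡ᵇ_; _<ᵇ_; _≤ᵇ_)
open import Data.Nat.ListAction using (sum)
import Data.Nat.Properties as ℕₚ
open import Data.Product using (Σ; _×_; _,_; proj₁; proj₂)
open import Data.Sum using (_⊎_; inj₁; inj₂)
open import Data.Vec as Vec using (Vec; []; _∷_; _∷ʳ_)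
open import Data.Vec.Properties using (lookup∘tabulate)
open import Function using (_∘_; id; Equivalence)
open import Function.Definitions using (Injective)
open import Level as Level using (0ℓ; _⊔_)
open import Relation.Binary.Bundles using (Setoid)
open import Relation.Binary.Definitions using (WeaklyDecidable; tri<; tri≈; tri>)
open import Relation.Binary.PropositionalEquality as ≡ using (_≡_; _≢_)
open import Relation.Nullary using (yes; no; does)
open import Relation.Nullary.Decidable using (dec-false)
open import Algebra.Properties.CommutativeSemigroup ℕₚ.+-commutativeSemigroup using (x∙yz≈y∙xz) renaming (interchange to ℕ-interchange)

-- At t = q⁻¹ put w(0) = 1 and w(b) = −(1−t)(1−q) wt(b) for b > 0, so that the weight of a flow becomes
-- the product of the w of its entries, up to a global factor. The generating function of w is
-- (1−z)² / ((1−qz)(1−q⁻¹z)), so the product of its rescalings z ↦ q⁻ⁱz over i < m telescopes to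
-- (1−z)(1−q^{1−m}z) / ((1−qz)(1−q^{−m}z)), whose coefficients are H m.
--
-- In a threshold graph labelled by reverse degree sequence, vertex r sends flow to 0, …, min(d_r, r) − 1.
-- Removing the largest vertex r, with demand s = a_r, replaces the demands a_i by a_i + x_i for a row x of
-- total s. By induction the remaining flows contribute q^{−i(a_i+x_i)} (q^{S_i+(i+1)x_i+Σ_{i<j}x_j} − 1) at
-- each i adjacent to r, and the sum over x of ∏ w(x_i) times these factors is ∏ (q^{S_i+s} − 1) · H m s:
-- sum over the last entry first, where both terms of its bracket give the telescoping product.
-- Denominators are avoided by multiplying with factors q^k − 1, which are cancelled at the end.

-- The three cases of b_i come from one index, the pivot p with d p = p. A vertex r > p has d r ≤ p
-- and is adjacent to 0, ..., d r - 1 only. It receives no flow, its demand stays a_r, and its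
-- factor `H (d r) (a r)` is already b_r for d_r < r, up to powers of q and q - 1. The vertices 0,
-- ..., p are pairwise adjacent. Write ⟨k⟩ for q^k - 1. For r ≤ p the demand s seen by row r may
-- include inflow from larger vertices, and `H r s` is ⟨1⟩⟨r⟩/⟨r+1⟩ times a new bracket u^{rs}
-- ⟨(r+1)s⟩. Each larger neighbour adds its own demand to the exponent of that bracket, which is the
-- origin of the sum over i < j ≤ d_i. Over r = 1, ..., p the quotients telescope to
-- ⟨1⟩^{p+1}/⟨p+1⟩. This is the source of the factor `⟨ suc p ⟩` in the closed forms below. The
-- bracket at the pivot has no larger neighbour, and dividing it by ⟨p+1⟩ gives [a_p]_{q^{p+1}}.

-- Coefficients (a , b) stand for a − b, which makes the homomorphism into R free of sign analysis;
-- they are kept reduced because the solver compares normal forms.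
module DifferenceSolver {c ℓ} (R : CommutativeRing c ℓ) where
  open CommutativeRing R
  open import Relation.Binary.Reasoning.Setoid setoid
  open import Algebra.Properties.Semiring.Mult.TCOptimised semiring renaming (_×_ to _·_)
  open import Algebra.Properties.Ring ring using (-‿distribˡ-*; -‿distribʳ-*)
  open import Algebra.Properties.AbelianGroup +-abelianGroup using (⁻¹-∙-comm; ⁻¹-involutive; ε⁻¹≈ε)
  open import Algebra.Properties.CommutativeSemigroup +-commutativeSemigroup using (interchange)

  private
    reduce : ℕ → ℕ → ℕ × ℕ
    reduce a b = a ℕ.∸ b , b ℕ.∸ a

    Coeff : RawRing 0ℓ 0ℓ
    Coeff = record
      { Carrier = ℕ × ℕ
      ; _≈_ = _≡_
      ; _+_ = λ (a , b) (a' , b') → reduce (a ℕ.+ a') (b ℕ.+ b')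
      ; _*_ = λ (a , b) (a' , b') → reduce (a ℕ.* a' ℕ.+ b ℕ.* b') (a ℕ.* b' ℕ.+ b ℕ.* a')
      ; -_ = λ (a , b) → b , a
      ; 0# = 0 , 0
      ; 1# = 1 , 0
      }

    -- The separate clause for `zero` makes `con (0 , 0)` and `con (1 , 0)` denote `0#` and `1#` on
    -- the nose, so that solved equations match the goals definitionally.
    ⟦_⟧ : ℕ × ℕ → Carrier
    ⟦ a , zero ⟧ = a · 1#
    ⟦ a , b@(suc _) ⟧ = a · 1# - b · 1#

    ⟦⟧-diff : ∀ a b → ⟦ a , b ⟧ ≈ a · 1# - b · 1#
    ⟦⟧-diff a zero = sym (trans (+-congˡ ε⁻¹≈ε) (+-identityʳ _))
    ⟦⟧-diff a (suc b) = refl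

    ⟦⟧-+ : ∀ a b a' b' → ⟦ a ℕ.+ a' , b ℕ.+ b' ⟧ ≈ ⟦ a , b ⟧ + ⟦ a' , b' ⟧
    ⟦⟧-+ a b a' b' = begin
      ⟦ a ℕ.+ a' , b ℕ.+ b' ⟧ ≈⟨ ⟦⟧-diff (a ℕ.+ a') (b ℕ.+ b') ⟩
      (a ℕ.+ a') · 1# - (b ℕ.+ b') · 1# ≈⟨ +-cong (×-homo-+ 1# a a') (-‿cong (×-homo-+ 1# b b')) ⟩
      (a · 1# + a' · 1#) - (b · 1# + b' · 1#) ≈⟨ +-congˡ (⁻¹-∙-comm _ _) ⟨
      (a · 1# + a' · 1#) + (- (b · 1#) - b' · 1#) ≈⟨ interchange _ _ _ _ ⟩
      (a · 1# - b · 1#) + (a' · 1# - b' · 1#) ≈⟨ +-cong (⟦⟧-diff a b) (⟦⟧-diff a' b') ⟨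
      ⟦ a , b ⟧ + ⟦ a' , b' ⟧ ∎

    ⟦⟧-shift : ∀ a b k → ⟦ a , b ⟧ ≈ ⟦ k ℕ.+ a , k ℕ.+ b ⟧
    ⟦⟧-shift a b k = begin
      ⟦ a , b ⟧ ≈⟨ +-identityˡ _ ⟨
      0# + ⟦ a , b ⟧ ≈⟨ +-congʳ (trans (⟦⟧-diff k k) (-‿inverseʳ _)) ⟨
      ⟦ k , k ⟧ + ⟦ a , b ⟧ ≈⟨ ⟦⟧-+ k k a b ⟨
      ⟦ k ℕ.+ a , k ℕ.+ b ⟧ ∎

    ⟦⟧-reduce : ∀ a b → ⟦ reduce a b ⟧ ≈ ⟦ a , b ⟧
    ⟦⟧-reduce a b = begin
      ⟦ a ℕ.∸ b , b ℕ.∸ a ⟧ ≈⟨ ⟦⟧-shift _ _ (a ℕ.⊓ b) ⟩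
      ⟦ a ℕ.⊓ b ℕ.+ (a ℕ.∸ b) , a ℕ.⊓ b ℕ.+ (b ℕ.∸ a) ⟧
        ≡⟨ ≡.cong₂ (λ x y → ⟦ x , y ⟧)
             (≡.trans (≡.cong (ℕ._+ (a ℕ.∸ b)) (ℕₚ.⊓-comm a b)) (ℕₚ.m⊓n+n∸m≡n b a))
             (ℕₚ.m⊓n+n∸m≡n a b) ⟩
      ⟦ a , b ⟧ ∎

    +-hom : ∀ x y → ⟦ RawRing._+_ Coeff x y ⟧ ≈ ⟦ x ⟧ + ⟦ y ⟧
    +-hom (a , b) (a' , b') = trans (⟦⟧-reduce (a ℕ.+ a') (b ℕ.+ b')) (⟦⟧-+ a b a' b')

    -‿hom : ∀ x → ⟦ RawRing.-_ Coeff x ⟧ ≈ - ⟦ x ⟧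
    -‿hom (a , b) = begin
      ⟦ b , a ⟧ ≈⟨ ⟦⟧-diff b a ⟩
      b · 1# - a · 1# ≈⟨ +-comm _ _ ⟩
      - (a · 1#) + b · 1# ≈⟨ +-congˡ (⁻¹-involutive _) ⟨
      - (a · 1#) - - (b · 1#) ≈⟨ ⁻¹-∙-comm _ _ ⟩
      - (a · 1# - b · 1#) ≈⟨ -‿cong (⟦⟧-diff a b) ⟨
      - ⟦ a , b ⟧ ∎

    *-hom : ∀ x y → ⟦ RawRing._*_ Coeff x y ⟧ ≈ ⟦ x ⟧ * ⟦ y ⟧
    *-hom (a , b) (a' , b') = begin
      ⟦ reduce (a ℕ.* a' ℕ.+ b ℕ.* b') (a ℕ.* b' ℕ.+ b ℕ.* a') ⟧
        ≈⟨ ⟦⟧-reduce (a ℕ.* a' ℕ.+ b ℕ.* b') (a ℕ.* b' ℕ.+ b ℕ.* a') ⟩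
      ⟦ a ℕ.* a' ℕ.+ b ℕ.* b' , a ℕ.* b' ℕ.+ b ℕ.* a' ⟧
        ≈⟨ ⟦⟧-+ (a ℕ.* a') (a ℕ.* b') (b ℕ.* b') (b ℕ.* a') ⟩
      ⟦ a ℕ.* a' , a ℕ.* b' ⟧ + ⟦ b ℕ.* b' , b ℕ.* a' ⟧
        ≈⟨ +-cong (scale a a' b') (scale b b' a') ⟩
      a · 1# * ⟦ a' , b' ⟧ + b · 1# * ⟦ b' , a' ⟧
        ≈⟨ +-congˡ (trans (*-congˡ (-‿hom (a' , b'))) (trans (sym (-‿distribʳ-* _ _)) (-‿distribˡ-* _ _))) ⟩
      a · 1# * ⟦ a' , b' ⟧ + - (b · 1#) * ⟦ a' , b' ⟧ ≈⟨ distribʳ _ _ _ ⟨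
      (a · 1# - b · 1#) * ⟦ a' , b' ⟧ ≈⟨ *-congʳ (⟦⟧-diff a b) ⟨
      ⟦ a , b ⟧ * ⟦ a' , b' ⟧ ∎
      where
      scale : ∀ k a b → ⟦ k ℕ.* a , k ℕ.* b ⟧ ≈ k · 1# * ⟦ a , b ⟧
      scale k a b = begin
        ⟦ k ℕ.* a , k ℕ.* b ⟧ ≈⟨ ⟦⟧-diff (k ℕ.* a) (k ℕ.* b) ⟩
        (k ℕ.* a) · 1# - (k ℕ.* b) · 1# ≈⟨ +-cong (×1-homo-* k a) (-‿cong (×1-homo-* k b)) ⟩
        k · 1# * a · 1# - k · 1# * b · 1# ≈⟨ +-congˡ (-‿distribʳ-* _ _) ⟩
        k · 1# * a · 1# + k · 1# * - (b · 1#) ≈⟨ distribˡ _ _ _ ⟨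
        k · 1# * (a · 1# - b · 1#) ≈⟨ *-congˡ (⟦⟧-diff a b) ⟨
        k · 1# * ⟦ a , b ⟧ ∎

    morphism : Coeff -Raw-AlmostCommutative⟶ fromCommutativeRing R
    morphism = record
      { ⟦_⟧ = ⟦_⟧
      ; +-homo = +-hom
      ; *-homo = *-hom
      ; -‿homo = -‿hom
      ; 0-homo = refl
      ; 1-homo = refl
      }

    dec : WeaklyDecidable (Induced-equivalence morphism)
    dec (a , b) (a' , b') with a ℕ.≟ a' | b ℕ.≟ b'
    ... | yes ≡.refl | yes ≡.refl = just refl
    ... | _ | _ = nothing

  open Algebra.Solver.Ring Coeff (fromCommutativeRing R) morphism dec public
    using (solve; _:=_; _:+_; _:*_; _:-_; :-_; con)

-- Power series

module PowerSeries {c ℓ} (R : CommutativeRing c ℓ) where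
  open CommutativeRing R
  open DifferenceSolver R
  open import Algebra.Properties.Semiring.Exp semiring using (_^_)
  open import Relation.Binary.Reasoning.Setoid setoid

  Seq : Set c
  Seq = ℕ → Carrier

  infix 4 _≋_
  _≋_ : Seq → Seq → Set ℓ
  f ≋ g = ∀ a → f a ≈ g a

  seqSetoid : Setoid c ℓ
  seqSetoid = record
    { Carrier = Seq
    ; _≈_ = _≋_
    ; isEquivalence = record
      { refl = λ _ → refl
      ; sym = λ p a → sym (p a)
      ; trans = λ p r a → trans (p a) (r a)
      }
    }

  ∑ : ℕ → Seq → Carrier
  ∑ zero f = 0#
  ∑ (suc n) f = f 0 + ∑ n (f ∘ suc)

  conv : Seq → Seq → Seq
  conv f g zero = f 0 * g 0
  conv f g (suc a) = f 0 * g (suc a) + conv (f ∘ suc) g a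

  conv≈∑ : ∀ f g a → conv f g a ≈ ∑ (suc a) (λ x → f x * g (a ∸ x))
  conv≈∑ f g zero = sym (+-identityʳ _)
  conv≈∑ f g (suc a) = +-congˡ (conv≈∑ (f ∘ suc) g a)

  δ : Seq
  δ zero = 1#
  δ (suc _) = 0#

  -- Multiplication of a generating function by 1 − α z.
  D : Carrier → Seq → Seq
  D α f zero = f 0
  D α f (suc a) = f (suc a) - α * f a

  -- The substitution z ↦ λ′ z in the generating function.
  scale : Carrier → Seq → Seq
  scale λ′ f a = λ′ ^ a * f a

  conv-cong : ∀ {f f' g g'} → f ≋ f' → g ≋ g' → conv f g ≋ conv f' g'
  conv-cong p r zero = *-cong (p 0) (r 0)
  conv-cong p r (suc a) = +-cong (*-cong (p 0) (r (suc a))) (conv-cong (p ∘ suc) r a)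

  conv-zeroˡ : ∀ f g → (∀ a → f a ≈ 0#) → ∀ a → conv f g a ≈ 0#
  conv-zeroˡ f g z zero = trans (*-congʳ (z 0)) (zeroˡ _)
  conv-zeroˡ f g z (suc a) =
    trans (+-cong (trans (*-congʳ (z 0)) (zeroˡ _)) (conv-zeroˡ (f ∘ suc) g (z ∘ suc) a)) (+-identityˡ _)

  conv-δ : ∀ g → conv δ g ≋ g
  conv-δ g zero = *-identityˡ _
  conv-δ g (suc a) =
    trans (+-cong (*-identityˡ _) (conv-zeroˡ (δ ∘ suc) g (λ _ → refl) a)) (+-identityʳ _)

  D-cong : ∀ {α β f g} → α ≈ β → f ≋ g → D α f ≋ D β g
  D-cong e p zero = p 0
  D-cong e p (suc a) = +-cong (p (suc a)) (-‿cong (*-cong e (p a)))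

  D-comm : ∀ α β f → D α (D β f) ≋ D β (D α f)
  D-comm α β f zero = refl
  D-comm α β f (suc zero) =
    solve 4 (λ α β x y → (y :- β :* x) :- α :* x := (y :- α :* x) :- β :* x) refl α β (f 0) (f 1)
  D-comm α β f (suc (suc a)) =
    solve 5 (λ α β x y z → (z :- β :* y) :- α :* (y :- β :* x) := (z :- α :* y) :- β :* (y :- α :* x))
      refl α β (f a) (f (suc a)) (f (suc (suc a)))

  -- The series 1 - αz has constant term 1, so the coefficients of f can be recovered one after the
  -- other, over any commutative ring.
  D-injective : ∀ α {f g} → D α f ≋ D α g → f ≋ g
  D-injective α p zero = p 0
  D-injective α {f} {g} p (suc a) = begin
    f (suc a) ≈⟨ solve 2 (λ x y → x := x :- y :+ y) refl (f (suc a)) (α * f a) ⟩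
    f (suc a) - α * f a + α * f a ≈⟨ +-cong (p (suc a)) (*-congˡ (D-injective α p a)) ⟩
    g (suc a) - α * g a + α * g a ≈⟨ solve 2 (λ x y → x := x :- y :+ y) refl (g (suc a)) (α * g a) ⟨
    g (suc a) ∎

  conv-sub : ∀ α f f' g → conv (λ x → f x - α * f' x) g ≋ (λ a → conv f g a - α * conv f' g a)
  conv-sub α f f' g zero =
    solve 4 (λ α x y z → (x :- α :* y) :* z := x :* z :- α :* (y :* z)) refl α (f 0) (f' 0) (g 0)
  conv-sub α f f' g (suc a) = begin
    (f 0 - α * f' 0) * g (suc a) + conv (λ x → f (suc x) - α * f' (suc x)) g a
      ≈⟨ +-congˡ (conv-sub α (f ∘ suc) (f' ∘ suc) g a) ⟩
    (f 0 - α * f' 0) * g (suc a) + (conv (f ∘ suc) g a - α * conv (f' ∘ suc) g a)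
      ≈⟨ solve 6 (λ α x y z s t → (x :- α :* y) :* z :+ (s :- α :* t)
                                   := (x :* z :+ s) :- α :* (y :* z :+ t))
           refl α (f 0) (f' 0) (g (suc a)) (conv (f ∘ suc) g a) (conv (f' ∘ suc) g a) ⟩
    conv f g (suc a) - α * conv f' g (suc a) ∎

  conv-Dˡ : ∀ α f g → conv (D α f) g ≋ D α (conv f g)
  conv-Dˡ α f g zero = refl
  conv-Dˡ α f g (suc a) = trans (+-congˡ (conv-sub α (f ∘ suc) f g a)) (sym (+-assoc _ _ _))

  -- `conv` recurses on its left argument, so this is not the mirror image of `conv-Dˡ`: the shift
  -- of `g` only shows from index 2 on, which gives two base cases.
  conv-Dʳ : ∀ α f g → conv f (D α g) ≋ D α (conv f g)
  conv-Dʳ α f g zero = refl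
  conv-Dʳ α f g (suc zero) =
    solve 5 (λ α x y z t → x :* (t :- α :* z) :+ y :* z := (x :* t :+ y :* z) :- α :* (x :* z))
      refl α (f 0) (f 1) (g 0) (g 1)
  conv-Dʳ α f g (suc (suc a)) = begin
    f 0 * (g (suc (suc a)) - α * g (suc a)) + conv (f ∘ suc) (D α g) (suc a)
      ≈⟨ +-congˡ (conv-Dʳ α (f ∘ suc) g (suc a)) ⟩
    f 0 * (g (suc (suc a)) - α * g (suc a)) + (conv (f ∘ suc) g (suc a) - α * conv (f ∘ suc) g a)
      ≈⟨ solve 6 (λ α x y z s t → x :* (y :- α :* z) :+ (s :- α :* t)
                                   := (x :* y :+ s) :- α :* (x :* z :+ t))
           refl α (f 0) (g (suc (suc a))) (g (suc a)) (conv (f ∘ suc) g (suc a)) (conv (f ∘ suc) g a) ⟩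
    D α (conv f g) (suc (suc a)) ∎

  scale-cong : ∀ x {f g} → f ≋ g → scale x f ≋ scale x g
  scale-cong x p a = *-congˡ (p a)

  scale-δ : ∀ x → scale x δ ≋ δ
  scale-δ x zero = *-identityˡ _
  scale-δ x (suc a) = zeroʳ _

  D-scale : ∀ x α f → D (x * α) (scale x f) ≋ scale x (D α f)
  D-scale x α f zero = refl
  D-scale x α f (suc a) =
    solve 5 (λ x α p y z → x :* p :* z :- x :* α :* (p :* y) := x :* p :* (z :- α :* y))
      refl x α (x ^ a) (f a) (f (suc a))

  -- The generating function of f is (1 − γz)(1 − κz) / ((1 − αz)(1 − βz)).
  Rational : Seq → (α β γ κ : Carrier) → Set ℓ
  Rational f α β γ κ = D α (D β f) ≋ D γ (D κ δ)

  private module ≋R = Setoid seqSetoid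
  import Relation.Binary.Reasoning.Setoid seqSetoid as SR

  Rational-cong : ∀ {f g α α' β β' γ γ' κ κ'} → f ≋ g → α ≈ α' → β ≈ β' → γ ≈ γ' → κ ≈ κ' →
    Rational f α β γ κ → Rational g α' β' γ' κ'
  Rational-cong f≋g e₁ e₂ e₃ e₄ r =
    ≋R.trans (D-cong (sym e₁) (D-cong (sym e₂) (≋R.sym f≋g)))
      (≋R.trans r (D-cong e₃ (D-cong e₄ (λ _ → refl))))

  Rational-swap : ∀ {f α β γ κ} → Rational f α β γ κ → Rational f β α κ γ
  Rational-swap {f} {α} {β} {γ} {κ} r =
    ≋R.trans (D-comm β α f) (≋R.trans r (D-comm γ κ δ))

  Rational-scale : ∀ x {f α β γ κ} → Rational f α β γ κ →
    Rational (scale x f) (x * α) (x * β) (x * γ) (x * κ)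
  Rational-scale x {f} {α} {β} {γ} {κ} r = SR.begin
    D (x * α) (D (x * β) (scale x f)) SR.≈⟨ push α β f ⟩
    scale x (D α (D β f)) SR.≈⟨ scale-cong x r ⟩
    scale x (D γ (D κ δ)) SR.≈⟨ push γ κ δ ⟨
    D (x * γ) (D (x * κ) (scale x δ)) SR.≈⟨ D-cong refl (D-cong refl (scale-δ x)) ⟩
    D (x * γ) (D (x * κ) δ) SR.∎
    where
    push : ∀ α β f → D (x * α) (D (x * β) (scale x f)) ≋ scale x (D α (D β f))
    push α β f = ≋R.trans (D-cong refl (D-scale x β f)) (D-scale x α (D β f))

  -- In generating functions: (1−γz)²/((1−κz)(1−βz)) · (1−ζz)(1−κz)/((1−αz)(1−γz)) = (1−ζz)(1−γz)/((1−αz)(1−βz))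
  Rational-conv : ∀ {f g h α β γ ζ κ} →
    Rational f κ β γ γ → Rational g α γ ζ κ → Rational h α β ζ γ → conv f g ≋ h
  Rational-conv {f} {g} {h} {α} {β} {γ} {ζ} {κ} rf rg rh =
    -- Cross-multiplication: both sides are multiplied by all four linear factors of the
    -- denominators of `f` and `g`. For `h` the factors γ and κ are in excess, and they match the
    -- numerator factors that cancel.
    D-injective γ (D-injective α (D-injective β (D-injective κ (SR.begin
      D κ (D β (D α (D γ (conv f g))))
        SR.≈⟨ D² κ β (≋R.trans (D-cong refl (≋R.sym (conv-Dʳ γ f g))) (≋R.sym (conv-Dʳ α f (D γ g)))) ⟩
      D κ (D β (conv f (D α (D γ g))))
        SR.≈⟨ ≋R.trans (D-cong refl (≋R.sym (conv-Dˡ β f (D α (D γ g))))) (≋R.sym (conv-Dˡ κ (D β f) (D α (D γ g)))) ⟩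
      conv (D κ (D β f)) (D α (D γ g)) SR.≈⟨ conv-cong rf rg ⟩
      conv (D γ (D γ δ)) (D ζ (D κ δ))
        SR.≈⟨ ≋R.trans (conv-Dˡ γ (D γ δ) (D ζ (D κ δ))) (D-cong refl (conv-Dˡ γ δ (D ζ (D κ δ)))) ⟩
      D γ (D γ (conv δ (D ζ (D κ δ)))) SR.≈⟨ D² γ γ (conv-δ (D ζ (D κ δ))) ⟩
      D γ (D γ (D ζ (D κ δ))) SR.≈⟨ D² γ γ (D-comm ζ κ δ) ⟩
      D γ (D γ (D κ (D ζ δ))) SR.≈⟨ D-cong refl (D-comm γ κ (D ζ δ)) ⟩
      D γ (D κ (D γ (D ζ δ))) SR.≈⟨ D-comm γ κ (D γ (D ζ δ)) ⟩
      D κ (D γ (D γ (D ζ δ))) SR.≈⟨ D² κ γ (D-comm γ ζ δ) ⟩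
      D κ (D γ (D ζ (D γ δ))) SR.≈⟨ D² κ γ rh ⟨
      D κ (D γ (D α (D β h))) SR.≈⟨ D² κ γ (D-comm α β h) ⟩
      D κ (D γ (D β (D α h))) SR.≈⟨ D-cong refl (D-comm γ β (D α h)) ⟩
      D κ (D β (D γ (D α h))) SR.≈⟨ D² κ β (D-comm γ α h) ⟩
      D κ (D β (D α (D γ h))) SR.∎))))
    where
    D² : ∀ α β {f g} → f ≋ g → D α (D β f) ≋ D α (D β g)
    D² α β p = D-cong refl (D-cong refl p)

  geo : Carrier → ℕ → Carrier
  geo x n = ∑ n (x ^_)

  ∑-cong : ∀ n {f g} → (∀ i → i ℕ.< n → f i ≈ g i) → ∑ n f ≈ ∑ n g
  ∑-cong zero p = refl
  ∑-cong (suc n) p = +-cong (p 0 ℕ.z<s) (∑-cong n (λ i i<n → p (suc i) (ℕ.s<s i<n)))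

  ∑-distribˡ : ∀ n x f → ∑ n (λ i → x * f i) ≈ x * ∑ n f
  ∑-distribˡ zero x f = sym (zeroʳ x)
  ∑-distribˡ (suc n) x f = trans (+-congˡ (∑-distribˡ n x (f ∘ suc))) (sym (distribˡ _ _ _))

  geo-suc : ∀ x n → geo x (suc n) ≈ 1# + x * geo x n
  geo-suc x n = +-congˡ (∑-distribˡ n x (x ^_))

  geo-telescope : ∀ x n → (x - 1#) * geo x n ≈ x ^ n - 1#
  geo-telescope x zero = trans (zeroʳ _) (sym (-‿inverseʳ 1#))
  geo-telescope x (suc n) = begin
    (x - 1#) * geo x (suc n) ≈⟨ *-congˡ (geo-suc x n) ⟩
    (x - 1#) * (1# + x * geo x n)
      ≈⟨ solve 2 (λ x g → (x :- con (1 , 0)) :* (con (1 , 0) :+ x :* g)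
                          := x :- con (1 , 0) :+ x :* ((x :- con (1 , 0)) :* g)) refl x (geo x n) ⟩
    x - 1# + x * ((x - 1#) * geo x n) ≈⟨ +-congˡ (*-congˡ (geo-telescope x n)) ⟩
    x - 1# + x * (x ^ n - 1#)
      ≈⟨ solve 2 (λ x p → x :- con (1 , 0) :+ x :* (p :- con (1 , 0)) := x :* p :- con (1 , 0)) refl x (x ^ n) ⟩
    x ^ suc n - 1# ∎

-- The series `H` over a ring with an invertible q

record QRing c ℓ : Set (Level.suc (c ⊔ ℓ)) where
  field
    R : CommutativeRing c ℓ
  open CommutativeRing R public hiding (zero)
  open Algebra.Properties.Semiring.Exp semiring public using (_^_)
  field
    q u : Carrier
    q*u≈1 : q * u ≈ 1#
    -- Stands in for a field of fractions: identities with denominators q^k - 1 are proved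
    -- multiplied out, and the denominators are then cancelled.
    q^k-1-cancelˡ : ∀ k {x y} → (q ^ suc k - 1#) * x ≈ (q ^ suc k - 1#) * y → x ≈ y

module RowSeries {c ℓ} (QR : QRing c ℓ) where
  open QRing QR
  open DifferenceSolver R
  open PowerSeries R
  open import Algebra.Properties.Semiring.Exp semiring using (^-homo-*; ^-assocʳ; ^-congˡ)
  open import Algebra.Properties.CommutativeSemiring.Exp commutativeSemiring using (^-distrib-*)
  open import Relation.Binary.Reasoning.Setoid setoid

  ⟨_⟩ : ℕ → Carrier
  ⟨ k ⟩ = q ^ k - 1#

  -- For a > 0 this is (q−1)² times q^{−ka} [a]_{q^{k+1}} [k]_q.
  H : ℕ → Seq
  H k zero = 1#
  H k (suc a) = ⟨ 1 ⟩ * ⟨ k ⟩ * (u ^ k) ^ suc a * geo (q ^ suc k) (suc a)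

  1^n : ∀ n → 1# ^ n ≈ 1#
  1^n zero = refl
  1^n (suc n) = trans (*-identityˡ _) (1^n n)

  q^n*u^n : ∀ n → q ^ n * u ^ n ≈ 1#
  q^n*u^n n = trans (sym (^-distrib-* q u n)) (trans (^-congˡ n q*u≈1) (1^n n))

  -- Because `q ^ suc k * u ^ k` is q, multiplying by 1 - qz collapses consecutive geometric sums to
  -- the monomial A vᵃ with v = `u ^ k`, from index 2 on. The factor 1 - vz then kills everything
  -- from index 3 on. Indices 0, 1, 2 are separate because `H k 0` is 1 and does not follow the
  -- formula.
  H-rational : ∀ k → Rational (H k) q (u ^ k) 1# (q * u ^ k)
  H-rational k = λ a → trans (D-comm q v (H k) a) (Dv a)
    where
    v A Q : Carrier
    v = u ^ k
    A = ⟨ 1 ⟩ * ⟨ k ⟩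
    Q = q ^ suc k
    Q*v≈q : Q * v ≈ q
    Q*v≈q = begin
      q * q ^ k * v ≈⟨ *-assoc _ _ _ ⟩
      q * (q ^ k * v) ≈⟨ *-congˡ (q^n*u^n k) ⟩
      q * 1# ≈⟨ *-identityʳ q ⟩
      q ∎
    A*v : A * v ≈ (q - 1#) * (1# - v)
    A*v = begin
      (q * 1# - 1#) * (q ^ k - 1#) * v
        ≈⟨ solve 3 (λ q p v → (q :* con (1 , 0) :- con (1 , 0)) :* (p :- con (1 , 0)) :* v
                      := (q :- con (1 , 0)) :* (p :* v :- v)) refl q (q ^ k) v ⟩
      (q - 1#) * (q ^ k * v - v) ≈⟨ *-congˡ (+-congʳ (q^n*u^n k)) ⟩
      (q - 1#) * (1# - v) ∎
    h₁ : H k 1 ≈ A * v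
    h₁ = solve 2 (λ A v → A :* (v :* con (1 , 0)) :* (con (1 , 0) :+ con (0 , 0)) := A :* v) refl A v
    Dq : ∀ a → D q (H k) (suc (suc a)) ≈ A * v ^ suc (suc a)
    Dq a = begin
      A * (v * p) * geo Q (suc (suc a)) - q * (A * p * g)
        ≈⟨ +-cong (*-congˡ (geo-suc Q (suc a))) (-‿cong (*-congʳ (sym Q*v≈q))) ⟩
      A * (v * p) * (1# + Q * g) - Q * v * (A * p * g)
        ≈⟨ solve 5 (λ A v p Q g → A :* (v :* p) :* (con (1 , 0) :+ Q :* g) :- Q :* v :* (A :* p :* g)
                      := A :* (v :* p)) refl A v p Q g ⟩
      A * (v * p) ∎
      where
      p = v ^ suc a
      g = geo Q (suc a)
    Dv : D v (D q (H k)) ≋ D 1# (D (q * v) δ)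
    Dv zero = refl
    Dv (suc zero) = begin
      H k 1 - q * 1# - v * 1# ≈⟨ +-congʳ (+-congʳ (trans h₁ A*v)) ⟩
      (q - 1#) * (1# - v) - q * 1# - v * 1#
        ≈⟨ solve 2 (λ q v → (q :- con (1 , 0)) :* (con (1 , 0) :- v) :- q :* con (1 , 0) :- v :* con (1 , 0)
               := con (0 , 0) :- q :* v :* con (1 , 0) :- con (1 , 0) :* con (1 , 0)) refl q v ⟩
      0# - q * v * 1# - 1# * 1# ∎
    Dv (suc (suc zero)) = begin
      D q (H k) 2 - v * (H k 1 - q * 1#) ≈⟨ +-cong (Dq 0) (-‿cong (*-congˡ (+-congʳ h₁))) ⟩
      A * (v * (v * 1#)) - v * (A * v - q * 1#)
        ≈⟨ solve 3 (λ A v q → A :* (v :* (v :* con (1 , 0))) :- v :* (A :* v :- q :* con (1 , 0))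
               := con (0 , 0) :- q :* v :* con (0 , 0)
                   :- con (1 , 0) :* (con (0 , 0) :- q :* v :* con (1 , 0))) refl A v q ⟩
      0# - q * v * 0# - 1# * (0# - q * v * 1#) ∎
    Dv (suc (suc (suc a))) = begin
      D q (H k) (suc (suc (suc a))) - v * D q (H k) (suc (suc a))
        ≈⟨ +-cong (Dq (suc a)) (-‿cong (*-congˡ (Dq a))) ⟩
      A * (v * p) - v * (A * p)
        ≈⟨ solve 4 (λ A v q p → A :* (v :* p) :- v :* (A :* p)
             := con (0 , 0) :- q :* v :* con (0 , 0)
                 :- con (1 , 0) :* (con (0 , 0) :- q :* v :* con (0 , 0))) refl A v q p ⟩
      0# - q * v * 0# - 1# * (0# - q * v * 0#) ∎
      where p = v ^ suc (suc a)

  private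
    q*[u*x] : ∀ x → q * (u * x) ≈ x
    q*[u*x] x = trans (sym (*-assoc _ _ _)) (trans (*-congʳ q*u≈1) (*-identityˡ x))

    u¹ : u ^ 1 ≈ u
    u¹ = *-identityʳ u

    q*u¹ : q * u ^ 1 ≈ 1#
    q*u¹ = trans (*-congˡ u¹) q*u≈1

  -- One more factor at the end of the telescoping product. With v = `u ^ m`, the numerator factor 1
  -- - qvz of `H m` cancels against the denominator of the rescaled `H 1`, and one numerator factor
  -- 1 - vz of the latter cancels against the denominator of `H m`.
  conv-H : ∀ m → conv (scale (u ^ m) (H 1)) (H m) ≋ H (suc m)
  conv-H m = Rational-conv {κ = q * v}
    (Rational-cong (λ _ → refl) (*-comm v q) (trans (*-congˡ u¹) (*-comm v u)) (*-identityʳ v)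
      (trans (*-congˡ q*u¹) (*-identityʳ v)) (Rational-scale v (H-rational 1)))
    (H-rational m)
    (Rational-cong (λ _ → refl) refl refl refl (q*[u*x] v) (H-rational (suc m)))
    where v = u ^ m

  -- The product extended at its other end. `H m` is made of the rescalings by q⁰, ..., q^{1-m};
  -- with the rescaling by q in front, the m + 1 factors are those of `H (suc m)` with qz in place
  -- of z.
  conv-H-scaled : ∀ m → conv (scale q (H 1)) (H m) ≋ scale q (H (suc m))
  conv-H-scaled m = Rational-conv {κ = 1#}
    (Rational-swap (Rational-cong (λ _ → refl) refl q*u¹ (*-identityʳ q)
      (trans (*-congˡ q*u¹) (*-identityʳ q)) (Rational-scale q (H-rational 1))))
    (Rational-swap (H-rational m))
    (Rational-swap (Rational-cong (λ _ → refl) refl (q*[u*x] (u ^ m)) (*-identityʳ q)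
      (*-congˡ (q*[u*x] (u ^ m))) (Rational-scale q (H-rational (suc m)))))

  -- Vertex 0 carries no demand, so its bracket is left out.
  br : ℕ → ℕ → Carrier
  br zero _ = 1#
  br (suc _) N = ⟨ N ⟩

  ∑-sub : ∀ n f g → ∑ n (λ x → f x - g x) ≈ ∑ n f - ∑ n g
  ∑-sub zero f g = sym (-‿inverseʳ 0#)
  ∑-sub (suc n) f g = trans (+-congˡ (∑-sub n (f ∘ suc) (g ∘ suc)))
    (solve 4 (λ a b x y → (a :- b) :+ (x :- y) := (a :+ x) :- (b :+ y)) refl _ _ _ _)

  -- For m > 0, u^{my} (q^{S+(m+1)y} - 1) = q^S q^y - u^{my}. The two terms rescale `H 1` by q and
  -- by `u ^ m`, exactly the two ways to extend `H m`, so both convolutions are multiples of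
  -- `H (suc m) s`. For m = 0 there is no bracket and one extension is enough.
  H-step : ∀ m S s →
    ∑ (suc s) (λ y → H 1 y * (u ^ (m ℕ.* y) * br m (S ℕ.+ suc m ℕ.* y)) * H m (s ∸ y))
      ≈ br m (S ℕ.+ s) * H (suc m) s
  H-step zero S s = begin
    ∑ (suc s) (λ y → H 1 y * (1# * 1#) * H 0 (s ∸ y))
      ≈⟨ ∑-cong (suc s) (λ y _ → term y) ⟩
    ∑ (suc s) (λ y → scale 1# (H 1) y * H 0 (s ∸ y)) ≈⟨ conv≈∑ (scale 1# (H 1)) (H 0) s ⟨
    conv (scale 1# (H 1)) (H 0) s ≈⟨ conv-H 0 s ⟩
    H 1 s ≈⟨ *-identityˡ _ ⟨
    1# * H 1 s ∎
    where
    term : ∀ y → H 1 y * (1# * 1#) * H 0 (s ∸ y) ≈ scale 1# (H 1) y * H 0 (s ∸ y)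
    term y = *-congʳ (trans (*-congˡ (trans (*-identityˡ 1#) (sym (1^n y)))) (*-comm _ _))
  H-step m@(suc _) S s = begin
    ∑ (suc s) (λ y → H 1 y * (u ^ (m ℕ.* y) * ⟨ S ℕ.+ suc m ℕ.* y ⟩) * H m (s ∸ y))
      ≈⟨ ∑-cong (suc s) (λ y _ → term y) ⟩
    ∑ (suc s) (λ y → q ^ S * (scale q (H 1) y * H m (s ∸ y)) - scale v (H 1) y * H m (s ∸ y))
      ≈⟨ ∑-sub (suc s) (λ y → q ^ S * (scale q (H 1) y * H m (s ∸ y))) (λ y → scale v (H 1) y * H m (s ∸ y)) ⟩
    ∑ (suc s) (λ y → q ^ S * (scale q (H 1) y * H m (s ∸ y))) - ∑ (suc s) (λ y → scale v (H 1) y * H m (s ∸ y))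
      ≈⟨ +-cong (∑-distribˡ (suc s) (q ^ S) (λ y → scale q (H 1) y * H m (s ∸ y))) refl ⟩
    q ^ S * ∑ (suc s) (λ y → scale q (H 1) y * H m (s ∸ y)) - ∑ (suc s) (λ y → scale v (H 1) y * H m (s ∸ y))
      ≈⟨ +-cong (*-congˡ (conv≈∑ (scale q (H 1)) (H m) s)) (-‿cong (conv≈∑ (scale v (H 1)) (H m) s)) ⟨
    q ^ S * conv (scale q (H 1)) (H m) s - conv (scale v (H 1)) (H m) s
      ≈⟨ +-cong (*-congˡ (conv-H-scaled m s)) (-‿cong (conv-H m s)) ⟩
    q ^ S * (q ^ s * H (suc m) s) - H (suc m) s
      ≈⟨ solve 3 (λ a b h → a :* (b :* h) :- h := (a :* b :- con (1 , 0)) :* h) refl (q ^ S) (q ^ s) (H (suc m) s) ⟩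
    (q ^ S * q ^ s - 1#) * H (suc m) s ≈⟨ *-congʳ (+-congʳ (^-homo-* q S s)) ⟨
    ⟨ S ℕ.+ s ⟩ * H (suc m) s ∎
    where
    v = u ^ m
    term : ∀ y → H 1 y * (u ^ (m ℕ.* y) * ⟨ S ℕ.+ suc m ℕ.* y ⟩) * H m (s ∸ y)
      ≈ q ^ S * (scale q (H 1) y * H m (s ∸ y)) - scale v (H 1) y * H m (s ∸ y)
    term y = begin
      H 1 y * (u ^ (m ℕ.* y) * ⟨ S ℕ.+ suc m ℕ.* y ⟩) * H m (s ∸ y)
        ≈⟨ *-congʳ (*-congˡ (*-congˡ (+-congʳ (trans (^-homo-* q S (suc m ℕ.* y))
            (*-congˡ (^-homo-* q y (m ℕ.* y))))))) ⟩
      H 1 y * (ω * (q ^ S * (q ^ y * ρ) - 1#)) * H m (s ∸ y)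
        ≈⟨ solve 6 (λ w ω a b ρ h → w :* (ω :* (a :* (b :* ρ) :- con (1 , 0))) :* h
                 := (ρ :* ω) :* (a :* (b :* w :* h)) :- ω :* w :* h) refl (H 1 y) ω (q ^ S) (q ^ y) ρ (H m (s ∸ y)) ⟩
      (ρ * ω) * (q ^ S * (q ^ y * H 1 y * H m (s ∸ y))) - ω * H 1 y * H m (s ∸ y)
        ≈⟨ +-cong (trans (*-congʳ (q^n*u^n (m ℕ.* y))) (*-identityˡ _))
            (-‿cong (*-congʳ (*-congʳ (sym (^-assocʳ u m y))))) ⟩
      q ^ S * (scale q (H 1) y * H m (s ∸ y)) - scale v (H 1) y * H m (s ∸ y) ∎
      where
      ω = u ^ (m ℕ.* y)
      ρ = q ^ (m ℕ.* y)

  -- ⟨k+1⟩ sums the geometric series in q^{k+1}. The quotient ⟨k⟩/⟨k+1⟩ implicit here is the one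
  -- that telescopes over the pairwise adjacent vertices.
  H-closed : ∀ k a → ⟨ suc k ⟩ * H k (suc a) ≈ ⟨ 1 ⟩ * ⟨ k ⟩ * (u ^ (k ℕ.* suc a) * ⟨ suc k ℕ.* suc a ⟩)
  H-closed k a = begin
    ⟨ suc k ⟩ * (⟨ 1 ⟩ * ⟨ k ⟩ * (u ^ k) ^ suc a * geo (q ^ suc k) (suc a))
      ≈⟨ solve 4 (λ a b c d → a :* (b :* c :* d) := b :* (c :* (a :* d))) refl _ _ _ _ ⟩
    ⟨ 1 ⟩ * ⟨ k ⟩ * ((u ^ k) ^ suc a * (⟨ suc k ⟩ * geo (q ^ suc k) (suc a)))
      ≈⟨ *-congˡ (*-cong (^-assocʳ u k (suc a)) (trans (geo-telescope (q ^ suc k) (suc a))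
          (+-congʳ (^-assocʳ q (suc k) (suc a))))) ⟩
    ⟨ 1 ⟩ * ⟨ k ⟩ * (u ^ (k ℕ.* suc a) * ⟨ suc k ℕ.* suc a ⟩) ∎

-- Row and flow sums

<ᵇ-true : ∀ {m n} → m < n → (m <ᵇ n) ≡ true
<ᵇ-true p = Equivalence.to T-≡ (ℕₚ.<⇒<ᵇ p)

<ᵇ-false : ∀ {m n} → n ≤ m → (m <ᵇ n) ≡ false
<ᵇ-false {m} {n} p with m <ᵇ n in eq
... | false = ≡.refl
... | true = ⊥-elim (ℕₚ.<⇒≱ (ℕₚ.<ᵇ⇒< m n (Equivalence.from T-≡ eq)) p)

≤ᵇ-true : ∀ {m n} → m ≤ n → (m ≤ᵇ n) ≡ true
≤ᵇ-true p = Equivalence.to T-≡ (ℕₚ.≤⇒≤ᵇ p)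

≤ᵇ-false : ∀ {m n} → n < m → (m ≤ᵇ n) ≡ false
≤ᵇ-false {m} {n} p with m ≤ᵇ n in eq
... | false = ≡.refl
... | true = ⊥-elim (ℕₚ.<⇒≱ p (ℕₚ.≤ᵇ⇒≤ m n (Equivalence.from T-≡ eq)))

∧-true : ∀ {a b} → a ∧ b ≡ true → a ≡ true × b ≡ true
∧-true {true} {true} _ = ≡.refl , ≡.refl

-- With a default beyond the end, vectors act as functions on ℕ, and sums and products over them run
-- over natural numbers without bounds to carry along.
at : ∀ {A : Set} {n} → A → Vec A n → ℕ → A
at z [] _ = z
at z (x ∷ v) zero = x
at z (x ∷ v) (suc i) = at z v i

at-∷ʳ-< : ∀ {A : Set} {n} (z : A) (v : Vec A n) y {i} → i < n → at z (v ∷ʳ y) i ≡ at z v i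
at-∷ʳ-< z (x ∷ v) y {zero} _ = ≡.refl
at-∷ʳ-< z (x ∷ v) y {suc i} (s≤s p) = at-∷ʳ-< z v y p

at-∷ʳ-last : ∀ {A : Set} {n} (z : A) (v : Vec A n) y → at z (v ∷ʳ y) n ≡ y
at-∷ʳ-last z [] y = ≡.refl
at-∷ʳ-last z (x ∷ v) y = at-∷ʳ-last z v y

total : ℕ → (ℕ → ℕ) → ℕ
total zero e = 0
total (suc r) e = total r e ℕ.+ e r

above : ℕ → ℕ → (ℕ → ℕ) → ℕ
above i zero e = 0
above i (suc k) e = above i k e ℕ.+ (if i <ᵇ k then e k else 0)

above-cong : ∀ i k {e e'} → (∀ j → j < k → e j ≡ e' j) → above i k e ≡ above i k e'
above-cong i zero p = ≡.refl
above-cong i (suc k) p = ≡.cong₂ ℕ._+_ (above-cong i k (λ j j<k → p j (ℕₚ.m<n⇒m<1+n j<k)))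
  (≡.cong (if i <ᵇ k then_else 0) (p k ℕₚ.≤-refl))

above-low : ∀ i k e → k ≤ suc i → above i k e ≡ 0
above-low i zero e _ = ≡.refl
above-low i (suc k) e (s≤s k≤i) rewrite <ᵇ-false k≤i =
  ≡.trans (ℕₚ.+-identityʳ _) (above-low i k e (ℕₚ.m≤n⇒m≤1+n k≤i))

above-suc : ∀ i k e → i < k → above i (suc k) e ≡ above i k e ℕ.+ e k
above-suc i k e i<k rewrite <ᵇ-true i<k = ≡.refl

above-+ : ∀ i k e e' → above i k (λ j → e j ℕ.+ e' j) ≡ above i k e ℕ.+ above i k e'
above-+ i zero e e' = ≡.refl
above-+ i (suc k) e e' with i <ᵇ k
... | true = ≡.trans (≡.cong (ℕ._+ (e k ℕ.+ e' k)) (above-+ i k e e'))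
    (ℕ-interchange (above i k e) (above i k e') (e k) (e' k))
... | false = ≡.trans (≡.cong (ℕ._+ 0) (above-+ i k e e')) (ℕ-interchange (above i k e) (above i k e') 0 0)

above-vanish : ∀ i k l e → k ≤ l → (∀ j → k ≤ j → j < l → e j ≡ 0) → above i l e ≡ above i k e
above-vanish i zero zero e _ _ = ≡.refl
above-vanish i k (suc l) e k≤1+l z with ℕₚ.m≤n⇒m<n∨m≡n k≤1+l
... | inj₂ ≡.refl = ≡.refl
... | inj₁ (s≤s k≤l) rewrite z l k≤l ℕₚ.≤-refl with i <ᵇ l
...   | true = ≡.trans (ℕₚ.+-identityʳ _) (above-vanish i k l e k≤l (λ j k≤j j<l → z j k≤j (ℕₚ.m<n⇒m<1+n j<l)))
...   | false = ≡.trans (ℕₚ.+-identityʳ _) (above-vanish i k l e k≤l (λ j k≤j j<l → z j k≤j (ℕₚ.m<n⇒m<1+n j<l)))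

total-cong : ∀ r {e e'} → (∀ j → j < r → e j ≡ e' j) → total r e ≡ total r e'
total-cong zero p = ≡.refl
total-cong (suc r) p = ≡.cong₂ ℕ._+_ (total-cong r (λ j j<r → p j (ℕₚ.m<n⇒m<1+n j<r))) (p r ℕₚ.≤-refl)

total-+ : ∀ r e e' → total r (λ j → e j ℕ.+ e' j) ≡ total r e ℕ.+ total r e'
total-+ zero e e' = ≡.refl
total-+ (suc r) e e' = ≡.trans (≡.cong (ℕ._+ (e r ℕ.+ e' r)) (total-+ r e e'))
  (ℕ-interchange (total r e) (total r e') (e r) (e' r))

total-mono : ∀ {r l} e → r ≤ l → total r e ≤ total l e
total-mono {l = zero} e z≤n = z≤n
total-mono {r} {suc l} e r≤1+l with ℕₚ.m≤n⇒m<n∨m≡n r≤1+l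
... | inj₂ ≡.refl = ℕₚ.≤-refl
... | inj₁ (s≤s r≤l) = ℕₚ.≤-trans (total-mono e r≤l) (ℕₚ.m≤m+n _ _)

-- x₀ + ⋯ + x_{l−1} = s with x_j = 0 for j ≥ m, tested from the last entry downwards.
rowᵇ : (l m s : ℕ) → (ℕ → ℕ) → Bool
rowᵇ zero m s x = s ≡ᵇ 0
rowᵇ (suc l) m s x = ((x l ≡ᵇ 0) ∨ (l <ᵇ m)) ∧ ((x l ≤ᵇ s) ∧ rowᵇ l m (s ∸ x l) x)

rowᵇ-cong : ∀ l m s {x x'} → (∀ j → j < l → x j ≡ x' j) → rowᵇ l m s x ≡ rowᵇ l m s x'
rowᵇ-cong zero m s p = ≡.refl
rowᵇ-cong (suc l) m s {x} {x'} p rewrite p l ℕₚ.≤-refl =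
  ≡.cong (λ b → ((x' l ≡ᵇ 0) ∨ (l <ᵇ m)) ∧ ((x' l ≤ᵇ s) ∧ b))
    (rowᵇ-cong l m (s ∸ x' l) (λ j j<l → p j (ℕₚ.m<n⇒m<1+n j<l)))

-- Peeling off the last entry shortens the row but leaves m; this brings m back down to the new
-- length.
rowᵇ-full : ∀ l {m m'} s x → l ≤ m → l ≤ m' → rowᵇ l m s x ≡ rowᵇ l m' s x
rowᵇ-full zero s x _ _ = ≡.refl
rowᵇ-full (suc l) s x p p' rewrite <ᵇ-true p | <ᵇ-true p' =
  ≡.cong (λ b → ((x l ≡ᵇ 0) ∨ true) ∧ ((x l ≤ᵇ s) ∧ b)) (rowᵇ-full l (s ∸ x l) x (ℕₚ.<⇒≤ p) (ℕₚ.<⇒≤ p'))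

rowᵇ-total : ∀ l m s x → rowᵇ l m s x ≡ true → total l x ≡ s
rowᵇ-total zero m zero x _ = ≡.refl
rowᵇ-total (suc l) m s x v with ∧-true {(x l ≡ᵇ 0) ∨ (l <ᵇ m)} v
... | _ , v' with ∧-true {x l ≤ᵇ s} v'
...   | x≤s , v″ = ≡.trans (≡.cong (ℕ._+ x l) (rowᵇ-total l m (s ∸ x l) x v″))
                     (ℕₚ.m∸n+n≡m (ℕₚ.≤ᵇ⇒≤ (x l) s (Equivalence.from T-≡ x≤s)))

rowᵇ-support : ∀ l m s x → rowᵇ l m s x ≡ true → ∀ j → m ≤ j → j < l → x j ≡ 0
rowᵇ-support (suc l) m s x v j m≤j (s≤s j≤l) with ∧-true {(x l ≡ᵇ 0) ∨ (l <ᵇ m)} v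
... | o , v' with ∧-true {x l ≤ᵇ s} v' | ℕₚ.m≤n⇒m<n∨m≡n j≤l
...   | _ , v″ | inj₁ j<l = rowᵇ-support l m (s ∸ x l) x v″ j m≤j j<l
...   | _ | inj₂ ≡.refl rewrite <ᵇ-false m≤j with x j
...     | zero = ≡.refl

module Sums {c ℓ} (R : CommutativeRing c ℓ) where
  open CommutativeRing R hiding (zero)
  open PowerSeries R using (∑)
  open import Algebra.Properties.CommutativeSemigroup +-commutativeSemigroup using () renaming
      (interchange to +-interchange)
  open import Algebra.Properties.CommutativeSemigroup *-commutativeSemigroup using () renaming
      (interchange to *-interchange)
  open import Relation.Binary.Reasoning.Setoid setoid

  private variable
    A B : Set

  sumOver : List A → (A → Carrier) → Carrier
  sumOver [] f = 0#
  sumOver (x ∷ xs) f = f x + sumOver xs f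

  sumOver-cong : ∀ (xs : List A) {f g} → (∀ x → f x ≈ g x) → sumOver xs f ≈ sumOver xs g
  sumOver-cong [] p = refl
  sumOver-cong (x ∷ xs) p = +-cong (p x) (sumOver-cong xs p)

  sumOver-++ : ∀ (xs ys : List A) f → sumOver (xs ++ ys) f ≈ sumOver xs f + sumOver ys f
  sumOver-++ [] ys f = sym (+-identityˡ _)
  sumOver-++ (x ∷ xs) ys f = trans (+-congˡ (sumOver-++ xs ys f)) (sym (+-assoc _ _ _))

  sumOver-map : ∀ (g : A → B) xs f → sumOver (List.map g xs) f ≈ sumOver xs (f ∘ g)
  sumOver-map g [] f = refl
  sumOver-map g (x ∷ xs) f = +-congˡ (sumOver-map g xs f)

  sumOver-concatMap : ∀ (g : A → List B) xs f → sumOver (concatMap g xs) f ≈ sumOver xs (λ x → sumOver (g x) f)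
  sumOver-concatMap g [] f = refl
  sumOver-concatMap g (x ∷ xs) f = trans (sumOver-++ (g x) (concatMap g xs) f) (+-congˡ (sumOver-concatMap g xs f))

  sumOver-0 : ∀ (xs : List A) → sumOver xs (λ _ → 0#) ≈ 0#
  sumOver-0 [] = refl
  sumOver-0 (x ∷ xs) = trans (+-identityˡ _) (sumOver-0 xs)

  sumOver-+ : ∀ (xs : List A) f g → sumOver xs (λ x → f x + g x) ≈ sumOver xs f + sumOver xs g
  sumOver-+ [] f g = sym (+-identityˡ _)
  sumOver-+ (x ∷ xs) f g = trans (+-congˡ (sumOver-+ xs f g)) (+-interchange _ _ _ _)

  sumOver-swap : ∀ (xs : List A) (ys : List B) (f : A → B → Carrier) →
    sumOver xs (λ x → sumOver ys (f x)) ≈ sumOver ys (λ y → sumOver xs (λ x → f x y))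
  sumOver-swap [] ys f = sym (sumOver-0 ys)
  sumOver-swap (x ∷ xs) ys f = trans (+-congˡ (sumOver-swap xs ys f)) (sym (sumOver-+ ys (f x) _))

  sumOver-distribˡ : ∀ (xs : List A) k f → sumOver xs (λ x → k * f x) ≈ k * sumOver xs f
  sumOver-distribˡ [] k f = sym (zeroʳ k)
  sumOver-distribˡ (x ∷ xs) k f = trans (+-congˡ (sumOver-distribˡ xs k f)) (sym (distribˡ _ _ _))

  sumOver-applyUpTo : ∀ n (g : ℕ → A) f → sumOver (applyUpTo g n) f ≈ ∑ n (f ∘ g)
  sumOver-applyUpTo zero g f = refl
  sumOver-applyUpTo (suc n) g f = +-congˡ (sumOver-applyUpTo n (g ∘ suc) f)

  sumOver-allVecs-∷ : ∀ (xs : List A) m f →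
    sumOver (allVecs xs (suc m)) f ≈ sumOver xs (λ x → sumOver (allVecs xs m) (λ v → f (x ∷ v)))
  sumOver-allVecs-∷ xs m f = trans (sumOver-concatMap _ xs f)
    (sumOver-cong xs (λ x → sumOver-map (x ∷_) (allVecs xs m) f))

  -- `allVecs` builds vectors from the front, whereas rows and flow matrices are taken apart from
  -- the back, where the largest vertex is.
  sumOver-allVecs-∷ʳ : ∀ (xs : List A) m f →
    sumOver (allVecs xs (suc m)) f ≈ sumOver xs (λ y → sumOver (allVecs xs m) (λ v → f (v ∷ʳ y)))
  sumOver-allVecs-∷ʳ xs zero f = sumOver-allVecs-∷ xs zero f
  sumOver-allVecs-∷ʳ xs (suc m) f = begin
    sumOver (allVecs xs (suc (suc m))) f ≈⟨ sumOver-allVecs-∷ xs (suc m) f ⟩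
    sumOver xs (λ x → sumOver (allVecs xs (suc m)) (λ v → f (x ∷ v)))
      ≈⟨ sumOver-cong xs (λ x → sumOver-allVecs-∷ʳ xs m (λ v → f (x ∷ v))) ⟩
    sumOver xs (λ x → sumOver xs (λ y → sumOver (allVecs xs m) (λ v → f (x ∷ (v ∷ʳ y)))))
      ≈⟨ sumOver-swap xs xs (λ x y → sumOver (allVecs xs m) (λ v → f (x ∷ (v ∷ʳ y)))) ⟩
    sumOver xs (λ y → sumOver xs (λ x → sumOver (allVecs xs m) (λ v → f (x ∷ (v ∷ʳ y)))))
      ≈⟨ sumOver-cong xs (λ y → sumOver-allVecs-∷ xs m (λ v → f (v ∷ʳ y))) ⟨
    sumOver xs (λ y → sumOver (allVecs xs (suc m)) (λ v → f (v ∷ʳ y))) ∎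

  guard : Bool → Carrier → Carrier
  guard true x = x
  guard false x = 0#

  guard-cong : ∀ b {x y} → (b ≡ true → x ≈ y) → guard b x ≈ guard b y
  guard-cong true p = p ≡.refl
  guard-cong false p = refl

  guard-∧ : ∀ b b' x → guard (b ∧ b') x ≈ guard b (guard b' x)
  guard-∧ true b' x = refl
  guard-∧ false b' x = refl

  guard-distribˡ : ∀ b k x → guard b (k * x) ≈ k * guard b x
  guard-distribˡ true k x = refl
  guard-distribˡ false k x = sym (zeroʳ k)

  sumOver-guard : ∀ (xs : List A) b f → sumOver xs (λ x → guard b (f x)) ≈ guard b (sumOver xs f)
  sumOver-guard xs true f = refl
  sumOver-guard xs false f = sumOver-0 xs

  ∑-0 : ∀ n f → (∀ i → i < n → f i ≈ 0#) → ∑ n f ≈ 0#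
  ∑-0 zero f z = refl
  ∑-0 (suc n) f z = trans (+-cong (z 0 ℕ.z<s) (∑-0 n (f ∘ suc) (λ i i<n → z (suc i) (s≤s i<n)))) (+-identityˡ _)

  ∑-truncate : ∀ {s B} f → s ≤ B → ∑ (suc B) (λ y → guard (y ≤ᵇ s) (f y)) ≈ ∑ (suc s) f
  ∑-truncate {zero} {B} f _ = +-congˡ (∑-0 B _ (λ _ _ → refl))
  ∑-truncate {suc s} {suc B} f (s≤s s≤B) = +-congˡ (trans (shift (suc B) s f) (∑-truncate (f ∘ suc) s≤B))
    where
    shift : ∀ n s (f : ℕ → Carrier) → ∑ n (λ y → guard (suc y ≤ᵇ suc s) (f (suc y)))
      ≈ ∑ n (λ y → guard (y ≤ᵇ s) (f (suc y)))
    shift n s f = PowerSeries.∑-cong R n (λ { zero _ → refl ; (suc y) _ → refl })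

  ∏ : ℕ → (ℕ → Carrier) → Carrier
  ∏ zero f = 1#
  ∏ (suc n) f = ∏ n f * f n

  ∏-cong : ∀ n {f g} → (∀ i → i < n → f i ≈ g i) → ∏ n f ≈ ∏ n g
  ∏-cong zero p = refl
  ∏-cong (suc n) p = *-cong (∏-cong n (λ i i<n → p i (ℕₚ.m<n⇒m<1+n i<n))) (p n ℕₚ.≤-refl)

  ∏-* : ∀ n f g → ∏ n (λ i → f i * g i) ≈ ∏ n f * ∏ n g
  ∏-* zero f g = sym (*-identityˡ _)
  ∏-* (suc n) f g = trans (*-congʳ (∏-* n f g)) (*-interchange _ _ _ _)

  ∏-split : ∀ m k f → ∏ (k ℕ.+ m) f ≈ ∏ m f * ∏ k (λ i → f (i ℕ.+ m))
  ∏-split m zero f = sym (*-identityʳ _)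
  ∏-split m (suc k) f = trans (*-congʳ (∏-split m k f)) (*-assoc _ _ _)

  ∏-∷ : ∀ n f → ∏ (suc n) f ≈ f 0 * ∏ n (f ∘ suc)
  ∏-∷ zero f = *-comm _ _
  ∏-∷ (suc n) f = trans (*-congʳ (∏-∷ n f)) (*-assoc _ _ _)

module RowSums {c ℓ} (QR : QRing c ℓ) (B : ℕ) where
  open QRing QR
  open DifferenceSolver R
  open PowerSeries R
  open RowSeries QR
  open Sums R
  open import Relation.Binary.Reasoning.Setoid setoid

  rowWeight : ℕ → (ℕ → ℕ) → Carrier
  rowWeight l x = ∏ l (λ j → H 1 (x j))

  rowSum : (l m s : ℕ) → ((ℕ → ℕ) → Carrier) → Carrier
  rowSum l m s F = sumOver (allVecs (upTo (suc B)) l)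
    (λ v → guard (rowᵇ l m s (at 0 v)) (rowWeight l (at 0 v) * F (at 0 v)))

  rowSum-cong : ∀ l m s {F G} → (∀ x → rowᵇ l m s x ≡ true → F x ≈ G x) → rowSum l m s F ≈ rowSum l m s G
  rowSum-cong l m s p = sumOver-cong (allVecs (upTo (suc B)) l)
    (λ v → guard-cong (rowᵇ l m s (at 0 v)) (λ b → *-congˡ (p (at 0 v) b)))

  rowSum-distribˡ : ∀ l m s k F → rowSum l m s (λ x → k * F x) ≈ k * rowSum l m s F
  rowSum-distribˡ l m s k F = trans
    (sumOver-cong (allVecs (upTo (suc B)) l) (λ v → trans
      (guard-cong (rowᵇ l m s (at 0 v)) (λ _ → swap (rowWeight l (at 0 v)) (F (at 0 v))))
      (guard-distribˡ (rowᵇ l m s (at 0 v)) k (rowWeight l (at 0 v) * F (at 0 v)))))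
    (sumOver-distribˡ (allVecs (upTo (suc B)) l) k _)
    where
    swap : ∀ x y → x * (k * y) ≈ k * (x * y)
    swap = solve 3 (λ k x y → x :* (k :* y) := k :* (x :* y)) refl k

  rowSum-full : ∀ l {m m'} s F → l ≤ m → l ≤ m' → rowSum l m s F ≈ rowSum l m' s F
  rowSum-full l s F p p' = sumOver-cong (allVecs (upTo (suc B)) l)
    (λ v → reflexive (≡.cong (λ b → guard b (rowWeight l (at 0 v) * F (at 0 v))) (rowᵇ-full l s (at 0 v) p p')))

  -- `F` receives the row as a function on ℕ, and `at 0 (v ∷ʳ y)` agrees with `at 0 v` only
  -- pointwise below l. `FG` therefore expresses `F` by a family `G` in which the last entry is
  -- explicit.
  rowSum-∷ʳ : ∀ l m s F (G : ℕ → (ℕ → ℕ) → Carrier) →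
    (∀ x x' → (∀ j → j < l → x' j ≡ x j) → F x' ≈ G (x' l) x) →
    rowSum (suc l) m s F ≈
      ∑ (suc B) (λ y → guard ((y ≡ᵇ 0) ∨ (l <ᵇ m)) (guard (y ≤ᵇ s) (H 1 y * rowSum l m (s ∸ y) (G y))))
  rowSum-∷ʳ l m s F G FG = begin
    rowSum (suc l) m s F ≈⟨ sumOver-allVecs-∷ʳ (upTo (suc B)) l _ ⟩
    sumOver (upTo (suc B)) (λ y → sumOver vs (λ v → t (v ∷ʳ y)))
      ≈⟨ sumOver-cong (upTo (suc B)) peel ⟩
    sumOver (upTo (suc B)) (λ y → guard (g₁ y) (guard (y ≤ᵇ s) (H 1 y * rowSum l m (s ∸ y) (G y))))
      ≈⟨ sumOver-applyUpTo (suc B) (λ i → i) (λ y → guard (g₁ y)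
          (guard (y ≤ᵇ s) (H 1 y * rowSum l m (s ∸ y) (G y)))) ⟩
    ∑ (suc B) (λ y → guard (g₁ y) (guard (y ≤ᵇ s) (H 1 y * rowSum l m (s ∸ y) (G y)))) ∎
    where
    vs = allVecs (upTo (suc B)) l
    g₁ : ℕ → Bool
    g₁ y = (y ≡ᵇ 0) ∨ (l <ᵇ m)
    t : Vec ℕ (suc l) → Carrier
    t v = guard (rowᵇ (suc l) m s (at 0 v)) (rowWeight (suc l) (at 0 v) * F (at 0 v))
    t' : ℕ → Vec ℕ l → Carrier
    t' y v = guard (rowᵇ l m (s ∸ y) (at 0 v)) (rowWeight l (at 0 v) * G y (at 0 v))
    entryStep : ∀ y v → t (v ∷ʳ y) ≈ guard (g₁ y) (guard (y ≤ᵇ s) (H 1 y * t' y v))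
    entryStep y v = begin
      t (v ∷ʳ y) ≡⟨ ≡.cong (λ b → guard b (rowWeight (suc l) x' * F x')) bool ⟩
      guard (g₁ y ∧ ((y ≤ᵇ s) ∧ rowᵇ l m (s ∸ y) x)) (rowWeight (suc l) x' * F x')
        ≈⟨ trans (guard-∧ (g₁ y) _ _) (guard-cong (g₁ y) (λ _ → guard-∧ (y ≤ᵇ s) _ _)) ⟩
      guard (g₁ y) (guard (y ≤ᵇ s) (guard (rowᵇ l m (s ∸ y) x) (rowWeight (suc l) x' * F x')))
        ≈⟨ guard-cong (g₁ y) (λ _ → guard-cong (y ≤ᵇ s) (λ _ → trans
             (guard-cong (rowᵇ l m (s ∸ y) x) (λ _ → val))
             (guard-distribˡ (rowᵇ l m (s ∸ y) x) (H 1 y) _))) ⟩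
      guard (g₁ y) (guard (y ≤ᵇ s) (H 1 y * t' y v)) ∎
      where
      x = at 0 v
      x' = at 0 (v ∷ʳ y)
      low : ∀ j → j < l → x' j ≡ x j
      low j = at-∷ʳ-< 0 v y
      last : x' l ≡ y
      last = at-∷ʳ-last 0 v y
      bool : rowᵇ (suc l) m s x' ≡ g₁ y ∧ ((y ≤ᵇ s) ∧ rowᵇ l m (s ∸ y) x)
      bool = ≡.trans (≡.cong (λ z → g₁ z ∧ ((z ≤ᵇ s) ∧ rowᵇ l m (s ∸ z) x')) last)
        (≡.cong (λ b → g₁ y ∧ ((y ≤ᵇ s) ∧ b)) (rowᵇ-cong l m (s ∸ y) low))
      val : rowWeight (suc l) x' * F x' ≈ H 1 y * (rowWeight l x * G y x)
      val = begin
        rowWeight l x' * H 1 (x' l) * F x'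
          ≈⟨ *-cong (*-cong (∏-cong l (λ j j<l → reflexive (≡.cong (H 1) (low j j<l))))
              (reflexive (≡.cong (H 1) last)))
               (trans (FG x x' low) (reflexive (≡.cong (λ z → G z x) last))) ⟩
        rowWeight l x * H 1 y * G y x
          ≈⟨ solve 3 (λ a b c → a :* b :* c := b :* (a :* c)) refl (rowWeight l x) (H 1 y) (G y x) ⟩
        H 1 y * (rowWeight l x * G y x) ∎
    peel : ∀ y → sumOver vs (λ v → t (v ∷ʳ y)) ≈ guard (g₁ y) (guard (y ≤ᵇ s) (H 1 y * rowSum l m (s ∸ y) (G y)))
    peel y = begin
      sumOver vs (λ v → t (v ∷ʳ y)) ≈⟨ sumOver-cong vs (entryStep y) ⟩
      sumOver vs (λ v → guard (g₁ y) (guard (y ≤ᵇ s) (H 1 y * t' y v))) ≈⟨ sumOver-guard vs (g₁ y) _ ⟩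
      guard (g₁ y) (sumOver vs (λ v → guard (y ≤ᵇ s) (H 1 y * t' y v)))
        ≈⟨ guard-cong (g₁ y) (λ _ → trans (sumOver-guard vs (y ≤ᵇ s) _)
             (guard-cong (y ≤ᵇ s) (λ _ → sumOver-distribˡ vs (H 1 y) (t' y)))) ⟩
      guard (g₁ y) (guard (y ≤ᵇ s) (H 1 y * rowSum l m (s ∸ y) (G y))) ∎

  -- The share of the row x in the factor of vertex i once x has been added to the demands; `S i`
  -- holds what the bracket exponent was before.
  rowFactor : ℕ → (ℕ → ℕ) → (ℕ → ℕ) → ℕ → Carrier
  rowFactor l S x i = u ^ (i ℕ.* x i) * br i (S i ℕ.+ (suc i ℕ.* x i ℕ.+ above i l x))

  -- Summing out the last entry y first turns every S i into S i + y, so that the remaining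
  -- row, of total s ∸ y, contributes brackets independent of y.
  rowSum-product : ∀ l m → m ≤ l → ∀ S s → s ≤ B →
    rowSum l m s (λ x → ∏ m (rowFactor l S x)) ≈ ∏ m (λ i → br i (S i ℕ.+ s)) * H m s
  rowSum-product zero zero _ S zero _ = +-identityʳ _
  -- No empty row has positive total; on the other side `H 0 (suc s)` contains ⟨0⟩, which is
  -- `1# - 1#`.
  rowSum-product zero zero _ S (suc s) _ = sym (begin
    1# * (⟨ 1 ⟩ * (1# - 1#) * x * y)
      ≈⟨ solve 3 (λ a x y → con (1 , 0) :* (a :* (con (1 , 0) :- con (1 , 0)) :* x :* y) := con (0 , 0)
          :+ con (0 , 0)) refl ⟨ 1 ⟩ x y ⟩
    0# + 0# ∎)
    where
    x = (u ^ 0) ^ suc s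
    y = geo (q ^ 1) (suc s)
  rowSum-product (suc l) m m≤1+l S s s≤B with ℕₚ.m≤n⇒m<n∨m≡n m≤1+l
  -- Here the last entry lies outside the support, so only y = 0 survives.
  ... | inj₁ (s≤s m≤l) = begin
    rowSum (suc l) m s (λ x → ∏ m (rowFactor (suc l) S x)) ≈⟨ rowSum-∷ʳ l m s _ G FG ⟩
    1# * rowSum l m s (G 0) + ∑ B (λ y → guard (l <ᵇ m)
        (guard (suc y ≤ᵇ s) (H 1 (suc y) * rowSum l m (s ∸ suc y) (G (suc y)))))
      ≈⟨ +-cong (*-identityˡ _) (∑-0 B _ (λ y _ → vanish
          (guard (suc y ≤ᵇ s) (H 1 (suc y) * rowSum l m (s ∸ suc y) (G (suc y)))))) ⟩
    rowSum l m s (G 0) + 0# ≈⟨ +-identityʳ _ ⟩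
    rowSum l m s (G 0) ≈⟨ rowSum-cong l m s (λ x _ → G₀ x) ⟩
    rowSum l m s (λ x → ∏ m (rowFactor l S x)) ≈⟨ rowSum-product l m m≤l S s s≤B ⟩
    ∏ m (λ i → br i (S i ℕ.+ s)) * H m s ∎
    where
    G : ℕ → (ℕ → ℕ) → Carrier
    G y x = ∏ m (λ i → u ^ (i ℕ.* x i) * br i (S i ℕ.+ (suc i ℕ.* x i ℕ.+ (above i l x ℕ.+ y))))
    vanish : ∀ z → guard (l <ᵇ m) z ≈ 0#
    vanish z = reflexive (≡.cong (λ b → guard b z) (<ᵇ-false m≤l))
    G₀ : ∀ x → G 0 x ≈ ∏ m (rowFactor l S x)
    G₀ x = ∏-cong m (λ i _ → reflexive (≡.cong (λ z → u ^ (i ℕ.* x i) * br i (S i ℕ.+ (suc i ℕ.* x i ℕ.+ z)))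
      (ℕₚ.+-identityʳ (above i l x))))
    FG : ∀ x x' → (∀ j → j < l → x' j ≡ x j) → ∏ m (rowFactor (suc l) S x') ≈ G (x' l) x
    FG x x' low = ∏-cong m (λ i i<m → reflexive (≡.cong₂ (λ y z → u ^ (i ℕ.* y) * br i (S i ℕ.+ (suc i ℕ.* y ℕ.+ z)))
      (low i (ℕₚ.<-≤-trans i<m m≤l))
      (≡.trans (above-suc i l x' (ℕₚ.<-≤-trans i<m m≤l)) (≡.cong (ℕ._+ x' l) (above-cong i l low)))))
  -- Here the last entry is allowed. It has nothing above it, so its own factor depends on y alone,
  -- and `H-step` performs the sum over y.
  ... | inj₂ ≡.refl = begin
    rowSum (suc l) (suc l) s (λ x → ∏ (suc l) (rowFactor (suc l) S x)) ≈⟨ rowSum-∷ʳ l (suc l) s _ G FG ⟩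
    ∑ (suc B) (λ y → guard ((y ≡ᵇ 0) ∨ (l <ᵇ suc l)) (guard (y ≤ᵇ s) (H 1 y * rowSum l (suc l) (s ∸ y) (G y))))
      ≈⟨ ∑-cong (suc B) (λ y _ → reflexive (≡.cong (λ b → guard b
          (guard (y ≤ᵇ s) (H 1 y * rowSum l (suc l) (s ∸ y) (G y)))) (allowed y))) ⟩
    ∑ (suc B) (λ y → guard (y ≤ᵇ s) (H 1 y * rowSum l (suc l) (s ∸ y) (G y)))
      ≈⟨ ∑-truncate (λ y → H 1 y * rowSum l (suc l) (s ∸ y) (G y)) s≤B ⟩
    ∑ (suc s) (λ y → H 1 y * rowSum l (suc l) (s ∸ y) (G y))
      ≈⟨ ∑-cong (suc s) (λ y y≤s → inner y (ℕₚ.≤-pred y≤s)) ⟩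
    ∑ (suc s) (λ y → P * (H 1 y * (u ^ (l ℕ.* y) * br l (S l ℕ.+ suc l ℕ.* y)) * H l (s ∸ y)))
      ≈⟨ ∑-distribˡ (suc s) P (λ y → H 1 y * last y * H l (s ∸ y)) ⟩
    P * ∑ (suc s) (λ y → H 1 y * (u ^ (l ℕ.* y) * br l (S l ℕ.+ suc l ℕ.* y)) * H l (s ∸ y))
      ≈⟨ *-congˡ (H-step l (S l) s) ⟩
    P * (br l (S l ℕ.+ s) * H (suc l) s) ≈⟨ *-assoc _ _ _ ⟨
    P * br l (S l ℕ.+ s) * H (suc l) s ∎
    where
    P = ∏ l (λ i → br i (S i ℕ.+ s))
    last : ℕ → Carrier
    last y = u ^ (l ℕ.* y) * br l (S l ℕ.+ suc l ℕ.* y)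
    G : ℕ → (ℕ → ℕ) → Carrier
    G y x = last y * ∏ l (rowFactor l (λ i → S i ℕ.+ y) x)
    regroup : ∀ s a b y → s ℕ.+ (a ℕ.+ (b ℕ.+ y)) ≡ s ℕ.+ y ℕ.+ (a ℕ.+ b)
    regroup s a b y = ≡.trans (≡.cong (s ℕ.+_) (≡.trans (≡.sym (ℕₚ.+-assoc a b y)) (ℕₚ.+-comm (a ℕ.+ b) y)))
      (≡.sym (ℕₚ.+-assoc s y (a ℕ.+ b)))
    FG : ∀ x x' → (∀ j → j < l → x' j ≡ x j) → ∏ (suc l) (rowFactor (suc l) S x') ≈ G (x' l) x
    FG x x' low = trans (*-comm _ _) (*-cong
      (*-congˡ (reflexive (≡.cong (λ z → br l (S l ℕ.+ z))
          (≡.trans (≡.cong (suc l ℕ.* x' l ℕ.+_) (above-low l (suc l) x' ℕₚ.≤-refl)) (ℕₚ.+-identityʳ _)))))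
      (∏-cong l (λ i i<l → reflexive (≡.cong₂ (λ y z → u ^ (i ℕ.* y) * br i z) (low i i<l)
        (≡.trans (≡.cong₂ (λ y z → S i ℕ.+ (suc i ℕ.* y ℕ.+ z)) (low i i<l)
          (≡.trans (above-suc i l x' i<l) (≡.cong (ℕ._+ x' l) (above-cong i l low))))
          (regroup (S i) (suc i ℕ.* x i) (above i l x) (x' l)))))))
    allowed : ∀ y → (y ≡ᵇ 0) ∨ (l <ᵇ suc l) ≡ true
    allowed y = ≡.trans (≡.cong ((y ≡ᵇ 0) ∨_) (<ᵇ-true (ℕₚ.n<1+n l))) (∨-zeroʳ (y ≡ᵇ 0))
    inner : ∀ y → y ≤ s → H 1 y * rowSum l (suc l) (s ∸ y) (G y) ≈ P * (H 1 y * last y * H l (s ∸ y))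
    inner y y≤s = begin
      H 1 y * rowSum l (suc l) (s ∸ y) (G y)
        ≈⟨ *-congˡ (trans (rowSum-distribˡ l (suc l) (s ∸ y) (last y)
            (λ x → ∏ l (rowFactor l (λ i → S i ℕ.+ y) x)))
                (*-congˡ (rowSum-full l (s ∸ y) (λ x → ∏ l (rowFactor l (λ i → S i ℕ.+ y) x))
                    (ℕₚ.n≤1+n l) ℕₚ.≤-refl))) ⟩
      H 1 y * (last y * rowSum l l (s ∸ y) (λ x → ∏ l (rowFactor l (λ i → S i ℕ.+ y) x)))
        ≈⟨ *-congˡ (*-congˡ (rowSum-product l l ℕₚ.≤-refl (λ i → S i ℕ.+ y) (s ∸ y)
            (ℕₚ.≤-trans (ℕₚ.m∸n≤m s y) s≤B))) ⟩
      H 1 y * (last y * (∏ l (λ i → br i (S i ℕ.+ y ℕ.+ (s ∸ y))) * H l (s ∸ y)))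
        ≈⟨ *-congˡ (*-congˡ (*-congʳ (∏-cong l (λ i _ → reflexive (≡.cong (br i)
             (≡.trans (ℕₚ.+-assoc (S i) y (s ∸ y)) (≡.cong (S i ℕ.+_) (ℕₚ.m+[n∸m]≡n y≤s)))))))) ⟩
      H 1 y * (last y * (P * H l (s ∸ y)))
        ≈⟨ solve 4 (λ w a p h → w :* (a :* (p :* h)) := p :* (w :* a :* h)) refl (H 1 y) (last y) P (H l (s ∸ y)) ⟩
      P * (H 1 y * last y * H l (s ∸ y)) ∎

-- In flowᵇ the edges out of r are r → j for j < m r. The total of row r is the demand at r (none at
-- the sink 0), and its entries are added to the demands of the smaller vertices.
demand : ℕ → (ℕ → ℕ) → ℕ
demand zero e = 0
demand r@(suc _) e = e r

flowᵇ : (N : ℕ) (m : ℕ → ℕ) (r : ℕ) → (ℕ → ℕ → ℕ) → (ℕ → ℕ) → Bool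
flowᵇ N m zero M e = true
flowᵇ N m (suc r) M e = rowᵇ N (m r) (demand r e) (M r) ∧ flowᵇ N m r M (λ j → e j ℕ.+ M r j)

flowᵇ-cong : ∀ N m r {M M'} e → (∀ i → i < r → M i ≡ M' i) → flowᵇ N m r M e ≡ flowᵇ N m r M' e
flowᵇ-cong N m zero e p = ≡.refl
flowᵇ-cong N m (suc r) {M} {M'} e p rewrite p r ℕₚ.≤-refl =
  ≡.cong (rowᵇ N (m r) (demand r e) (M' r) ∧_)
    (flowᵇ-cong N m r (λ j → e j ℕ.+ M' r j) (λ i i<r → p i (ℕₚ.m<n⇒m<1+n i<r)))

cell : ∀ {N r} → Vec (Vec ℕ N) r → ℕ → ℕ → ℕ
cell M i = at 0 (at (Vec.replicate _ 0) M i)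

module FlowSums {c ℓ} (QR : QRing c ℓ) (B N : ℕ) (m : ℕ → ℕ) where
  open QRing QR
  open DifferenceSolver R
  open RowSeries QR
  open Sums R
  open RowSums QR B
  open import Algebra.Properties.Semiring.Exp semiring using (^-homo-*)
  open import Relation.Binary.Reasoning.Setoid setoid

  rows : List (Vec ℕ N)
  rows = allVecs (upTo (suc B)) N

  flowSum : ℕ → (ℕ → ℕ) → Carrier
  flowSum r e = sumOver (allVecs rows r)
    (λ M → guard (flowᵇ N m r (cell M) e) (∏ r (λ i → rowWeight N (cell M i))))

  flowSum-suc : ∀ r e → flowSum (suc r) e ≈ rowSum N (m r) (demand r e) (λ x → flowSum r (λ j → e j ℕ.+ x j))
  flowSum-suc r e = trans (sumOver-allVecs-∷ʳ rows r _) (sumOver-cong rows peel)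
    where
    t : Vec (Vec ℕ N) (suc r) → Carrier
    t M = guard (flowᵇ N m (suc r) (cell M) e) (∏ (suc r) (λ i → rowWeight N (cell M i)))
    t' : Vec ℕ N → Vec (Vec ℕ N) r → Carrier
    t' v M = guard (flowᵇ N m r (cell M) (λ j → e j ℕ.+ at 0 v j)) (∏ r (λ i → rowWeight N (cell M i)))
    step : ∀ v M → t (M ∷ʳ v) ≈ guard (rowᵇ N (m r) (demand r e) (at 0 v)) (rowWeight N (at 0 v) * t' v M)
    step v M = begin
      t (M ∷ʳ v) ≡⟨ ≡.cong (λ b → guard b (∏ (suc r) (λ i → rowWeight N (cell (M ∷ʳ v) i)))) bool ⟩
      guard (b₁ ∧ b₂) (∏ r (λ i → rowWeight N (cell (M ∷ʳ v) i)) * rowWeight N (cell (M ∷ʳ v) r))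
        ≈⟨ trans (guard-∧ b₁ b₂ _) (guard-cong b₁ (λ _ → guard-cong b₂ (λ _ → val))) ⟩
      guard b₁ (guard b₂ (rowWeight N (at 0 v) * ∏ r (λ i → rowWeight N (cell M i))))
        ≈⟨ guard-cong b₁ (λ _ → guard-distribˡ b₂ _ _) ⟩
      guard b₁ (rowWeight N (at 0 v) * t' v M) ∎
      where
      b₁ = rowᵇ N (m r) (demand r e) (at 0 v)
      b₂ = flowᵇ N m r (cell M) (λ j → e j ℕ.+ at 0 v j)
      last : cell (M ∷ʳ v) r ≡ at 0 v
      last = ≡.cong (at 0) (at-∷ʳ-last (Vec.replicate _ 0) M v)
      low : ∀ i → i < r → cell (M ∷ʳ v) i ≡ cell M i
      low i i<r = ≡.cong (at 0) (at-∷ʳ-< (Vec.replicate _ 0) M v i<r)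
      bool : flowᵇ N m (suc r) (cell (M ∷ʳ v)) e ≡ b₁ ∧ b₂
      bool = ≡.trans
        (≡.cong (λ x → rowᵇ N (m r) (demand r e) x ∧ flowᵇ N m r (cell (M ∷ʳ v)) (λ j → e j ℕ.+ x j)) last)
        (≡.cong (b₁ ∧_) (flowᵇ-cong N m r _ low))
      val : ∏ r (λ i → rowWeight N (cell (M ∷ʳ v) i)) * rowWeight N (cell (M ∷ʳ v) r)
        ≈ rowWeight N (at 0 v) * ∏ r (λ i → rowWeight N (cell M i))
      val = trans (*-cong (∏-cong r (λ i i<r → reflexive (≡.cong (rowWeight N) (low i i<r))))
        (reflexive (≡.cong (rowWeight N) last))) (*-comm _ _)
    peel : ∀ v → sumOver (allVecs rows r) (λ M → t (M ∷ʳ v))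
      ≈ guard (rowᵇ N (m r) (demand r e) (at 0 v)) (rowWeight N (at 0 v) * flowSum r (λ j → e j ℕ.+ at 0 v j))
    peel v = begin
      sumOver (allVecs rows r) (λ M → t (M ∷ʳ v)) ≈⟨ sumOver-cong (allVecs rows r) (step v) ⟩
      sumOver (allVecs rows r) (λ M → guard b (rowWeight N (at 0 v) * t' v M))
        ≈⟨ sumOver-guard (allVecs rows r) b _ ⟩
      guard b (sumOver (allVecs rows r) (λ M → rowWeight N (at 0 v) * t' v M))
        ≈⟨ guard-cong b (λ _ → sumOver-distribˡ (allVecs rows r) (rowWeight N (at 0 v)) (t' v)) ⟩
      guard b (rowWeight N (at 0 v) * sumOver (allVecs rows r) (t' v)) ∎
      where b = rowᵇ N (m r) (demand r e) (at 0 v)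

  ψ : ℕ → (ℕ → ℕ) → ℕ → Carrier
  ψ i e k = u ^ (i ℕ.* e i) * br i (suc i ℕ.* e i ℕ.+ above i k e)

  -- For a neighbour i < `m r`, `rowSum-product` adds the row total `e r` to the bracket exponent,
  -- which is precisely the new term j = r when the bound moves from r to r + 1. A factor with i ≥
  -- `m r` does not see the row: it involves only entries at indices from i on, and these vanish.
  rowSum-ψ : ∀ r P e (K K' : ℕ → ℕ) → r ≤ N → m r ≤ r → m r ≤ P → e r ≤ B →
    (∀ i → i < m r → K i ≡ r × K' i ≡ suc r) →
    (∀ i → m r ≤ i → i < P → K i ≡ K' i × i < N × K i ≤ N) →
    rowSum N (m r) (e r) (λ x → ∏ P (λ i → ψ i (λ j → e j ℕ.+ x j) (K i)))
      ≈ ∏ P (λ i → ψ i e (K' i)) * H (m r) (e r)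
  rowSum-ψ r P e K K' r≤N m≤r m≤P s≤B Klow Khigh = begin
    rowSum N μ s (λ x → ∏ P (λ i → ψ i (λ j → e j ℕ.+ x j) (K i))) ≈⟨ rowSum-cong N μ s factor ⟩
    rowSum N μ s (λ x → Z * ∏ μ (rowFactor N S x)) ≈⟨ rowSum-distribˡ N μ s Z (λ x → ∏ μ (rowFactor N S x)) ⟩
    Z * rowSum N μ s (λ x → ∏ μ (rowFactor N S x))
      ≈⟨ *-congˡ (rowSum-product N μ (ℕₚ.≤-trans m≤r r≤N) S s s≤B) ⟩
    Z * (∏ μ (λ i → br i (S i ℕ.+ s)) * H μ s)
      ≈⟨ solve 4 (λ x y b h → (x :* y) :* (b :* h) := ((x :* b) :* y) :* h) refl X Y _ _ ⟩
    ((X * ∏ μ (λ i → br i (S i ℕ.+ s))) * Y) * H μ s ≈⟨ *-congʳ (*-congʳ (∏-* μ _ _)) ⟨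
    (∏ μ (λ i → u ^ (i ℕ.* e i) * br i (S i ℕ.+ s)) * Y) * H μ s ≈⟨ *-congʳ (*-congʳ (∏-cong μ target)) ⟩
    (∏ μ (λ i → ψ i e (K' i)) * Y) * H μ s ≈⟨ *-congʳ (∏-split μ κ (λ i → ψ i e (K' i))) ⟨
    ∏ (κ ℕ.+ μ) (λ i → ψ i e (K' i)) * H μ s ≡⟨ ≡.cong (λ z → ∏ z (λ i → ψ i e (K' i)) * H μ s) κ+μ ⟩
    ∏ P (λ i → ψ i e (K' i)) * H μ s ∎
    where
    μ = m r
    s = e r
    κ = P ∸ μ
    κ+μ : κ ℕ.+ μ ≡ P
    κ+μ = ℕₚ.m∸n+n≡m m≤P
    S : ℕ → ℕ
    S i = suc i ℕ.* e i ℕ.+ above i r e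
    X = ∏ μ (λ i → u ^ (i ℕ.* e i))
    Y = ∏ κ (λ i → ψ (i ℕ.+ μ) e (K' (i ℕ.+ μ)))
    Z = X * Y
    target : ∀ i → i < μ → u ^ (i ℕ.* e i) * br i (S i ℕ.+ s) ≈ ψ i e (K' i)
    target i i<μ = reflexive (≡.cong (λ z → u ^ (i ℕ.* e i) * br i z)
      (≡.trans (ℕₚ.+-assoc (suc i ℕ.* e i) (above i r e) s)
        (≡.cong (suc i ℕ.* e i ℕ.+_) (≡.trans (≡.sym (above-suc i r e (ℕₚ.<-≤-trans i<μ m≤r)))
          (≡.cong (λ k → above i k e) (≡.sym (proj₂ (Klow i i<μ))))))))
    factor : ∀ x → rowᵇ N μ s x ≡ true →
      ∏ P (λ i → ψ i (λ j → e j ℕ.+ x j) (K i)) ≈ Z * ∏ μ (rowFactor N S x)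
    factor x valid = begin
      ∏ P f ≡⟨ ≡.cong (λ z → ∏ z f) κ+μ ⟨
      ∏ (κ ℕ.+ μ) f ≈⟨ ∏-split μ κ f ⟩
      ∏ μ f * ∏ κ (λ i → f (i ℕ.+ μ)) ≈⟨ *-cong (∏-cong μ low) (∏-cong κ high) ⟩
      ∏ μ (λ i → u ^ (i ℕ.* e i) * rowFactor N S x i) * Y ≈⟨ *-congʳ (∏-* μ _ _) ⟩
      (X * ∏ μ (rowFactor N S x)) * Y ≈⟨ solve 3 (λ x a y → x :* a :* y := x :* y :* a) refl X _ Y ⟩
      Z * ∏ μ (rowFactor N S x) ∎
      where
      f : ℕ → Carrier
      f i = ψ i (λ j → e j ℕ.+ x j) (K i)
      zeros : ∀ j → μ ≤ j → j < N → x j ≡ 0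
      zeros = rowᵇ-support N μ s x valid
      low : ∀ i → i < μ → f i ≈ u ^ (i ℕ.* e i) * rowFactor N S x i
      low i i<μ = begin
        u ^ (i ℕ.* (e i ℕ.+ x i)) * br i (suc i ℕ.* (e i ℕ.+ x i) ℕ.+ above i (K i) (λ j → e j ℕ.+ x j))
          ≈⟨ *-cong (trans (reflexive (≡.cong (u ^_) (ℕₚ.*-distribˡ-+ i (e i) (x i))))
              (^-homo-* u (i ℕ.* e i) (i ℕ.* x i)))
               (reflexive (≡.cong (br i) arith)) ⟩
        u ^ (i ℕ.* e i) * u ^ (i ℕ.* x i) * br i (S i ℕ.+ (suc i ℕ.* x i ℕ.+ above i N x)) ≈⟨ *-assoc _ _ _ ⟩
        u ^ (i ℕ.* e i) * rowFactor N S x i ∎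
        where
        arith : suc i ℕ.* (e i ℕ.+ x i) ℕ.+ above i (K i) (λ j → e j ℕ.+ x j)
          ≡ S i ℕ.+ (suc i ℕ.* x i ℕ.+ above i N x)
        arith = ≡.trans (≡.cong₂ ℕ._+_ (ℕₚ.*-distribˡ-+ (suc i) (e i) (x i))
          (≡.trans (≡.cong (λ k → above i k (λ j → e j ℕ.+ x j)) (proj₁ (Klow i i<μ)))
            (≡.trans (above-+ i r e x) (≡.cong (above i r e ℕ.+_)
              (≡.sym (above-vanish i r N x r≤N (λ j r≤j → zeros j (ℕₚ.≤-trans m≤r r≤j))))))))
          (ℕ-interchange (suc i ℕ.* e i) (suc i ℕ.* x i) (above i r e) (above i N x))
      high : ∀ i → i < κ → f (i ℕ.+ μ) ≈ ψ (i ℕ.+ μ) e (K' (i ℕ.+ μ))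
      high i i<κ with Khigh (i ℕ.+ μ) (ℕₚ.m≤n+m μ i) (≡.subst (i ℕ.+ μ <_) κ+μ (ℕₚ.+-monoˡ-< μ i<κ))
      ... | K≡K' , j<N , K≤N = reflexive (≡.cong₂ (λ y z → u ^ (j ℕ.* y) * br j (suc j ℕ.* y ℕ.+ z)) ej
        (≡.trans (≡.trans (above-+ j (K j) e x) (≡.trans (≡.cong (above j (K j) e ℕ.+_) xabove) (ℕₚ.+-identityʳ _)))
          (≡.cong (λ k → above j k e) K≡K')))
        where
        j = i ℕ.+ μ
        ej : e j ℕ.+ x j ≡ e j
        ej = ≡.trans (≡.cong (e j ℕ.+_) (zeros j (ℕₚ.m≤n+m μ i) j<N)) (ℕₚ.+-identityʳ _)
        xabove : above j (K j) x ≡ 0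
        xabove with ℕₚ.≤-total (K j) (suc j)
        ... | inj₁ K≤1+j = above-low j (K j) x K≤1+j
        ... | inj₂ 1+j≤K = ≡.trans
          (above-vanish j (suc j) (K j) x 1+j≤K (λ i' j<i' i'<K → zeros i'
              (ℕₚ.≤-trans (ℕₚ.m≤n+m μ i) (ℕₚ.<⇒≤ j<i')) (ℕₚ.<-≤-trans i'<K K≤N)))
          (above-low j (suc j) x ℕₚ.≤-refl)

-- The numerical content of "threshold graph on {0,…,n} with degrees d, labelled by reverse degree
-- sequence": p is the unique index with d p = p, and i < r are adjacent iff i < d r iff r ≤ d i.
record DegreeData (n : ℕ) (d : ℕ → ℕ) : Set where
  field
    p : ℕ
    p≤n : p ≤ n
    d[p]≡p : d p ≡ p
    antitone : ∀ {i j} → i ≤ j → j ≤ n → d j ≤ d i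
    bounded : ∀ {i} → i ≤ n → d i ≤ n
    below⇒above : ∀ {i r} → i < r → r ≤ n → i < d r → r ≤ d i
    above⇒below : ∀ {i r} → i < r → r ≤ n → r ≤ d i → i < d r

  outdeg : ℕ → ℕ
  outdeg r = d r ℕ.⊓ r

  outdeg-early : ∀ {r} → r ≤ p → outdeg r ≡ r
  outdeg-early r≤p = ℕₚ.m≥n⇒m⊓n≡n (ℕₚ.≤-trans r≤p (≡.subst (_≤ d _) d[p]≡p (antitone r≤p p≤n)))

  d≤p : ∀ {r} → p ≤ r → r ≤ n → d r ≤ p
  d≤p p≤r r≤n = ≡.subst (d _ ≤_) d[p]≡p (antitone p≤r r≤n)

  outdeg-late : ∀ {r} → p < r → r ≤ n → outdeg r ≡ d r
  outdeg-late p<r r≤n = ℕₚ.m≤n⇒m⊓n≡m (ℕₚ.≤-trans (d≤p (ℕₚ.<⇒≤ p<r) r≤n) (ℕₚ.<⇒≤ p<r))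

-- Closed form of the flow sum of a threshold graph

module ThresholdFlowSum {c ℓ} (QR : QRing c ℓ) (B n : ℕ) (d : ℕ → ℕ) (degrees : DegreeData n d) where
  open QRing QR
  open RowSeries QR
  open DegreeData degrees
  open DifferenceSolver R
  open PowerSeries R
  open Sums R
  open RowSums QR B
  open FlowSums QR B (suc n) outdeg
  open import Algebra.Properties.Semiring.Exp semiring using (^-assocʳ)
  open import Relation.Binary.Reasoning.Setoid setoid

  -- For j > i, adjacency to i means j ≤ d i. So the larger neighbours of i among the vertices below
  -- r are the j with i < j < `cut r i`, and the bound moves with r exactly at the neighbours i of
  -- r.
  cut : ℕ → ℕ → ℕ
  cut r i = suc (d i) ℕ.⊓ r

  cut-low : ∀ {r i} → r ≤ n → i < outdeg r → cut r i ≡ r × cut (suc r) i ≡ suc r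
  cut-low {r} {i} r≤n i<m = ℕₚ.m≥n⇒m⊓n≡n (ℕₚ.m≤n⇒m≤1+n r≤di) , ℕₚ.m≥n⇒m⊓n≡n (s≤s r≤di)
    where
    r≤di : r ≤ d i
    r≤di = below⇒above (ℕₚ.<-≤-trans i<m (ℕₚ.m⊓n≤n (d r) r)) r≤n (ℕₚ.<-≤-trans i<m (ℕₚ.m⊓n≤m (d r) r))

  cut-high : ∀ {r i} → r ≤ n → i < r → d r ≤ i → cut r i ≡ cut (suc r) i
  cut-high {r} {i} r≤n i<r dr≤i = ≡.trans (ℕₚ.m≤n⇒m⊓n≡m di<r) (≡.sym (ℕₚ.m≤n⇒m⊓n≡m (ℕₚ.m≤n⇒m≤1+n di<r)))
    where
    di<r : d i < r
    di<r = ℕₚ.≰⇒> (λ r≤di → ℕₚ.<⇒≱ (above⇒below i<r r≤n r≤di) dr≤i)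

  -- Keeps `H` on its second clause: at 0 it is 1, where the closed formula would give 0.
  Positive : ℕ → (ℕ → ℕ) → Set
  Positive r e = ∀ j → 0 < j → j < r → 0 < e j

  private
    Positive-+ : ∀ {r e} (x : ℕ → ℕ) → Positive (suc r) e → Positive r (λ j → e j ℕ.+ x j)
    Positive-+ {r} {e} x pos j 0<j j<r = ℕₚ.<-≤-trans (pos j 0<j (ℕₚ.m<n⇒m<1+n j<r)) (ℕₚ.m≤m+n (e j) (x j))

    -- A row only redistributes `e r`: the part that reaches vertices below r cannot exceed it. The
    -- total demand does not grow, and the search bound B remains large enough.
    total-next : ∀ {r e} x → r ≤ suc n → total (suc r) e ≤ B → rowᵇ (suc n) (outdeg r) (e r) x ≡ true →
      total r (λ j → e j ℕ.+ x j) ≤ B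
    total-next {r} {e} x r≤N t≤B valid = ℕₚ.≤-trans (ℕₚ.≤-reflexive (total-+ r e x))
      (ℕₚ.≤-trans (ℕₚ.+-monoʳ-≤ (total r e)
        (ℕₚ.≤-trans (total-mono x r≤N) (ℕₚ.≤-reflexive (rowᵇ-total (suc n) (outdeg r) (e r) x valid)))) t≤B)

    e≤B : ∀ {r e} → total (suc r) e ≤ B → e r ≤ B
    e≤B {r} {e} t≤B = ℕₚ.≤-trans (ℕₚ.m≤n+m (e r) (total r e)) t≤B

  flowSum-1 : ∀ e → flowSum 1 e ≈ 1#
  flowSum-1 e = begin
    flowSum 1 e ≈⟨ flowSum-suc 0 e ⟩
    rowSum (suc n) (outdeg 0) 0 (λ x → flowSum 0 (λ j → e j ℕ.+ x j))
      ≈⟨ rowSum-cong (suc n) (outdeg 0) 0 (λ _ _ → +-identityʳ 1#) ⟩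
    rowSum (suc n) (outdeg 0) 0 (λ _ → 1#)
      ≡⟨ ≡.cong (λ z → rowSum (suc n) z 0 (λ _ → 1#)) (outdeg-early {0} z≤n) ⟩
    rowSum (suc n) 0 0 (λ _ → 1#) ≈⟨ rowSum-product (suc n) 0 z≤n (λ _ → 0) 0 z≤n ⟩
    1# * 1# ≈⟨ *-identityˡ 1# ⟩
    1# ∎

  -- Since s ≤ p, each of the rows 0, ..., s goes to all smaller vertices, as in a complete graph.
  -- Row r brings ⟨1⟩⟨r⟩/⟨r+1⟩ and its own bracket; after telescoping, one factor `⟨ suc s ⟩` is
  -- left to clear.
  flowSum-complete : ∀ s → s ≤ p → ∀ e → total (suc s) e ≤ B → Positive (suc s) e →
    ⟨ suc s ⟩ * flowSum (suc s) e ≈ ⟨ 1 ⟩ ^ suc s * ∏ (suc s) (λ i → ψ i e (cut (suc s) i))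
  flowSum-complete zero _ e _ _ = trans (*-congˡ (flowSum-1 e))
    (solve 1 (λ a → a :* con (1 , 0) := a :* con (1 , 0) :* (con (1 , 0) :* (con (1 , 0) :* con (1 , 0)))) refl ⟨ 1 ⟩)
  -- The induction hypothesis evaluates `⟨ r ⟩ * flowSum r`, so the equation is multiplied by
  -- `⟨ r ⟩`; `H-closed` supplies the same factor on the other side.
  flowSum-complete (suc s) r≤p e t≤B pos = q^k-1-cancelˡ s (begin
    ⟨ r ⟩ * (⟨ suc r ⟩ * flowSum (suc r) e)
      ≈⟨ solve 3 (λ a b t → a :* (b :* t) := b :* (a :* t)) refl _ _ _ ⟩
    ⟨ suc r ⟩ * (⟨ r ⟩ * flowSum (suc r) e) ≈⟨ *-congˡ (*-congˡ (flowSum-suc r e)) ⟩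
    ⟨ suc r ⟩ * (⟨ r ⟩ * rowSum (suc n) (outdeg r) (e r) (λ x → flowSum r (λ j → e j ℕ.+ x j)))
      ≈⟨ *-congˡ (rowSum-distribˡ (suc n) (outdeg r) (e r) ⟨ r ⟩ (λ x → flowSum r (λ j → e j ℕ.+ x j))) ⟨
    ⟨ suc r ⟩ * rowSum (suc n) (outdeg r) (e r) (λ x → ⟨ r ⟩ * flowSum r (λ j → e j ℕ.+ x j))
      ≈⟨ *-congˡ (rowSum-cong (suc n) (outdeg r) (e r) (λ x valid →
           flowSum-complete s (ℕₚ.<⇒≤ r≤p) (λ j → e j ℕ.+ x j) (total-next x (ℕₚ.m≤n⇒m≤1+n r≤n) t≤B valid)
               (Positive-+ x pos))) ⟩
    ⟨ suc r ⟩ * rowSum (suc n) (outdeg r) (e r) (λ x → ⟨ 1 ⟩ ^ r * ∏ r (λ i → ψ i (λ j → e j ℕ.+ x j) (cut r i)))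
      ≈⟨ *-congˡ (rowSum-distribˡ (suc n) (outdeg r) (e r) (⟨ 1 ⟩ ^ r)
          (λ x → ∏ r (λ i → ψ i (λ j → e j ℕ.+ x j) (cut r i)))) ⟩
    ⟨ suc r ⟩ * (⟨ 1 ⟩ ^ r * rowSum (suc n) (outdeg r) (e r) (λ x → ∏ r (λ i → ψ i (λ j → e j ℕ.+ x j) (cut r i))))
      ≈⟨ *-congˡ (*-congˡ (rowSum-ψ r r e (cut r) (cut (suc r)) (ℕₚ.m≤n⇒m≤1+n r≤n) (ℕₚ.m⊓n≤n (d r) r)
          (ℕₚ.m⊓n≤n (d r) r)
           (e≤B {r} {e} t≤B) (λ i → cut-low r≤n)
           (λ i m≤i i<r → ⊥-elim (ℕₚ.<⇒≱ i<r (≡.subst (_≤ i) (outdeg-early r≤p) m≤i))))) ⟩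
    ⟨ suc r ⟩ * (⟨ 1 ⟩ ^ r * (Π * H (outdeg r) (e r)))
      ≡⟨ ≡.cong₂ (λ z z' → ⟨ suc r ⟩ * (⟨ 1 ⟩ ^ r * (Π * H z z'))) (outdeg-early r≤p) er ⟩
    ⟨ suc r ⟩ * (⟨ 1 ⟩ ^ r * (Π * H r (suc a)))
      ≈⟨ solve 4 (λ a b c h → a :* (b :* (c :* h)) := b :* c :* (a :* h)) refl _ _ _ _ ⟩
    ⟨ 1 ⟩ ^ r * Π * (⟨ suc r ⟩ * H r (suc a)) ≈⟨ *-congˡ (H-closed r a) ⟩
    ⟨ 1 ⟩ ^ r * Π * (⟨ 1 ⟩ * ⟨ r ⟩ * (u ^ (r ℕ.* suc a) * ⟨ suc r ℕ.* suc a ⟩)) ≈⟨ *-congˡ (*-congˡ ψr) ⟨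
    ⟨ 1 ⟩ ^ r * Π * (⟨ 1 ⟩ * ⟨ r ⟩ * ψ r e (cut (suc r) r))
      ≈⟨ solve 5 (λ b c d r x → b :* c :* (d :* r :* x) := r :* (d :* b :* (c :* x))) refl _ _ _ _ _ ⟩
    ⟨ r ⟩ * (⟨ 1 ⟩ ^ suc r * (Π * ψ r e (cut (suc r) r))) ∎)
    where
    r = suc s
    r≤n = ℕₚ.≤-trans r≤p p≤n
    a = ℕ.pred (e r)
    er : e r ≡ suc a
    er = ≡.sym (ℕₚ.suc-pred (e r) {{ℕ.>-nonZero (pos r ℕ.z<s ℕₚ.≤-refl)}})
    Π = ∏ r (λ i → ψ i e (cut (suc r) i))
    ψr : ψ r e (cut (suc r) r) ≈ u ^ (r ℕ.* suc a) * ⟨ suc r ℕ.* suc a ⟩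
    ψr = reflexive (≡.cong₂ (λ y z → u ^ (r ℕ.* y) * ⟨ z ⟩) er
      (≡.trans (≡.cong₂ ℕ._+_ (≡.cong (suc r ℕ.*_) er) (above-low r (cut (suc r) r) e
          (ℕₚ.m⊓n≤n (suc (d r)) (suc r)))) (ℕₚ.+-identityʳ _)))

  -- A row r > p has support below `d r` ≤ p. It extends brackets of the vertices up to p only and
  -- leaves the demands of the other vertices beyond p alone, so their `H` factors do not depend on
  -- the row and leave the sum.
  flowSum-threshold : ∀ k → k ℕ.+ suc p ≤ suc n → ∀ e → total (k ℕ.+ suc p) e ≤ B → Positive (k ℕ.+ suc p) e →
    ⟨ suc p ⟩ * flowSum (k ℕ.+ suc p) e ≈
      ⟨ 1 ⟩ ^ suc p * ∏ (suc p) (λ i → ψ i e (cut (k ℕ.+ suc p) i)) * ∏ k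
          (λ j → H (d (j ℕ.+ suc p)) (e (j ℕ.+ suc p)))
  flowSum-threshold zero _ e t≤B pos = trans (flowSum-complete p ℕₚ.≤-refl e t≤B pos) (sym (*-identityʳ _))
  flowSum-threshold (suc k) (s≤s r≤n) e t≤B pos = begin
    ⟨ suc p ⟩ * flowSum (suc r) e ≈⟨ *-congˡ (flowSum-suc r e) ⟩
    ⟨ suc p ⟩ * rowSum (suc n) (outdeg r) (demand r e) (λ x → flowSum r (λ j → e j ℕ.+ x j))
      ≡⟨ ≡.cong (λ z → ⟨ suc p ⟩ * rowSum (suc n) (outdeg r) z (λ x → flowSum r (λ j → e j ℕ.+ x j)))
          (demand-pos p<r) ⟩
    ⟨ suc p ⟩ * rowSum (suc n) (outdeg r) (e r) (λ x → flowSum r (λ j → e j ℕ.+ x j))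
      ≈⟨ rowSum-distribˡ (suc n) (outdeg r) (e r) ⟨ suc p ⟩ (λ x → flowSum r (λ j → e j ℕ.+ x j)) ⟨
    rowSum (suc n) (outdeg r) (e r) (λ x → ⟨ suc p ⟩ * flowSum r (λ j → e j ℕ.+ x j))
      ≈⟨ rowSum-cong (suc n) (outdeg r) (e r) inner ⟩
    rowSum (suc n) (outdeg r) (e r) (λ x → C * Θ * ∏ (suc p) (λ i → ψ i (λ j → e j ℕ.+ x j) (cut r i)))
      ≈⟨ rowSum-distribˡ (suc n) (outdeg r) (e r) (C * Θ)
          (λ x → ∏ (suc p) (λ i → ψ i (λ j → e j ℕ.+ x j) (cut r i))) ⟩
    C * Θ * rowSum (suc n) (outdeg r) (e r) (λ x → ∏ (suc p) (λ i → ψ i (λ j → e j ℕ.+ x j) (cut r i)))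
      ≈⟨ *-congˡ (rowSum-ψ r (suc p) e (cut r) (cut (suc r)) r≤N (ℕₚ.m⊓n≤n (d r) r) m≤1+p (e≤B {r} {e} t≤B)
          (λ i → cut-low r≤n) high) ⟩
    C * Θ * (∏ (suc p) (λ i → ψ i e (cut (suc r) i)) * H (outdeg r) (e r))
      ≡⟨ ≡.cong (λ z → C * Θ * (∏ (suc p) (λ i → ψ i e (cut (suc r) i)) * H z (e r))) (outdeg-late p<r r≤n) ⟩
    C * Θ * (∏ (suc p) (λ i → ψ i e (cut (suc r) i)) * H (d r) (e r))
      ≈⟨ solve 4 (λ c t x h → c :* t :* (x :* h) := c :* x :* (t :* h)) refl _ _ _ _ ⟩
    C * ∏ (suc p) (λ i → ψ i e (cut (suc r) i)) * (Θ * H (d r) (e r)) ∎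
    where
    r = k ℕ.+ suc p
    C = ⟨ 1 ⟩ ^ suc p
    Θ = ∏ k (λ j → H (d (j ℕ.+ suc p)) (e (j ℕ.+ suc p)))
    r≤N = ℕₚ.m≤n⇒m≤1+n r≤n
    p<r : p < r
    p<r = ℕₚ.m≤n+m (suc p) k
    demand-pos : ∀ {r} → p < r → demand r e ≡ e r
    demand-pos {suc _} _ = ≡.refl
    m≤p : outdeg r ≤ p
    m≤p = ℕₚ.≤-trans (ℕₚ.m⊓n≤m (d r) r) (d≤p (ℕₚ.<⇒≤ p<r) r≤n)
    m≤1+p = ℕₚ.m≤n⇒m≤1+n m≤p
    high : ∀ i → outdeg r ≤ i → i < suc p → cut r i ≡ cut (suc r) i × i < suc n × cut r i ≤ suc n
    high i m≤i (s≤s i≤p) = cut-high r≤n (ℕₚ.≤-<-trans i≤p p<r) (≡.subst (_≤ i) (outdeg-late p<r r≤n) m≤i)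
      , s≤s (ℕₚ.≤-trans i≤p p≤n) , ℕₚ.≤-trans (ℕₚ.m⊓n≤n (suc (d i)) r) r≤N
    inner : ∀ x → rowᵇ (suc n) (outdeg r) (e r) x ≡ true →
      ⟨ suc p ⟩ * flowSum r (λ j → e j ℕ.+ x j) ≈ C * Θ * ∏ (suc p) (λ i → ψ i (λ j → e j ℕ.+ x j) (cut r i))
    inner x valid = begin
      ⟨ suc p ⟩ * flowSum r (λ j → e j ℕ.+ x j)
        ≈⟨ flowSum-threshold k r≤N (λ j → e j ℕ.+ x j) (total-next x r≤N t≤B valid) (Positive-+ x pos) ⟩
      C * Ψ * ∏ k (λ j → H (d (j ℕ.+ suc p)) (e (j ℕ.+ suc p) ℕ.+ x (j ℕ.+ suc p)))
        ≈⟨ *-congˡ (∏-cong k (λ j j<k → reflexive (≡.cong (H (d (j ℕ.+ suc p)))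
             (≡.trans (≡.cong (e (j ℕ.+ suc p) ℕ.+_) (zeros j j<k)) (ℕₚ.+-identityʳ _))))) ⟩
      C * Ψ * Θ ≈⟨ solve 3 (λ a b c → a :* b :* c := a :* c :* b) refl _ _ _ ⟩
      C * Θ * Ψ ∎
      where
      Ψ = ∏ (suc p) (λ i → ψ i (λ j → e j ℕ.+ x j) (cut r i))
      zeros : ∀ j → j < k → x (j ℕ.+ suc p) ≡ 0
      zeros j j<k = rowᵇ-support (suc n) (outdeg r) (e r) x valid (j ℕ.+ suc p)
        (ℕₚ.≤-trans m≤1+p (ℕₚ.m≤n+m (suc p) j)) (ℕₚ.<-≤-trans (ℕₚ.+-monoˡ-< (suc p) j<k) r≤N)

  bracket : (ℕ → ℕ) → ℕ → Carrier
  bracket a i =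
    if i <ᵇ d i then geo q (suc i ℕ.* a i ℕ.+ above i (suc (d i)) a)
    else if d i <ᵇ i then geo (q ^ suc (d i)) (a i) * geo q (d i)
    else geo (q ^ suc i) (a i)

  private
    -- The value at 0 is an extra factor that lets vertex 0 satisfy `β-early` and `β-pivot` like the
    -- other vertices. `flowSum-brackets` compensates by multiplying with `⟨ 1 ⟩` and cancelling it.
    β : (ℕ → ℕ) → ℕ → Carrier
    β a zero = ⟨ 1 ⟩
    β a i@(suc _) = ⟨ 1 ⟩ * ⟨ 1 ⟩ * (u ^ (outdeg i ℕ.* a i) * bracket a i)

    ⟨1⟩*geo : ∀ k → ⟨ 1 ⟩ * geo q k ≈ ⟨ k ⟩
    ⟨1⟩*geo k = trans (*-congʳ (+-congʳ (*-identityʳ q))) (geo-telescope q k)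

    β-early : ∀ a i → i < p → β a i ≈ ⟨ 1 ⟩ * ψ i a (cut (suc n) i)
    β-early a zero _ = solve 1 (λ x → x := x :* (con (1 , 0) :* con (1 , 0))) refl ⟨ 1 ⟩
    β-early a i@(suc _) i<p = begin
      ⟨ 1 ⟩ * ⟨ 1 ⟩ * (u ^ (outdeg i ℕ.* a i) * bracket a i)
        ≡⟨ ≡.cong₂ (λ x y → ⟨ 1 ⟩ * ⟨ 1 ⟩ * (u ^ (x ℕ.* a i) * y)) (outdeg-early (ℕₚ.<⇒≤ i<p)) br≡ ⟩
      ⟨ 1 ⟩ * ⟨ 1 ⟩ * (u ^ (i ℕ.* a i) * geo q M)
        ≈⟨ solve 3 (λ x y z → x :* x :* (y :* z) := x :* (y :* (x :* z))) refl _ _ _ ⟩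
      ⟨ 1 ⟩ * (u ^ (i ℕ.* a i) * (⟨ 1 ⟩ * geo q M)) ≈⟨ *-congˡ (*-congˡ (⟨1⟩*geo M)) ⟩
      ⟨ 1 ⟩ * (u ^ (i ℕ.* a i) * ⟨ M ⟩)
        ≡⟨ ≡.cong (λ k → ⟨ 1 ⟩ * (u ^ (i ℕ.* a i) * ⟨ suc i ℕ.* a i ℕ.+ above i k a ⟩)) cut≡ ⟨
      ⟨ 1 ⟩ * ψ i a (cut (suc n) i) ∎
      where
      M = suc i ℕ.* a i ℕ.+ above i (suc (d i)) a
      i<d : i < d i
      i<d = ℕₚ.<-≤-trans i<p (≡.subst (_≤ d i) d[p]≡p (antitone (ℕₚ.<⇒≤ i<p) p≤n))
      br≡ : bracket a i ≡ geo q M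
      br≡ rewrite <ᵇ-true i<d = ≡.refl
      cut≡ : cut (suc n) i ≡ suc (d i)
      cut≡ = ℕₚ.m≤n⇒m⊓n≡m (s≤s (bounded (ℕₚ.≤-trans (ℕₚ.<⇒≤ i<p) p≤n)))

    -- As d p = p, no larger neighbour contributes to the bracket, and ⟨p+1⟩ [a_p]_{q^{p+1}} =
    -- ⟨(p+1) a_p⟩. This absorbs the factor `⟨ suc p ⟩` left by the telescoping.
    β-pivot : ∀ a → ⟨ suc p ⟩ * β a p ≈ ⟨ 1 ⟩ * (⟨ 1 ⟩ * ψ p a (cut (suc n) p))
    β-pivot a = helper p ≡.refl
      where
      -- `p` is a record projection, so a variable equal to it is split instead.
      helper : ∀ i → i ≡ p → ⟨ suc i ⟩ * β a i ≈ ⟨ 1 ⟩ * (⟨ 1 ⟩ * ψ i a (cut (suc n) i))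
      helper zero _ = solve 1 (λ x → x :* x := x :* (x :* (con (1 , 0) :* con (1 , 0)))) refl ⟨ 1 ⟩
      helper i@(suc _) i≡p = begin
        ⟨ suc i ⟩ * (⟨ 1 ⟩ * ⟨ 1 ⟩ * (u ^ (outdeg i ℕ.* a i) * bracket a i))
          ≡⟨ ≡.cong₂ (λ x y → ⟨ suc i ⟩ * (⟨ 1 ⟩ * ⟨ 1 ⟩ * (u ^ (x ℕ.* a i) * y)))
              (outdeg-early (ℕₚ.≤-reflexive i≡p)) br≡ ⟩
        ⟨ suc i ⟩ * (⟨ 1 ⟩ * ⟨ 1 ⟩ * (u ^ (i ℕ.* a i) * geo (q ^ suc i) (a i)))
          ≈⟨ solve 4 (λ s x y z → s :* (x :* x :* (y :* z)) := x :* (x :* (y :* (s :* z)))) refl _ _ _ _ ⟩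
        ⟨ 1 ⟩ * (⟨ 1 ⟩ * (u ^ (i ℕ.* a i) * (⟨ suc i ⟩ * geo (q ^ suc i) (a i))))
          ≈⟨ *-congˡ (*-congˡ (*-congˡ (trans (geo-telescope (q ^ suc i) (a i))
              (+-congʳ (^-assocʳ q (suc i) (a i)))))) ⟩
        ⟨ 1 ⟩ * (⟨ 1 ⟩ * (u ^ (i ℕ.* a i) * ⟨ suc i ℕ.* a i ⟩))
          ≡⟨ ≡.cong (λ z → ⟨ 1 ⟩ * (⟨ 1 ⟩ * (u ^ (i ℕ.* a i) * ⟨ z ⟩)))
               (≡.trans (≡.cong (suc i ℕ.* a i ℕ.+_) none) (ℕₚ.+-identityʳ _)) ⟨
        ⟨ 1 ⟩ * (⟨ 1 ⟩ * ψ i a (cut (suc n) i)) ∎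
        where
        d≡i : d i ≡ i
        d≡i = ≡.subst (λ z → d z ≡ z) (≡.sym i≡p) d[p]≡p
        br≡ : bracket a i ≡ geo (q ^ suc i) (a i)
        br≡ rewrite <ᵇ-false (ℕₚ.≤-reflexive d≡i) | <ᵇ-false (ℕₚ.≤-reflexive (≡.sym d≡i)) = ≡.refl
        none : above i (cut (suc n) i) a ≡ 0
        none = above-low i (cut (suc n) i) a (ℕₚ.≤-trans (ℕₚ.m⊓n≤m (suc (d i)) (suc n)) (s≤s (ℕₚ.≤-reflexive d≡i)))

    β-late : ∀ a i → p < i → i ≤ n → 0 < a i → β a i ≈ H (d i) (a i)
    β-late a i@(suc _) p<i i≤n 0<a = begin
      ⟨ 1 ⟩ * ⟨ 1 ⟩ * (u ^ (outdeg i ℕ.* a i) * bracket a i)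
        ≡⟨ ≡.cong₂ (λ x y → ⟨ 1 ⟩ * ⟨ 1 ⟩ * (u ^ (x ℕ.* a i) * y)) (outdeg-late p<i i≤n) br≡ ⟩
      ⟨ 1 ⟩ * ⟨ 1 ⟩ * (u ^ (d i ℕ.* a i) * (geo (q ^ suc (d i)) (a i) * geo q (d i)))
        ≈⟨ solve 4 (λ x y z w → x :* x :* (y :* (z :* w)) := x :* (x :* w) :* y :* z) refl _ _ _ _ ⟩
      ⟨ 1 ⟩ * (⟨ 1 ⟩ * geo q (d i)) * u ^ (d i ℕ.* a i) * geo (q ^ suc (d i)) (a i)
        ≈⟨ *-congʳ (*-cong (*-congˡ (⟨1⟩*geo (d i))) (sym (^-assocʳ u (d i) (a i)))) ⟩
      ⟨ 1 ⟩ * ⟨ d i ⟩ * (u ^ d i) ^ a i * geo (q ^ suc (d i)) (a i) ≈⟨ H-pos (a i) 0<a ⟨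
      H (d i) (a i) ∎
      where
      H-pos : ∀ k → 0 < k → H (d i) k ≈ ⟨ 1 ⟩ * ⟨ d i ⟩ * (u ^ d i) ^ k * geo (q ^ suc (d i)) k
      H-pos (suc k) _ = refl
      d<i : d i < i
      d<i = ℕₚ.≤-<-trans (d≤p (ℕₚ.<⇒≤ p<i) i≤n) p<i
      br≡ : bracket a i ≡ geo (q ^ suc (d i)) (a i) * geo q (d i)
      br≡ rewrite <ᵇ-false (ℕₚ.<⇒≤ d<i) | <ᵇ-true d<i = ≡.refl

  ∏-const : ∀ k x → ∏ k (λ _ → x) ≈ x ^ k
  ∏-const zero x = refl
  ∏-const (suc k) x = trans (*-congʳ (∏-const k x)) (*-comm _ _)

  flowSum-brackets : ∀ a → total (suc n) a ≤ B → Positive (suc n) a →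
    flowSum (suc n) a ≈ ∏ n (λ i → ⟨ 1 ⟩ * ⟨ 1 ⟩ * (u ^ (outdeg (suc i) ℕ.* a (suc i)) * bracket a (suc i)))
  flowSum-brackets a t≤B pos = q^k-1-cancelˡ 0 (q^k-1-cancelˡ p (begin
    ⟨ suc p ⟩ * (⟨ 1 ⟩ * flowSum (suc n) a) ≈⟨ solve 3 (λ x y z → x :* (y :* z) := y :* (x :* z)) refl _ _ _ ⟩
    ⟨ 1 ⟩ * (⟨ suc p ⟩ * flowSum (suc n) a) ≈⟨ *-congˡ closed ⟩
    ⟨ 1 ⟩ * (⟨ 1 ⟩ ^ suc p * (Π * Ψ) * Θ)
      ≈⟨ solve 5 (λ x c π ψ θ → x :* (x :* c :* (π :* ψ) :* θ) := c :* π :* (x :* (x :* ψ)) :* θ) refl _ _ _ _ _ ⟩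
    ⟨ 1 ⟩ ^ p * Π * (⟨ 1 ⟩ * (⟨ 1 ⟩ * Ψ)) * Θ
      ≈⟨ *-cong (*-cong (trans (∏-cong p (β-early a)) (trans (∏-* p _ _) (*-congʳ (∏-const p ⟨ 1 ⟩))))
          (β-pivot a)) late ⟨
    ∏ p (β a) * (⟨ suc p ⟩ * β a p) * ∏ k (λ j → β a (j ℕ.+ suc p))
      ≈⟨ solve 4 (λ x s y z → x :* (s :* y) :* z := s :* (x :* y :* z)) refl _ _ _ _ ⟩
    ⟨ suc p ⟩ * (∏ (suc p) (β a) * ∏ k (λ j → β a (j ℕ.+ suc p))) ≈⟨ *-congˡ (∏-split (suc p) k (β a)) ⟨
    ⟨ suc p ⟩ * ∏ (k ℕ.+ suc p) (β a) ≡⟨ ≡.cong (λ z → ⟨ suc p ⟩ * ∏ z (β a)) k+1+p ⟩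
    ⟨ suc p ⟩ * ∏ (suc n) (β a) ≈⟨ *-congˡ (∏-∷ n (β a)) ⟩
    ⟨ suc p ⟩ * (⟨ 1 ⟩ * ∏ n (λ i → β a (suc i))) ∎))
    where
    k = n ∸ p
    k+1+p : k ℕ.+ suc p ≡ suc n
    k+1+p = ≡.trans (ℕₚ.+-suc k p) (≡.cong suc (ℕₚ.m∸n+n≡m p≤n))
    Π = ∏ p (λ i → ψ i a (cut (suc n) i))
    Ψ = ψ p a (cut (suc n) p)
    Θ = ∏ k (λ j → H (d (j ℕ.+ suc p)) (a (j ℕ.+ suc p)))
    closed : ⟨ suc p ⟩ * flowSum (suc n) a ≈ ⟨ 1 ⟩ ^ suc p * (Π * Ψ) * Θ
    closed = ≡.subst
      (λ N → N ≤ suc n → total N a ≤ B → Positive N a →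
        ⟨ suc p ⟩ * flowSum N a ≈ ⟨ 1 ⟩ ^ suc p * ∏ (suc p) (λ i → ψ i a (cut N i)) * Θ)
      k+1+p (λ x y z → flowSum-threshold k x a y z) ℕₚ.≤-refl t≤B pos
    late : ∏ k (λ j → β a (j ℕ.+ suc p)) ≈ Θ
    late = ∏-cong k (λ j j<k →
      let j+1+p<1+n = ≡.subst (j ℕ.+ suc p <_) k+1+p (ℕₚ.+-monoˡ-< (suc p) j<k) in
      β-late a (j ℕ.+ suc p) (ℕₚ.m≤n+m (suc p) j) (ℕₚ.≤-pred j+1+p<1+n)
        (pos _ (ℕₚ.<-≤-trans ℕ.z<s (ℕₚ.m≤n+m (suc p) j)) j+1+p<1+n))

-- Laurent polynomials

module Differences {c ℓ} (R : CommutativeRing c ℓ) where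
  open CommutativeRing R
  open DifferenceSolver R
  open import Relation.Binary.Reasoning.Setoid setoid

  -- For Q a power of q, multiplication by Q shifts exponents, so being fixed by it makes the
  -- coefficients of x - y periodic.
  fixed-difference : ∀ Q x y → (Q - 1#) * x ≈ (Q - 1#) * y → Q * (x - y) ≈ x - y
  fixed-difference Q x y h = begin
    Q * (x - y)
      ≈⟨ solve 3 (λ Q x y → Q :* (x :- y) := (Q :- con (1 , 0)) :* x :- (Q :- con (1 , 0)) :* y :+
          (x :- y)) refl Q x y ⟩
    (Q - 1#) * x - (Q - 1#) * y + (x - y) ≈⟨ +-congʳ (+-congʳ h) ⟩
    (Q - 1#) * y - (Q - 1#) * y + (x - y) ≈⟨ +-congʳ (-‿inverseʳ _) ⟩
    0# + (x - y) ≈⟨ +-identityˡ _ ⟩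
    x - y ∎

  difference-0 : ∀ x y → x - y ≈ 0# → x ≈ y
  difference-0 x y h = begin
    x ≈⟨ solve 2 (λ x y → x := x :- y :+ y) refl x y ⟩
    x - y + y ≈⟨ +-congʳ h ⟩
    0# + y ≈⟨ +-identityˡ y ⟩
    y ∎

-- The linear functional with q^e ↦ f e. Coefficients are the case of an indicator function, and
-- keeping f arbitrary makes products tractable: `ev-⊗` is an iterated evaluation, from which most
-- ring laws are read off.
ev : LP → (ℤ → ℤ) → ℤ
ev [] f = + 0
ev ((c , e) ∷ p) f = c ℤ.* f e ℤ.+ ev p f

[_≐_] : ℤ → ℤ → ℤ
[ e ≐ k ] = if does (e ℤ.≟ k) then + 1 else + 0

coeff≡ev : ∀ p k → coeff p k ≡ ev p (λ e → [ e ≐ k ])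
coeff≡ev [] k = ≡.refl
coeff≡ev ((c , e) ∷ p) k = ≡.cong₂ ℤ._+_ (head (does (e ℤ.≟ k))) (coeff≡ev p k)
  where
  head : ∀ b → (if b then c else + 0) ≡ c ℤ.* (if b then + 1 else + 0)
  head true = ≡.sym (ℤₚ.*-identityʳ c)
  head false = ≡.sym (ℤₚ.*-zeroʳ c)

ev-cong : ∀ p {f g} → (∀ e → f e ≡ g e) → ev p f ≡ ev p g
ev-cong [] h = ≡.refl
ev-cong ((c , e) ∷ p) h = ≡.cong₂ (λ x y → c ℤ.* x ℤ.+ y) (h e) (ev-cong p h)

ev-++ : ∀ p r f → ev (p ++ r) f ≡ ev p f ℤ.+ ev r f
ev-++ [] r f = ≡.sym (ℤₚ.+-identityˡ _)
ev-++ ((c , e) ∷ p) r f = ≡.trans (≡.cong (ℤ._+_ (c ℤ.* f e)) (ev-++ p r f)) (≡.sym (ℤₚ.+-assoc (c ℤ.* f e) _ _))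

ev-neg : ∀ p f → ev (negLP p) f ≡ ℤ.- ev p f
ev-neg [] f = ≡.refl
ev-neg ((c , e) ∷ p) f = ≡.trans (≡.cong (ℤ._+_ (ℤ.- c ℤ.* f e)) (ev-neg p f)) (distr c (f e) (ev p f))
  where
  distr : ∀ x y z → ℤ.- x ℤ.* y ℤ.+ ℤ.- z ≡ ℤ.- (x ℤ.* y ℤ.+ z)
  distr = solve-∀

ev-0 : ∀ p → ev p (λ _ → + 0) ≡ + 0
ev-0 [] = ≡.refl
ev-0 ((c , e) ∷ p) = ≡.cong₂ ℤ._+_ (ℤₚ.*-zeroʳ c) (ev-0 p)

ev-linear : ∀ p c f g → ev p (λ e → c ℤ.* f e ℤ.+ g e) ≡ c ℤ.* ev p f ℤ.+ ev p g
ev-linear [] c f g = ≡.sym (≡.trans (ℤₚ.+-identityʳ _) (ℤₚ.*-zeroʳ c))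
ev-linear ((c' , e) ∷ p) c f g = ≡.trans (≡.cong (ℤ._+_ (c' ℤ.* (c ℤ.* f e ℤ.+ g e))) (ev-linear p c f g))
  (rearrange c' c (f e) (g e) (ev p f) (ev p g))
  where
  rearrange : ∀ c' c x y a b → c' ℤ.* (c ℤ.* x ℤ.+ y) ℤ.+ (c ℤ.* a ℤ.+ b)
    ≡ c ℤ.* (c' ℤ.* x ℤ.+ a) ℤ.+ (c' ℤ.* y ℤ.+ b)
  rearrange = solve-∀

ev-swap : ∀ p r (g : ℤ → ℤ → ℤ) → ev p (λ e → ev r (g e)) ≡ ev r (λ e' → ev p (λ e → g e e'))
ev-swap [] r g = ≡.sym (ev-0 r)
ev-swap ((c , e) ∷ p) r g = ≡.trans (≡.cong (ℤ._+_ (c ℤ.* ev r (g e))) (ev-swap p r g))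
    (≡.sym (ev-linear r c (g e) _))

ev-⊗ : ∀ p r f → ev (p ⊗ r) f ≡ ev p (λ e → ev r (λ e' → f (e ℤ.+ e')))
ev-⊗ [] r f = ≡.refl
ev-⊗ ((c , e) ∷ p) r f = ≡.trans (ev-++ (row r) (p ⊗ r) f) (≡.cong₂ ℤ._+_ (ev-row r) (ev-⊗ p r f))
  where
  row : LP → LP
  row = List.map (λ { (c' , e') → (c ℤ.* c' , e ℤ.+ e') })
  factor : ∀ c c' x y → c ℤ.* c' ℤ.* x ℤ.+ c ℤ.* y ≡ c ℤ.* (c' ℤ.* x ℤ.+ y)
  factor = solve-∀
  ev-row : ∀ r → ev (row r) f ≡ c ℤ.* ev r (λ e' → f (e ℤ.+ e'))
  ev-row [] = ≡.sym (ℤₚ.*-zeroʳ c)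
  ev-row ((c' , e') ∷ r) = ≡.trans (≡.cong (ℤ._+_ (c ℤ.* c' ℤ.* f (e ℤ.+ e'))) (ev-row r)) (factor c c' _ _)

[≐]-shift : ∀ e e' k → [ e ℤ.+ e' ≐ k ] ≡ [ e' ≐ k ℤ.- e ]
[≐]-shift e e' k with (e ℤ.+ e') ℤ.≟ k | e' ℤ.≟ (k ℤ.- e)
... | yes _ | yes _ = ≡.refl
... | no _ | no _ = ≡.refl
... | yes ≡.refl | no ¬p = ⊥-elim (¬p (cancel e e'))
  where
  cancel : ∀ e e' → e' ≡ e ℤ.+ e' ℤ.- e
  cancel = solve-∀
... | no ¬p | yes ≡.refl = ⊥-elim (¬p (cancel e k))
  where
  cancel : ∀ e k → e ℤ.+ (k ℤ.- e) ≡ k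
  cancel = solve-∀

coeff-⊗ : ∀ p r k → coeff (p ⊗ r) k ≡ ev p (λ e → coeff r (k ℤ.- e))
coeff-⊗ p r k = ≡.trans (coeff≡ev (p ⊗ r) k) (≡.trans (ev-⊗ p r _)
  (ev-cong p (λ e → ≡.trans (ev-cong r (λ e' → [≐]-shift e e' k)) (≡.sym (coeff≡ev r (k ℤ.- e))))))

-- ≈ᴸ unfolds to a function type, from which its two sides cannot be inferred.
infix 4 _≃_
record _≃_ (p r : LP) : Set where
  constructor mk≃
  field coeffs : p ≈ᴸ r
open _≃_

private
  ev⇒≃ : ∀ {p r} → (∀ f → ev p f ≡ ev r f) → p ≃ r
  ev⇒≃ {p} {r} h = mk≃ λ k → ≡.trans (coeff≡ev p k) (≡.trans (h _) (≡.sym (coeff≡ev r k)))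

  ⊕-cong : ∀ {p p' r r'} → p ≃ p' → r ≃ r' → p ⊕ r ≃ p' ⊕ r'
  ⊕-cong {p} {p'} {r} {r'} (mk≃ h) (mk≃ h') = mk≃ λ k → ≡.trans (coeff-⊕ p r k)
      (≡.trans (≡.cong₂ ℤ._+_ (h k) (h' k)) (≡.sym (coeff-⊕ p' r' k)))
    where
    coeff-⊕ : ∀ p r k → coeff (p ⊕ r) k ≡ coeff p k ℤ.+ coeff r k
    coeff-⊕ p r k = ≡.trans (coeff≡ev (p ⊕ r) k) (≡.trans (ev-++ p r _)
        (≡.sym (≡.cong₂ ℤ._+_ (coeff≡ev p k) (coeff≡ev r k))))

  ⊗-comm : ∀ p r → p ⊗ r ≃ r ⊗ p
  ⊗-comm p r = ev⇒≃ λ f → ≡.trans (ev-⊗ p r f) (≡.trans (ev-swap p r _)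
    (≡.trans (ev-cong r (λ e' → ev-cong p (λ e → ≡.cong f (ℤₚ.+-comm e e')))) (≡.sym (ev-⊗ r p f))))

  ≃-trans : ∀ {p r s} → p ≃ r → r ≃ s → p ≃ s
  ≃-trans (mk≃ h) (mk≃ h') = mk≃ λ k → ≡.trans (h k) (h' k)

  -- By `coeff-⊗` a product depends on its right factor through coefficients only. Congruence in the
  -- left factor then comes from commutativity, which holds for `ev` and needs no congruence.
  ⊗-congˡ : ∀ p {r r'} → r ≃ r' → p ⊗ r ≃ p ⊗ r'
  ⊗-congˡ p {r} {r'} (mk≃ h) = mk≃ λ k → ≡.trans (coeff-⊗ p r k)
      (≡.trans (ev-cong p (λ e → h (k ℤ.- e))) (≡.sym (coeff-⊗ p r' k)))

  ⊗-cong : ∀ {p p' r r'} → p ≃ p' → r ≃ r' → p ⊗ r ≃ p' ⊗ r'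
  ⊗-cong {p} {p'} {r} {r'} h h' = ≃-trans (⊗-congˡ p h')
    (≃-trans (⊗-comm p r') (≃-trans (⊗-congˡ r' h) (⊗-comm r' p')))

  ⊗-assoc : ∀ p r s → (p ⊗ r) ⊗ s ≃ p ⊗ (r ⊗ s)
  ⊗-assoc p r s = ev⇒≃ λ f → ≡.trans (ev-⊗ (p ⊗ r) s f) (≡.trans (ev-⊗ p r _)
    (≡.trans (ev-cong p (λ e → ≡.trans
        (ev-cong r (λ e' → ev-cong s (λ e″ → ≡.cong f (ℤₚ.+-assoc e e' e″))))
        (≡.sym (ev-⊗ r s (λ x → f (e ℤ.+ x))))))
      (≡.sym (ev-⊗ p (r ⊗ s) f))))

  ⊗-identityˡ : ∀ p → oneLP ⊗ p ≃ p
  ⊗-identityˡ p = ev⇒≃ λ f → ≡.trans (ev-⊗ oneLP p f) (≡.trans (ℤₚ.+-identityʳ _)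
    (≡.trans (ℤₚ.*-identityˡ _) (ev-cong p (λ e → ≡.cong f (ℤₚ.+-identityˡ e)))))

  ⊗-distribʳ : ∀ s p r → (p ⊕ r) ⊗ s ≃ (p ⊗ s) ⊕ (r ⊗ s)
  ⊗-distribʳ s p r = ev⇒≃ λ f → ≡.trans (ev-⊗ (p ⊕ r) s f) (≡.trans (ev-++ p r _)
    (≡.sym (≡.trans (ev-++ (p ⊗ s) (r ⊗ s) f) (≡.cong₂ ℤ._+_ (ev-⊗ p s f) (ev-⊗ r s f)))))

laurentRing : CommutativeRing 0ℓ 0ℓ
laurentRing = record
  { Carrier = LP
  ; _≈_ = _≃_
  ; _+_ = _⊕_
  ; _*_ = _⊗_
  ; -_ = negLP
  ; 0# = zeroLP
  ; 1# = oneLP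
  ; isCommutativeRing = record
    { isRing = record
      { +-isAbelianGroup = record
        { isGroup = record
          { isMonoid = record
            { isSemigroup = record
              { isMagma = record
                { isEquivalence = record
                  { refl = mk≃ λ _ → ≡.refl
                  ; sym = λ (mk≃ h) → mk≃ λ k → ≡.sym (h k)
                  ; trans = ≃-trans
                  }
                ; ∙-cong = ⊕-cong
                }
              ; assoc = λ p r s → ev⇒≃ λ f → ≡.trans (ev-++ (p ⊕ r) s f) (≡.trans (≡.cong (ℤ._+ ev s f) (ev-++ p r f))
                  (≡.trans (ℤₚ.+-assoc (ev p f) _ _) (≡.sym
                      (≡.trans (ev-++ p (r ⊕ s) f) (≡.cong (ℤ._+_ (ev p f)) (ev-++ r s f))))))
              }
            ; identity = (λ p → mk≃ λ _ → ≡.refl) ,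
                (λ p → ev⇒≃ λ f → ≡.trans (ev-++ p [] f) (ℤₚ.+-identityʳ _))
            }
          ; inverse = (λ p → ev⇒≃ λ f → ≡.trans (ev-++ (negLP p) p f)
              (≡.trans (≡.cong (ℤ._+ ev p f) (ev-neg p f)) (ℤₚ.+-inverseˡ (ev p f)))) ,
              (λ p → ev⇒≃ λ f → ≡.trans (ev-++ p (negLP p) f)
                  (≡.trans (≡.cong (ℤ._+_ (ev p f)) (ev-neg p f)) (ℤₚ.+-inverseʳ (ev p f))))
          ; ⁻¹-cong = λ {p} {r} (mk≃ h) → mk≃ λ k → ≡.trans (coeff-neg p k)
              (≡.trans (≡.cong ℤ.-_ (h k)) (≡.sym (coeff-neg r k)))
          }
        ; comm = λ p r → ev⇒≃ λ f → ≡.trans (ev-++ p r f) (≡.trans (ℤₚ.+-comm (ev p f) _) (≡.sym (ev-++ r p f)))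
        }
      ; *-cong = ⊗-cong
      ; *-assoc = ⊗-assoc
      ; *-identity = ⊗-identityˡ , (λ p → ≃-trans (⊗-comm p oneLP) (⊗-identityˡ p))
      ; distrib = (λ s p r → ≃-trans (⊗-comm s (p ⊕ r))
          (≃-trans (⊗-distribʳ s p r) (⊕-cong (⊗-comm p s) (⊗-comm r s)))) ,
          ⊗-distribʳ
      }
    ; *-comm = ⊗-comm
    }
  }
  where
  coeff-neg : ∀ p k → coeff (negLP p) k ≡ ℤ.- coeff p k
  coeff-neg p k = ≡.trans (coeff≡ev (negLP p) k) (≡.trans (ev-neg p _) (≡.cong ℤ.-_ (≡.sym (coeff≡ev p k))))

module Laurent where
  open Differences laurentRing
  open CommutativeRing laurentRing using (semiring; refl; trans; *-congˡ; *-congʳ; reflexive) renaming (_-_ to _⊖_)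
  open import Algebra.Properties.Semiring.Exp semiring using (_^_)

  qL^ : ∀ n → qL ^ n ≃ mono (+ 1) (+ n)
  qL^ zero = refl
  qL^ (suc n) = *-congˡ {qL} (qL^ n)

  qinvL^ : ∀ n → qinvL ^ n ≃ mono (+ 1) (ℤ.- (+ n))
  qinvL^ zero = refl
  qinvL^ (suc n) = trans (*-congˡ {qinvL} (qinvL^ n)) (reflexive
      (≡.cong (mono (+ 1)) (≡.sym (ℤₚ.neg-distrib-+ (+ 1) (+ n)))))

  coeff-mono-⊗ : ∀ e p k → coeff (mono (+ 1) e ⊗ p) k ≡ coeff p (k ℤ.- e)
  coeff-mono-⊗ e p k = ≡.trans (coeff-⊗ (mono (+ 1) e) p k) (≡.trans (ℤₚ.+-identityʳ _) (ℤₚ.*-identityˡ _))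

  span : LP → ℕ
  span [] = 0
  span ((c , e) ∷ p) = ∣ e ∣ ℕ.+ span p

  coeff-beyond-span : ∀ p k → span p < ∣ k ∣ → coeff p k ≡ + 0
  coeff-beyond-span [] k _ = ≡.refl
  coeff-beyond-span ((c , e) ∷ p) k h rewrite dec-false (e ℤ.≟ k)
      (λ { ≡.refl → ℕₚ.<⇒≱ h (ℕₚ.m≤m+n ∣ e ∣ (span p)) }) =
    ≡.trans (ℤₚ.+-identityˡ _) (coeff-beyond-span p k (ℕₚ.≤-<-trans (ℕₚ.m≤n+m (span p) ∣ e ∣) h))

  -- `span p` bounds the absolute value of every exponent. Going back more than |k| + `span p`
  -- periods, each of length at least 1, leads from k to an exponent of absolute value above
  -- `span p`, where the coefficient is 0.
  periodic⇒0 : ∀ K p → (∀ k → coeff p (k ℤ.- + suc K) ≡ coeff p k) → p ≃ zeroLP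
  periodic⇒0 K p per = mk≃ λ k → ≡.trans (≡.sym (far k (t k)))
      (coeff-beyond-span p _ (ℕₚ.≰⇒> (λ le → ℕₚ.<⇒≱ (ℕₚ.n<1+n (∣ k ∣ ℕ.+ span p)) (bound k le))))
    where
    t : ℤ → ℕ
    t k = suc (∣ k ∣ ℕ.+ span p)
    regroup : ∀ k x y → k ℤ.- (x ℤ.+ y) ≡ k ℤ.- y ℤ.- x
    regroup = solve-∀
    far : ∀ k t → coeff p (k ℤ.- + (t ℕ.* suc K)) ≡ coeff p k
    far k zero = ≡.cong (coeff p) (ℤₚ.+-identityʳ k)
    far k (suc t) = ≡.trans (≡.cong (coeff p) (regroup k (+ suc K) (+ (t ℕ.* suc K)))) (≡.trans (per _) (far k t))
    self : ∀ k x → x ≡ k ℤ.- (k ℤ.- x)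
    self = solve-∀
    bound : ∀ k → ∣ k ℤ.- + (t k ℕ.* suc K) ∣ ≤ span p → t k ≤ ∣ k ∣ ℕ.+ span p
    bound k le = ℕₚ.≤-trans (ℕₚ.m≤m*n (t k) (suc K)) (ℕₚ.≤-trans
      (ℕₚ.≤-reflexive (≡.cong ∣_∣ (self k (+ (t k ℕ.* suc K)))))
      (ℕₚ.≤-trans (ℤₚ.∣i-j∣≤∣i∣+∣j∣ k (k ℤ.- + (t k ℕ.* suc K))) (ℕₚ.+-monoʳ-≤ ∣ k ∣ le)))

  -- x - y is fixed by q^{k+1}, hence has periodic coefficients, hence vanishes by finiteness of the
  -- support.
  qL^k-1-cancelˡ : ∀ k {x y} → (qL ^ suc k ⊖ oneLP) ⊗ x ≃ (qL ^ suc k ⊖ oneLP) ⊗ y → x ≃ y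
  qL^k-1-cancelˡ k {x} {y} h = difference-0 x y (periodic⇒0 k z λ j →
    ≡.trans (≡.sym (coeff-mono-⊗ (+ suc k) z j))
      (≡.trans (≡.sym (coeffs (*-congʳ {z} (qL^ (suc k))) j)) (coeffs (fixed-difference (qL ^ suc k) x y h) j)))
    where
    z = x ⊖ y

-- Threshold graphs

sumFin-suc : ∀ n f → sumFin (suc n) f ≡ f Fin.zero ℕ.+ sumFin n (f ∘ Fin.suc)
sumFin-suc n f = ≡.cong (λ xs → f Fin.zero ℕ.+ sum xs)
  (≡.trans (map-tabulate Fin.suc f) (≡.sym (map-tabulate id (f ∘ Fin.suc))))

indicator : Bool → ℕ
indicator b = if b then 1 else 0

count : ∀ {n} → (Fin n → Bool) → ℕ
count {n} P = sumFin n (indicator ∘ P)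

count-mono : ∀ {n} (P Q : Fin n → Bool) → (∀ w → P w ≡ true → Q w ≡ true) → count P ≤ count Q
count-mono {zero} P Q h = z≤n
count-mono {suc n} P Q h rewrite sumFin-suc n (indicator ∘ P) | sumFin-suc n (indicator ∘ Q) =
  ℕₚ.+-mono-≤ (ind (P Fin.zero) (Q Fin.zero) (h Fin.zero)) (count-mono (P ∘ Fin.suc) (Q ∘ Fin.suc) (h ∘ Fin.suc))
  where
  ind : ∀ b b' → (b ≡ true → b' ≡ true) → indicator b ≤ indicator b'
  ind false b' i = z≤n
  ind true b' i rewrite i ≡.refl = s≤s z≤n

_∖_ : ∀ {n} → (Fin n → Bool) → Fin n → Fin n → Bool
(P ∖ v) w = P w ∧ not (does (w Fin.≟ v))

∖-intro : ∀ {n} {P : Fin n → Bool} {v w} → P w ≡ true → w ≢ v → (P ∖ v) w ≡ true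
∖-intro {v = v} {w} p w≢v rewrite p | dec-false (w Fin.≟ v) w≢v = ≡.refl

∖-elim : ∀ {n} {P : Fin n → Bool} {v w} → (P ∖ v) w ≡ true → P w ≡ true × w ≢ v
∖-elim {P = P} {v} {w} h with P w | w Fin.≟ v
... | true | no w≢v = ≡.refl , w≢v

count-cong : ∀ {n} {P Q : Fin n → Bool} → (∀ w → P w ≡ Q w) → count P ≡ count Q
count-cong {P = P} {Q} h = ℕₚ.≤-antisym (count-mono P Q (λ w → ≡.trans (≡.sym (h w))))
    (count-mono Q P (λ w → ≡.trans (h w)))

count-∖ : ∀ {n} (P : Fin n → Bool) v → count P ≡ indicator (P v) ℕ.+ count (P ∖ v)
count-∖ {suc n} P Fin.zero rewrite sumFin-suc n (indicator ∘ P) | sumFin-suc n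
    (indicator ∘ (P ∖ Fin.zero)) with P Fin.zero
... | true = ≡.cong suc (count-cong (λ w → ≡.sym (∧-identityʳ (P (Fin.suc w)))))
... | false = count-cong (λ w → ≡.sym (∧-identityʳ (P (Fin.suc w))))
count-∖ {suc n} P (Fin.suc v) rewrite sumFin-suc n (indicator ∘ P) | sumFin-suc n (indicator ∘ (P ∖ Fin.suc v)) =
  ≡.trans (≡.cong₂ ℕ._+_ (≡.cong indicator (≡.sym (∧-identityʳ (P Fin.zero)))) (count-∖ (P ∘ Fin.suc) v))
    (x∙yz≈y∙xz (indicator (P Fin.zero ∧ true)) (indicator (P (Fin.suc v))) (count ((P ∘ Fin.suc) ∖ v)))

count-< : ∀ {n} (P Q : Fin n → Bool) v → (∀ w → P w ≡ true → Q w ≡ true) → P v ≡ false → Q v ≡ true →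
  count P < count Q
count-< P Q v h ¬Pv Qv rewrite count-∖ Q v | Qv = s≤s (count-mono P (Q ∖ v) (λ w Pw →
  ∖-intro {P = Q} (h w Pw) λ { ≡.refl → case (≡.trans (≡.sym ¬Pv) Pw) }))
  where
  case : false ≡ true → ⊥
  case ()

initial : ∀ {n} → ℕ → Fin n → Bool
initial k w = toℕ w <ᵇ k

count-initial : ∀ n k → k ≤ n → count (initial {n} k) ≡ k
count-initial zero zero _ = ≡.refl
count-initial (suc n) zero _ = ≡.trans (sumFin-suc n (indicator ∘ initial zero)) (count-initial n zero z≤n)
count-initial (suc n) (suc k) (s≤s k≤n) = ≡.trans (sumFin-suc n (indicator ∘ initial (suc k)))
    (≡.cong suc (count-initial n k k≤n))

-- Punching out a missed value would give an injection into a smaller finite set.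
injective⇒surjective : ∀ {n} (f : Fin n → Fin n) → Injective _≡_ _≡_ f → ∀ w → Σ (Fin n) λ s → f s ≡ w
injective⇒surjective {zero} f inj ()
injective⇒surjective {suc n} f inj w with Finₚ.any? (λ s → f s Fin.≟ w)
... | yes h = h
... | no ¬h = ⊥-elim (ℕₚ.1+n≰n (Finₚ.injective⇒≤ {f = λ s → punchOut {i = w} (≢ s)}
  (λ {s} {t} e → inj (Finₚ.punchOut-injective (≢ s) (≢ t) e))))
  where
  ≢ : ∀ s → w ≢ f s
  ≢ s e = ¬h (s , ≡.sym e)

module Threshold {N : ℕ} (adj : Fin N → Fin N → Bool) (threshold : IsThreshold adj)
  (labelled : ReverseDegreeLabeled adj) where

  private
    adj-sym : ∀ v w → adj v w ≡ adj w v
    adj-sym = proj₁ (proj₁ threshold)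
    adj-irrefl : ∀ v → adj v v ≡ false
    adj-irrefl = proj₂ (proj₁ threshold)
    π : Fin N → Fin N
    π = proj₁ (proj₂ threshold)
    c : Fin N → Bool
    c = proj₁ (proj₂ (proj₂ (proj₂ threshold)))
    π-adj : ∀ s t → s Fin.< t → adj (π s) (π t) ≡ c t
    π-adj = proj₂ (proj₂ (proj₂ (proj₂ threshold)))

  -- The vicinal preorder. That any two vertices are comparable in it characterises threshold
  -- graphs; v and w are left out since no vertex is its own neighbour.
  Dominated : Fin N → Fin N → Set
  Dominated v w = ∀ x → x ≢ v → x ≢ w → adj v x ≡ true → adj w x ≡ true

  private
    true≢false : ∀ {b} → b ≡ true → b ≡ false → ⊥
    true≢false ≡.refl ()

    -- A vertex added after t treats `π s` and `π t` alike. To the vertices added before it, `π t`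
    -- is joined entirely or not at all, according to `c t`.
    later : ∀ s t → s Fin.< t → Dominated (π s) (π t) ⊎ Dominated (π t) (π s)
    later s t s<t with c t in ct
    ... | true = inj₁ λ x x≢s x≢t h → dominating x x≢t h
      where
      dominating : ∀ x → x ≢ π t → adj (π s) x ≡ true → adj (π t) x ≡ true
      dominating x x≢t h with injective⇒surjective π (proj₁ (proj₂ (proj₂ threshold))) x
      ... | r , ≡.refl with Finₚ.<-cmp r t
      ...   | tri< r<t _ _ = ≡.trans (adj-sym (π t) (π r)) (≡.trans (π-adj r t r<t) ct)
      ...   | tri≈ _ ≡.refl _ = ⊥-elim (x≢t ≡.refl)
      ...   | tri> _ _ t<r = ≡.trans (π-adj t r t<r) (≡.trans (≡.sym (π-adj s r (Finₚ.<-trans s<t t<r))) h)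
    ... | false = inj₂ λ x x≢t x≢s h → isolated x x≢t h
      where
      isolated : ∀ x → x ≢ π t → adj (π t) x ≡ true → adj (π s) x ≡ true
      isolated x x≢t h with injective⇒surjective π (proj₁ (proj₂ (proj₂ threshold))) x
      ... | r , ≡.refl with Finₚ.<-cmp r t
      ...   | tri< r<t _ _ = ⊥-elim (true≢false h (≡.trans (adj-sym (π t) (π r)) (≡.trans (π-adj r t r<t) ct)))
      ...   | tri≈ _ ≡.refl _ = ⊥-elim (x≢t ≡.refl)
      ...   | tri> _ _ t<r = ≡.trans (π-adj s r (Finₚ.<-trans s<t t<r)) (≡.trans (≡.sym (π-adj t r t<r)) h)

  comparable : ∀ v w → v ≢ w → Dominated v w ⊎ Dominated w v
  comparable v w v≢w with injective⇒surjective π (proj₁ (proj₂ (proj₂ threshold))) v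
                        | injective⇒surjective π (proj₁ (proj₂ (proj₂ threshold))) w
  ... | s , ≡.refl | t , ≡.refl with Finₚ.<-cmp s t
  ...   | tri< s<t _ _ = later s t s<t
  ...   | tri≈ _ ≡.refl _ = ⊥-elim (v≢w ≡.refl)
  ...   | tri> _ _ t<s with later t s t<s
  ...     | inj₁ h = inj₂ h
  ...     | inj₂ h = inj₁ h

  -- If the comparison goes the other way and j has a neighbour x that i lacks, then deg j > deg i
  -- against the labelling. The possible edge between i and j counts equally in both degrees, so
  -- each vertex is first removed from the neighbourhood of the other.
  dominated : ∀ {i j} → i Fin.< j → Dominated j i
  dominated {i} {j} i<j with comparable i j (λ { ≡.refl → ℕₚ.<-irrefl ≡.refl i<j })
  ... | inj₂ h = h
  ... | inj₁ h = λ x x≢j x≢i jx → back x x≢j x≢i jx (adj i x) ≡.refl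
    where
    back : ∀ x → x ≢ j → x ≢ i → adj j x ≡ true → ∀ b → adj i x ≡ b → adj i x ≡ true
    back x x≢j x≢i jx true e = e
    back x x≢j x≢i jx false e = ⊥-elim (ℕₚ.<⇒≱ (≡.subst₂ _<_ (≡.sym (count-∖ (adj i) j)) (≡.sym degj)
      (ℕₚ.+-monoʳ-< (indicator (adj i j)) strict)) (labelled i j i<j))
      where
      degj : count (adj j) ≡ indicator (adj i j) ℕ.+ count (adj j ∖ i)
      degj = ≡.trans (count-∖ (adj j) i) (≡.cong (λ b → indicator b ℕ.+ count (adj j ∖ i)) (adj-sym j i))
      strict : count (adj i ∖ j) < count (adj j ∖ i)
      strict = count-< (adj i ∖ j) (adj j ∖ i) x
        (λ w hw → let (iw , w≢j) = ∖-elim {P = adj i} hw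
                      w≢i : w ≢ i
                      w≢i = λ { ≡.refl → true≢false iw (adj-irrefl i) }
                  in ∖-intro {P = adj j} (h w w≢i w≢j iw) w≢i)
        (≡.cong (_∧ not (does (x Fin.≟ j))) e)
        (∖-intro {P = adj j} jx x≢i)

  private
    <ᵇ⁻¹ : ∀ {k l} → (k <ᵇ l) ≡ true → k < l
    <ᵇ⁻¹ {k} {l} h = ℕₚ.<ᵇ⇒< k l (Equivalence.from T-≡ h)

    -- The neighbourhood of v is an initial segment of the labels with v taken out; the degree
    -- criteria below only count such segments.
    down : ∀ v {i j} → i Fin.< j → i ≢ v → j ≢ v → adj v j ≡ true → adj v i ≡ true
    down v {i} {j} i<j i≢v j≢v h = ≡.trans (adj-sym v i)
      (dominated i<j v (j≢v ∘ ≡.sym) (i≢v ∘ ≡.sym) (≡.trans (adj-sym j v) h))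

    down≤ : ∀ v {i j} → toℕ i ≤ toℕ j → i ≢ v → j ≢ v → adj v j ≡ true → adj v i ≡ true
    down≤ v i≤j i≢v j≢v h with ℕₚ.m≤n⇒m<n∨m≡n i≤j
    ... | inj₁ i<j = down v i<j i≢v j≢v h
    ... | inj₂ i≡j rewrite Finₚ.toℕ-injective i≡j = h

    <⇒≢ : ∀ {i j : Fin N} → toℕ i < toℕ j → i ≢ j
    <⇒≢ i<j ≡.refl = ℕₚ.<-irrefl ≡.refl i<j

    neighbours-below-j : ∀ v j → j ≢ v → adj v j ≡ false → ∀ w → adj v w ≡ true → toℕ w < toℕ j
    neighbours-below-j v j j≢v ¬h w h = ℕₚ.≰⇒> λ j≤w →
      true≢false (down≤ v j≤w j≢v (λ { ≡.refl → true≢false h (adj-irrefl v) }) h) ¬h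

  adj⇒<deg : ∀ {v j} → j Fin.< v → adj v j ≡ true → toℕ j < deg adj v
  adj⇒<deg {v} {j} j<v h = ℕₚ.≤-trans (ℕₚ.≤-reflexive (≡.sym (count-initial N (suc (toℕ j)) (Finₚ.toℕ<n j))))
    (count-mono (initial (suc (toℕ j))) (adj v) (λ w hw →
      let w≤j = ℕₚ.≤-pred (<ᵇ⁻¹ {toℕ w} {suc (toℕ j)} hw) in
      down≤ v w≤j (<⇒≢ (ℕₚ.≤-<-trans w≤j j<v)) (<⇒≢ j<v) h))

  ¬adj⇒deg≤ : ∀ {v j} → j Fin.< v → adj v j ≡ false → deg adj v ≤ toℕ j
  ¬adj⇒deg≤ {v} {j} j<v h = ℕₚ.≤-trans
    (count-mono (adj v) (initial (toℕ j)) (λ w hw → <ᵇ-true (neighbours-below-j v j (<⇒≢ j<v) h w hw)))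
    (ℕₚ.≤-reflexive (count-initial N (toℕ j) (ℕₚ.<⇒≤ (Finₚ.toℕ<n j))))

  private
    count-initial-∖ : ∀ (v : Fin N) k → k ≤ N → toℕ v < k → suc (count (initial k ∖ v)) ≡ k
    count-initial-∖ v k k≤N v<k = ≡.trans
      (≡.cong (λ b → indicator b ℕ.+ count (initial k ∖ v)) (≡.sym (<ᵇ-true v<k)))
      (≡.trans (≡.sym (count-∖ (initial k) v)) (count-initial N k k≤N))

  -- Unlike in `adj⇒<deg`, v itself is among 0, ..., j and is not its own neighbour, so only j of
  -- these j + 1 vertices are counted.
  adj⇒≤deg : ∀ {v j} → v Fin.< j → adj v j ≡ true → toℕ j ≤ deg adj v
  adj⇒≤deg {v} {j} v<j h = ℕₚ.≤-pred (≡.subst (_≤ suc (deg adj v))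
    (count-initial-∖ v (suc (toℕ j)) (Finₚ.toℕ<n j) (ℕₚ.m<n⇒m<1+n v<j))
    (s≤s (count-mono (initial (suc (toℕ j)) ∖ v) (adj v) (λ w hw →
      let (w≤j , w≢v) = ∖-elim {P = initial (suc (toℕ j))} hw in
      down≤ v (ℕₚ.≤-pred (<ᵇ⁻¹ {toℕ w} {suc (toℕ j)} w≤j)) w≢v (<⇒≢ v<j ∘ ≡.sym) h))))

  ¬adj⇒deg< : ∀ {v j} → v Fin.< j → adj v j ≡ false → deg adj v < toℕ j
  ¬adj⇒deg< {v} {j} v<j h = ≡.subst (deg adj v <_) (count-initial-∖ v (toℕ j) (ℕₚ.<⇒≤ (Finₚ.toℕ<n j)) v<j)
    (s≤s (count-mono (adj v) (initial (toℕ j) ∖ v) (λ w hw →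
      ∖-intro {P = initial (toℕ j)} (<ᵇ-true (neighbours-below-j v j (<⇒≢ v<j ∘ ≡.sym) h w hw))
        (λ { ≡.refl → true≢false hw (adj-irrefl v) }))))

  deg<N : ∀ v → deg adj v < N
  deg<N v = ≡.subst (deg adj v <_) (count-initial-∖ v N ℕₚ.≤-refl (Finₚ.toℕ<n v))
    (s≤s (count-mono (adj v) (initial N ∖ v) (λ w hw →
      ∖-intro {P = initial N} (<ᵇ-true (Finₚ.toℕ<n w)) (λ { ≡.refl → true≢false hw (adj-irrefl v) }))))

  adj≡<deg : ∀ {v j} → j Fin.< v → adj v j ≡ (toℕ j <ᵇ deg adj v)
  adj≡<deg {v} {j} j<v with adj v j in e
  ... | true = ≡.sym (<ᵇ-true (adj⇒<deg j<v e))
  ... | false = ≡.sym (<ᵇ-false (¬adj⇒deg≤ j<v e))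

  below⇒above-deg : ∀ {i r} → i Fin.< r → toℕ i < deg adj r → toℕ r ≤ deg adj i
  below⇒above-deg {i} {r} i<r h with adj r i in e
  ... | true = adj⇒≤deg i<r (≡.trans (adj-sym i r) e)
  ... | false = ⊥-elim (ℕₚ.<⇒≱ h (¬adj⇒deg≤ i<r e))

  above⇒below-deg : ∀ {i r} → i Fin.< r → toℕ r ≤ deg adj i → toℕ i < deg adj r
  above⇒below-deg {i} {r} i<r h with adj r i in e
  ... | true = adj⇒<deg i<r e
  ... | false = ⊥-elim (ℕₚ.<⇒≱ (¬adj⇒deg< i<r (≡.trans (adj-sym i r) e)) h)

toℕ-surjective : ∀ {n i} → i < n → Σ (Fin n) λ k → toℕ k ≡ i
toℕ-surjective i<n = fromℕ< i<n , Finₚ.toℕ-fromℕ< i<n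

at-lookup : ∀ {A : Set} {n} (z : A) (v : Vec A n) i → at z v (toℕ i) ≡ Vec.lookup v i
at-lookup z (x Vec.∷ v) Fin.zero = ≡.refl
at-lookup z (x Vec.∷ v) (Fin.suc i) = at-lookup z v i

extend : ∀ {n} → (Fin n → ℕ) → ℕ → ℕ
extend f = at 0 (Vec.tabulate f)

extend-toℕ : ∀ {n} (f : Fin n → ℕ) i → extend f (toℕ i) ≡ f i
extend-toℕ f i = ≡.trans (at-lookup 0 (Vec.tabulate f) i) (lookup∘tabulate f i)

module _ {n : ℕ} (adj : Fin (suc n) → Fin (suc n) → Bool) (threshold : IsThreshold adj)
  (labelled : ReverseDegreeLabeled adj) where
  open Threshold adj threshold labelled

  private
    d : ℕ → ℕ
    d = extend (deg adj)

    fin : ∀ {i} → i ≤ n → Σ (Fin (suc n)) λ k → toℕ k ≡ i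
    fin = toℕ-surjective ∘ s≤s

    bounded : ∀ {i} → i ≤ n → d i ≤ n
    bounded i≤n with fin i≤n
    ... | k , ≡.refl rewrite extend-toℕ (deg adj) k = ℕₚ.≤-pred (deg<N k)

    antitone : ∀ {i j} → i ≤ j → j ≤ n → d j ≤ d i
    antitone i≤j j≤n with ℕₚ.m≤n⇒m<n∨m≡n i≤j
    ... | inj₂ ≡.refl = ℕₚ.≤-refl
    ... | inj₁ i<j with fin (ℕₚ.≤-trans i≤j j≤n) | fin j≤n
    ...   | k , ≡.refl | l , ≡.refl rewrite extend-toℕ (deg adj) k | extend-toℕ (deg adj) l = labelled k l i<j

    below⇒above : ∀ {i r} → i < r → r ≤ n → i < d r → r ≤ d i
    below⇒above i<r r≤n with fin (ℕₚ.≤-trans (ℕₚ.<⇒≤ i<r) r≤n) | fin r≤n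
    ... | k , ≡.refl | l , ≡.refl rewrite extend-toℕ (deg adj) k | extend-toℕ (deg adj) l = below⇒above-deg i<r

    above⇒below : ∀ {i r} → i < r → r ≤ n → r ≤ d i → i < d r
    above⇒below i<r r≤n with fin (ℕₚ.≤-trans (ℕₚ.<⇒≤ i<r) r≤n) | fin r≤n
    ... | k , ≡.refl | l , ≡.refl rewrite extend-toℕ (deg adj) k | extend-toℕ (deg adj) l = above⇒below-deg i<r

    -- A discrete intermediate value argument: k < d k makes k and k + 1 adjacent, whence d (k + 1)
    -- ≥ k + 1, so d cannot pass below the diagonal without meeting it. At n it can no longer be
    -- above.
    pivot-or-above : ∀ k → k ≤ n → (Σ ℕ λ p → p ≤ n × d p ≡ p) ⊎ k < d k
    pivot-or-above zero _ with ℕₚ.m≤n⇒m<n∨m≡n (z≤n {d 0})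
    ... | inj₁ 0<d = inj₂ 0<d
    ... | inj₂ e = inj₁ (0 , z≤n , ≡.sym e)
    pivot-or-above (suc k) k<n with pivot-or-above k (ℕₚ.<⇒≤ k<n)
    ... | inj₁ h = inj₁ h
    ... | inj₂ k<dk with ℕₚ.m≤n⇒m<n∨m≡n (above⇒below (ℕₚ.n<1+n k) k<n k<dk)
    ...   | inj₁ h = inj₂ h
    ...   | inj₂ e = inj₁ (suc k , k<n , ≡.sym e)

    pivot : Σ ℕ λ p → p ≤ n × d p ≡ p
    pivot with pivot-or-above n ℕₚ.≤-refl
    ... | inj₁ h = h
    ... | inj₂ n<d = ⊥-elim (ℕₚ.<⇒≱ n<d (bounded ℕₚ.≤-refl))

  degreeData : DegreeData n (extend (deg adj))
  degreeData = record
    { p = proj₁ pivot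
    ; p≤n = proj₁ (proj₂ pivot)
    ; d[p]≡p = proj₂ (proj₂ pivot)
    ; antitone = antitone
    ; bounded = bounded
    ; below⇒above = below⇒above
    ; above⇒below = above⇒below
    }

-- Flow matrices

≡ᵇ-true : ∀ {k l} → k ≡ l → (k ≡ᵇ l) ≡ true
≡ᵇ-true {k} {l} e = Equivalence.to T-≡ (ℕₚ.≡⇒≡ᵇ k l e)

≡ᵇ⁻¹ : ∀ {k l} → (k ≡ᵇ l) ≡ true → k ≡ l
≡ᵇ⁻¹ {k} {l} e = ℕₚ.≡ᵇ⇒≡ k l (Equivalence.from T-≡ e)

Bool-ext : ∀ {b b'} → (b ≡ true → b' ≡ true) → (b' ≡ true → b ≡ true) → b ≡ b'
Bool-ext {true} {b'} h _ = ≡.sym (h ≡.refl)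
Bool-ext {false} {true} _ h = h ≡.refl
Bool-ext {false} {false} _ _ = ≡.refl

∧-intro : ∀ {b b'} → b ≡ true → b' ≡ true → b ∧ b' ≡ true
∧-intro ≡.refl ≡.refl = ≡.refl

rowᵇ-intro : ∀ l m s x → total l x ≡ s → (∀ j → m ≤ j → j < l → x j ≡ 0) → rowᵇ l m s x ≡ true
rowᵇ-intro zero m s x e _ = ≡ᵇ-true (≡.sym e)
rowᵇ-intro (suc l) m s x ≡.refl z = ∧-intro entryOK (∧-intro (≤ᵇ-true (ℕₚ.m≤n+m (x l) (total l x)))
  (rowᵇ-intro l m _ x (≡.sym (ℕₚ.m+n∸n≡m (total l x) (x l))) (λ j m≤j j<l → z j m≤j (ℕₚ.m<n⇒m<1+n j<l))))
  where
  entryOK : (x l ≡ᵇ 0) ∨ (l <ᵇ m) ≡ true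
  entryOK with ℕₚ.<-≤-connex l m
  ... | inj₁ l<m rewrite <ᵇ-true l<m = ∨-zeroʳ (x l ≡ᵇ 0)
  ... | inj₂ m≤l rewrite z l m≤l ℕₚ.≤-refl = ≡.refl

total-∷ : ∀ n e → total (suc n) e ≡ e 0 ℕ.+ total n (e ∘ suc)
total-∷ zero e = ℕₚ.+-comm 0 (e 0)
total-∷ (suc n) e = ≡.trans (≡.cong (ℕ._+ e (suc n)) (total-∷ n e)) (ℕₚ.+-assoc (e 0) _ _)

total-0 : ∀ n → total n (λ _ → 0) ≡ 0
total-0 zero = ≡.refl
total-0 (suc n) = ≡.trans (ℕₚ.+-identityʳ _) (total-0 n)

total-swap : ∀ k l (M : ℕ → ℕ → ℕ) → total k (λ i → total l (M i)) ≡ total l (λ j → total k (λ i → M i j))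
total-swap zero l M = ≡.sym (total-0 l)
total-swap (suc k) l M = ≡.trans (≡.cong (ℕ._+ total l (M k)) (total-swap k l M)) (≡.sym (total-+ l _ (M k)))

total≡above : ∀ N i f → (∀ j → j ≤ i → f j ≡ 0) → total N f ≡ above i N f
total≡above zero i f z = ≡.refl
total≡above (suc N) i f z with ℕₚ.<-≤-connex i N
... | inj₁ i<N rewrite <ᵇ-true i<N = ≡.cong (ℕ._+ f N) (total≡above N i f z)
... | inj₂ N≤i rewrite <ᵇ-false N≤i | z N N≤i = ≡.cong (ℕ._+ 0) (total≡above N i f z)

sumFin≡total : ∀ n (f : Fin n → ℕ) (g : ℕ → ℕ) → (∀ i → f i ≡ g (toℕ i)) → sumFin n f ≡ total n g
sumFin≡total zero f g h = ≡.refl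
sumFin≡total (suc n) f g h = ≡.trans (sumFin-suc n f) (≡.trans
  (≡.cong₂ ℕ._+_ (h Fin.zero) (sumFin≡total n (f ∘ Fin.suc) (g ∘ suc) (h ∘ Fin.suc))) (≡.sym (total-∷ n g)))

module _ (N : ℕ) (m : ℕ → ℕ) (M : ℕ → ℕ → ℕ) where

  -- `e` already contains the inflow from rows r and beyond; `above` adds that from the rows
  -- strictly between i and r. For r = N this is the conservation law with the original demands.
  BalancedRow : ℕ → (ℕ → ℕ) → ℕ → Set
  BalancedRow r e i = total N (M i) ≡ demand i (λ j → e j ℕ.+ above i r (λ i' → M i' j))
    × (∀ j → m i ≤ j → j < N → M i j ≡ 0)

  private
    demand-cong : ∀ i {e e'} → (∀ j → e j ≡ e' j) → demand i e ≡ demand i e'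
    demand-cong zero h = ≡.refl
    demand-cong (suc i) h = h (suc i)

    demand-last : ∀ r e → demand r (λ j → e j ℕ.+ above r (suc r) (λ i' → M i' j)) ≡ demand r e
    demand-last r e = demand-cong r (λ j → ≡.trans (≡.cong (e j ℕ.+_)
        (above-low r (suc r) (λ i' → M i' j) ℕₚ.≤-refl)) (ℕₚ.+-identityʳ (e j)))

    demand-earlier : ∀ {i r} (e : ℕ → ℕ) → i < r → demand i (λ j → e j ℕ.+ M r j ℕ.+ above i r (λ i' → M i' j))
      ≡ demand i (λ j → e j ℕ.+ above i (suc r) (λ i' → M i' j))
    demand-earlier {i} {r} e i<r = demand-cong i (λ j → ≡.trans (ℕₚ.+-assoc (e j) (M r j) _)
      (≡.cong (e j ℕ.+_) (≡.trans (ℕₚ.+-comm (M r j) _) (≡.sym (above-suc i r (λ i' → M i' j) i<r)))))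

  flowᵇ-elim : ∀ r e → flowᵇ N m r M e ≡ true → ∀ i → i < r → BalancedRow r e i
  flowᵇ-elim (suc r) e h i (s≤s i≤r) with ∧-true {rowᵇ N (m r) (demand r e) (M r)} h | ℕₚ.m≤n⇒m<n∨m≡n i≤r
  ... | row , rest | inj₁ i<r with flowᵇ-elim r (λ j → e j ℕ.+ M r j) rest i i<r
  ...   | t , z = ≡.trans t (demand-earlier e i<r) , z
  flowᵇ-elim (suc r) e h i (s≤s i≤r) | row , rest | inj₂ ≡.refl =
    ≡.trans (rowᵇ-total N (m i) _ (M i) row) (≡.sym (demand-last i e)) , rowᵇ-support N (m i) _ (M i) row

  flowᵇ-intro : ∀ r e → (∀ i → i < r → BalancedRow r e i) → flowᵇ N m r M e ≡ true
  flowᵇ-intro zero e h = ≡.refl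
  flowᵇ-intro (suc r) e h = ∧-intro
    (rowᵇ-intro N (m r) _ (M r) (≡.trans (proj₁ (h r ℕₚ.≤-refl)) (demand-last r e)) (proj₂ (h r ℕₚ.≤-refl)))
    (flowᵇ-intro r (λ j → e j ℕ.+ M r j) (λ i i<r → let (t , z) = h i (ℕₚ.m<n⇒m<1+n i<r) in
      ≡.trans t (≡.sym (demand-earlier e i<r)) , z))

allᶠ-suc : ∀ n p → allᶠ (suc n) p ≡ p Fin.zero ∧ allᶠ n (p ∘ Fin.suc)
allᶠ-suc n p = ≡.cong (λ xs → p Fin.zero ∧ foldr _∧_ true xs)
  (≡.trans (map-tabulate Fin.suc p) (≡.sym (map-tabulate id (p ∘ Fin.suc))))

allᶠ-elim : ∀ n p → allᶠ n p ≡ true → ∀ i → p i ≡ true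
allᶠ-elim (suc n) p h i with ∧-true {p Fin.zero} (≡.trans (≡.sym (allᶠ-suc n p)) h)
allᶠ-elim (suc n) p h Fin.zero | h₀ , _ = h₀
allᶠ-elim (suc n) p h (Fin.suc i) | _ , h₁ = allᶠ-elim n (p ∘ Fin.suc) h₁ i

allᶠ-intro : ∀ n p → (∀ i → p i ≡ true) → allᶠ n p ≡ true
allᶠ-intro zero p h = ≡.refl
allᶠ-intro (suc n) p h = ≡.trans (allᶠ-suc n p) (∧-intro (h Fin.zero) (allᶠ-intro n (p ∘ Fin.suc) (h ∘ Fin.suc)))

entry≡cell : ∀ {N} (M : Mat N) i j → entry M i j ≡ cell M (toℕ i) (toℕ j)
entry≡cell M i j = ≡.trans (≡.sym (at-lookup 0 (Vec.lookup M i) j))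
  (≡.cong (λ v → at 0 v (toℕ j)) (≡.sym (at-lookup (Vec.replicate _ 0) M i)))

module _ {n : ℕ} (adj : Fin (suc n) → Fin (suc n) → Bool) (threshold : IsThreshold adj)
  (labelled : ReverseDegreeLabeled adj)
  (a : Fin n → ℕ) where

  private
    N = suc n
    m : ℕ → ℕ
    m = DegreeData.outdeg (degreeData adj threshold labelled)
    e : ℕ → ℕ
    e = extend (vtx a)

    edgeᵇ : Fin N → Fin N → Bool
    edgeᵇ i j = (toℕ j <ᵇ toℕ i) ∧ adj i j

    edge-m : ∀ i j → edgeᵇ i j ≡ (toℕ j <ᵇ m (toℕ i))
    edge-m i j with ℕₚ.<-≤-connex (toℕ j) (toℕ i)
    ... | inj₂ i≤j rewrite <ᵇ-false i≤j = ≡.sym (<ᵇ-false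
        (ℕₚ.≤-trans (ℕₚ.m⊓n≤n (extend (deg adj) (toℕ i)) (toℕ i)) i≤j))
    ... | inj₁ j<i rewrite <ᵇ-true j<i | extend-toℕ (deg adj) i =
      ≡.trans (Threshold.adj≡<deg adj threshold labelled j<i) (Bool-ext
        (λ h → <ᵇ-true (ℕₚ.⊓-glb (ℕₚ.<ᵇ⇒< (toℕ j) (deg adj i) (Equivalence.from T-≡ h)) j<i))
        (λ h → <ᵇ-true (ℕₚ.<-≤-trans (ℕₚ.<ᵇ⇒< (toℕ j) (deg adj i ℕ.⊓ toℕ i) (Equivalence.from T-≡ h))
            (ℕₚ.m⊓n≤m (deg adj i) (toℕ i)))))

    module _ (M : Mat N) where
      C : ℕ → ℕ → ℕ
      C = cell M

      row : ∀ k → sumFin N (λ j → entry M k j) ≡ total N (C (toℕ k))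
      row k = sumFin≡total N _ (C (toℕ k)) (entry≡cell M k)

      col : ∀ k → sumFin N (λ i → entry M i k) ≡ total N (λ i → C i (toℕ k))
      col k = sumFin≡total N _ (λ i → C i (toℕ k)) (λ i → entry≡cell M i k)

      Supported : Set
      Supported = ∀ i → i < N → ∀ j → m i ≤ j → j < N → C i j ≡ 0

      column : Supported → ∀ i → i < N → total N (λ i' → C i' i) ≡ above i N (λ i' → C i' i)
      column z i i<N = total≡above N i (λ i' → C i' i) (λ i' i'≤i →
        z i' (ℕₚ.≤-<-trans i'≤i i<N) i (ℕₚ.≤-trans (ℕₚ.m⊓n≤n (extend (deg adj) i') i') i'≤i) i<N)

      to : isFlowᵇ n adj a M ≡ true → flowᵇ N m N C e ≡ true
      to h = flowᵇ-intro N m C N e balanced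
        where
        parts₁ = ∧-true {allᶠ N (λ i → allᶠ N (λ j → (entry M i j ≡ᵇ 0) ∨ edgeᵇ i j))} h
        parts₂ = ∧-true {sumFin N (λ i → entry M i Fin.zero) ≡ᵇ
            (sumFin N (λ j → entry M Fin.zero j) ℕ.+ sumFin n a)} (proj₂ parts₁)
        z : Supported
        z i i<N j m≤j j<N with toℕ-surjective i<N | toℕ-surjective j<N
        ... | k , ≡.refl | l , ≡.refl with allᶠ-elim N _ (allᶠ-elim N _ (proj₁ parts₁) k) l
        ...   | o rewrite edge-m k l | <ᵇ-false m≤j with entry M k l in eq
        ...     | zero = ≡.trans (≡.sym (entry≡cell M k l)) eq
        balanced : ∀ i → i < N → BalancedRow N m C N e i
        balanced zero 0<N = ≡.trans (total-cong N (λ j j<N → z 0 0<N j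
            (ℕₚ.≤-trans (ℕₚ.m⊓n≤n (extend (deg adj) 0) 0) z≤n) j<N)) (total-0 N) , z 0 0<N
        balanced i@(suc i') i<N with toℕ-surjective (ℕₚ.≤-pred i<N)
        ... | k , ≡.refl = ≡.trans (≡.sym (row (Fin.suc k))) (≡.trans (≡ᵇ⁻¹ (allᶠ-elim n _ (proj₂ parts₂) k))
          (≡.cong₂ ℕ._+_ (≡.sym (extend-toℕ (vtx a) (Fin.suc k)))
              (≡.trans (col (Fin.suc k)) (column z i i<N)))) , z i i<N

      from : flowᵇ N m N C e ≡ true → isFlowᵇ n adj a M ≡ true
      from h = ∧-intro
        (allᶠ-intro N _ (λ i → allᶠ-intro N _ (λ j → supp i j)))
        (∧-intro (≡ᵇ-true sink) (allᶠ-intro n _ (λ k → ≡ᵇ-true (conserve k))))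
        where
        balanced = flowᵇ-elim N m C N e h
        z : Supported
        z i i<N = proj₂ (balanced i i<N)
        supp : ∀ i j → (entry M i j ≡ᵇ 0) ∨ edgeᵇ i j ≡ true
        supp i j rewrite edge-m i j with ℕₚ.<-≤-connex (toℕ j) (m (toℕ i))
        ... | inj₁ j<m rewrite <ᵇ-true j<m = ∨-zeroʳ (entry M i j ≡ᵇ 0)
        ... | inj₂ m≤j rewrite entry≡cell M i j | z (toℕ i) (Finₚ.toℕ<n i) (toℕ j) m≤j (Finₚ.toℕ<n j) = ≡.refl
        conserve : ∀ k → sumFin N (λ j → entry M (Fin.suc k) j) ≡ a k ℕ.+ sumFin N (λ i → entry M i (Fin.suc k))
        conserve k = ≡.trans (row (Fin.suc k)) (≡.trans (proj₁ (balanced (suc (toℕ k)) (s≤s (Finₚ.toℕ<n k))))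
          (≡.cong₂ ℕ._+_ (extend-toℕ (vtx a) (Fin.suc k))
            (≡.sym (≡.trans (col (Fin.suc k)) (column z (suc (toℕ k)) (s≤s (Finₚ.toℕ<n k)))))))
        ρ κ : ℕ → ℕ
        ρ i = total N (C i)
        κ j = total N (λ i → C i j)
        -- Over all vertices total outflow equals total inflow, by exchanging the two sums.
        -- Subtracting the conservation laws at 1, ..., n leaves the one at the sink;
        -- `total n (κ ∘ suc)` is added to both sides to avoid truncated subtraction.
        sink : sumFin N (λ i → entry M i Fin.zero) ≡ sumFin N (λ j → entry M Fin.zero j) ℕ.+ sumFin n a
        sink = ℕₚ.+-cancelʳ-≡ (total n (κ ∘ suc)) _ _ (begin
          sumFin N (λ i → entry M i Fin.zero) ℕ.+ total n (κ ∘ suc)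
            ≡⟨ ≡.cong (ℕ._+ total n (κ ∘ suc)) (col Fin.zero) ⟩
          κ 0 ℕ.+ total n (κ ∘ suc) ≡⟨ total-∷ n κ ⟨
          total N κ ≡⟨ total-swap N N C ⟨
          total N ρ ≡⟨ total-∷ n ρ ⟩
          ρ 0 ℕ.+ total n (ρ ∘ suc) ≡⟨ ≡.cong (ρ 0 ℕ.+_) (total-cong n (λ j j<n →
            ≡.trans (proj₁ (balanced (suc j) (s≤s j<n)))
                (≡.cong (e (suc j) ℕ.+_) (≡.sym (column z (suc j) (s≤s j<n)))))) ⟩
          ρ 0 ℕ.+ total n (λ j → e (suc j) ℕ.+ κ (suc j))
            ≡⟨ ≡.cong (ρ 0 ℕ.+_) (total-+ n (e ∘ suc) (κ ∘ suc)) ⟩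
          ρ 0 ℕ.+ (total n (e ∘ suc) ℕ.+ total n (κ ∘ suc)) ≡⟨ ℕₚ.+-assoc (ρ 0) _ _ ⟨
          ρ 0 ℕ.+ total n (e ∘ suc) ℕ.+ total n (κ ∘ suc)
            ≡⟨ ≡.cong (ℕ._+ total n (κ ∘ suc)) (≡.cong₂ ℕ._+_ (row Fin.zero)
                 (sumFin≡total n a (e ∘ suc) (λ k → ≡.sym (extend-toℕ (vtx a) (Fin.suc k))))) ⟨
          sumFin N (λ j → entry M Fin.zero j) ℕ.+ sumFin n a ℕ.+ total n (κ ∘ suc) ∎)
          where open ≡.≡-Reasoning

  isFlowᵇ≡flowᵇ : ∀ M → isFlowᵇ n adj a M ≡ flowᵇ N m N (cell M) e
  isFlowᵇ≡flowᵇ M = Bool-ext (to M) (from M)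

positives : List ℕ → ℕ
positives xs = length (filterᵇ (0 <ᵇ_) xs)

positives-++ : ∀ xs ys → positives (xs ++ ys) ≡ positives xs ℕ.+ positives ys
positives-++ [] ys = ≡.refl
positives-++ (zero ∷ xs) ys = positives-++ xs ys
positives-++ (suc x ∷ xs) ys = ≡.cong suc (positives-++ xs ys)

positives-row : ∀ {l} (v : Vec ℕ l) → 0 < total l (at 0 v) → 0 < positives (Vec.toList v)
positives-row {suc l} (zero Vec.∷ v) h = positives-row v (≡.subst (0 <_) (total-∷ l (at 0 (zero Vec.∷ v))) h)
positives-row {suc l} (suc x Vec.∷ v) h = s≤s z≤n

positives-rows : ∀ {l r} (M : Vec (Vec ℕ l) r) → (∀ i → i < r → 0 < total l (cell M i)) →
  r ≤ positives (concatMap Vec.toList (Vec.toList M))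
positives-rows Vec.[] h = z≤n
positives-rows {l} {suc r} (v Vec.∷ M) h rewrite positives-++ (Vec.toList v) (concatMap Vec.toList (Vec.toList M)) =
  ℕₚ.+-mono-≤ (positives-row v (h 0 (s≤s z≤n))) (positives-rows M (λ i i<r → h (suc i) (s≤s i<r)))

-- Each vertex from 1 to n has positive outflow, hence a positive entry in its row. This makes the
-- truncated subtraction in the exponent of the weight exact.
positives-flow : ∀ {n} (m : ℕ → ℕ) (e : ℕ → ℕ) (M : Mat (suc n)) → flowᵇ (suc n) m (suc n) (cell M) e ≡ true →
  (∀ j → 0 < j → j < suc n → 0 < e j) → n ≤ positives (allEntries M)
positives-flow {n} m e M@(v Vec.∷ M') h pos rewrite positives-++ (Vec.toList v)
    (concatMap Vec.toList (Vec.toList M')) =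
  ℕₚ.≤-trans (positives-rows M' (λ i i<n → ≡.subst (0 <_)
      (≡.sym (proj₁ (flowᵇ-elim (suc n) m (cell M) (suc n) e h (suc i) (s≤s i<n))))
      (ℕₚ.<-≤-trans (pos (suc i) (s≤s z≤n) (s≤s i<n)) (ℕₚ.m≤m+n (e (suc i)) _))))
    (ℕₚ.m≤n+m _ (positives (Vec.toList v)))

-- Weights

module WeightedFlows {ℓ₁ ℓ₂} (QR : QRing ℓ₁ ℓ₂) where
  open QRing QR
  open RowSeries QR
  open DifferenceSolver R
  open PowerSeries R
  open Sums R
  open import Algebra.Properties.Semiring.Exp semiring using (^-homo-*; ^-congˡ)
  open import Algebra.Properties.CommutativeSemiring.Exp commutativeSemiring using (^-distrib-*)
  open import Relation.Binary.Reasoning.Setoid setoid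

  wt : ℕ → Carrier
  wt zero = 1#
  wt (suc b) = ∑ (suc b) (λ k → q ^ (b ∸ k) * u ^ k)

  c : Carrier
  c = - ((1# - u) * (1# - q))

  -- So c is (q - 1)² up to a unit: it inherits cancellation from q - 1, and n such units give the
  -- q^n behind the -n in F.
  c*q : c * q ≈ ⟨ 1 ⟩ * ⟨ 1 ⟩
  c*q = begin
    - ((1# - u) * (1# - q)) * q
      ≈⟨ solve 2 (λ u q → :- ((con (1 , 0) :- u) :* (con (1 , 0) :- q)) :* q
           := (q :* u :- q) :* (con (1 , 0) :- q)) refl u q ⟩
    (q * u - q) * (1# - q) ≈⟨ *-congʳ (+-congʳ q*u≈1) ⟩
    (1# - q) * (1# - q)
      ≈⟨ solve 1 (λ q → (con (1 , 0) :- q) :* (con (1 , 0) :- q)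
           := (q :* con (1 , 0) :- con (1 , 0)) :* (q :* con (1 , 0) :- con (1 , 0))) refl q ⟩
    ⟨ 1 ⟩ * ⟨ 1 ⟩ ∎

  c-cancelˡ : ∀ {x y} → c * x ≈ c * y → x ≈ y
  c-cancelˡ {x} {y} h = q^k-1-cancelˡ 0 (q^k-1-cancelˡ 0 (trans (expand x) (trans (*-congˡ h) (sym (expand y)))))
    where
    expand : ∀ x → ⟨ 1 ⟩ * (⟨ 1 ⟩ * x) ≈ q * (c * x)
    expand x = begin
      ⟨ 1 ⟩ * (⟨ 1 ⟩ * x) ≈⟨ *-assoc _ _ _ ⟨
      ⟨ 1 ⟩ * ⟨ 1 ⟩ * x ≈⟨ *-congʳ c*q ⟨
      c * q * x ≈⟨ solve 3 (λ c q x → c :* q :* x := q :* (c :* x)) refl c q x ⟩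
      q * (c * x) ∎

  c^n-cancelˡ : ∀ n {x y} → c ^ n * x ≈ c ^ n * y → x ≈ y
  c^n-cancelˡ zero h = trans (sym (*-identityˡ _)) (trans h (*-identityˡ _))
  c^n-cancelˡ (suc n) h = c^n-cancelˡ n (c-cancelˡ (trans (sym (*-assoc _ _ _)) (trans h (*-assoc _ _ _))))

  ∑-∷ʳ : ∀ n f → ∑ (suc n) f ≈ ∑ n f + f n
  ∑-∷ʳ zero f = trans (+-identityʳ _) (sym (+-identityˡ _))
  ∑-∷ʳ (suc n) f = trans (+-congˡ (∑-∷ʳ n (f ∘ suc))) (sym (+-assoc _ _ _))

  u^b*geo : ∀ b → u ^ b * geo (q ^ 2) (suc b) ≈ wt (suc b)
  u^b*geo zero = solve 0 (con (1 , 0) :* (con (1 , 0) :+ con (0 , 0)) := con (1 , 0) :* con (1 , 0)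
      :+ con (0 , 0)) refl
  u^b*geo (suc b) = begin
    u ^ suc b * geo (q ^ 2) (suc (suc b)) ≈⟨ *-congˡ (∑-∷ʳ (suc b) ((q ^ 2) ^_)) ⟩
    u ^ suc b * (geo (q ^ 2) (suc b) + (q ^ 2) ^ suc b)
      ≈⟨ solve 4 (λ u p g x → u :* p :* (g :+ x) := u :* p :* x :+ u :* (p :* g)) refl u (u ^ b) _ _ ⟩
    u ^ suc b * (q ^ 2) ^ suc b + u * (u ^ b * geo (q ^ 2) (suc b))
      ≈⟨ +-cong (trans (sym (^-distrib-* u (q ^ 2) (suc b)))
          (trans (^-congˡ (suc b) u*q²) (sym (*-identityʳ _)))) (*-congˡ (u^b*geo b)) ⟩
    q ^ suc b * 1# + u * wt (suc b) ≈⟨ +-congˡ (∑-distribˡ (suc b) u (λ k → q ^ (b ∸ k) * u ^ k)) ⟨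
    q ^ suc b * 1# + ∑ (suc b) (λ k → u * (q ^ (b ∸ k) * u ^ k))
      ≈⟨ +-congˡ (∑-cong (suc b) (λ k _ → solve 3 (λ u x y → u :* (x :* y) := x :* (u :* y)) refl u
          (q ^ (b ∸ k)) (u ^ k))) ⟩
    wt (suc (suc b)) ∎
    where
    u*q² : u * q ^ 2 ≈ q
    u*q² = begin
      u * (q * (q * 1#)) ≈⟨ solve 2 (λ u q → u :* (q :* (q :* con (1 , 0))) := q :* u :* q) refl u q ⟩
      q * u * q ≈⟨ trans (*-congʳ q*u≈1) (*-identityˡ q) ⟩
      q ∎

  -- Identifies `H 1` with the modified weight w of a single entry.
  H₁≈c*wt : ∀ b → H 1 (suc b) ≈ c * wt (suc b)
  H₁≈c*wt b = begin
    ⟨ 1 ⟩ * ⟨ 1 ⟩ * (u ^ 1 * (u ^ 1) ^ b) * geo (q ^ 2) (suc b)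
      ≈⟨ *-congʳ (*-cong (sym c*q) (*-cong (*-identityʳ u) (^-congˡ b (*-identityʳ u)))) ⟩
    c * q * (u * u ^ b) * geo (q ^ 2) (suc b)
      ≈⟨ solve 5 (λ c q u p g → c :* q :* (u :* p) :* g := c :* (q :* u :* (p :* g))) refl c q u (u ^ b) _ ⟩
    c * (q * u * (u ^ b * geo (q ^ 2) (suc b))) ≈⟨ *-congˡ (trans (*-congʳ q*u≈1) (*-identityˡ _)) ⟩
    c * (u ^ b * geo (q ^ 2) (suc b)) ≈⟨ *-congˡ (u^b*geo b) ⟩
    c * wt (suc b) ∎

  prod : List Carrier → Carrier
  prod = foldr _*_ 1#

  prod-++ : ∀ xs ys → prod (xs ++ ys) ≈ prod xs * prod ys
  prod-++ [] ys = sym (*-identityˡ _)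
  prod-++ (x ∷ xs) ys = trans (*-congˡ (prod-++ xs ys)) (sym (*-assoc _ _ _))

  prod-H₁ : ∀ xs → prod (map (H 1) xs) ≈ c ^ positives xs * prod (map wt xs)
  prod-H₁ [] = sym (*-identityˡ _)
  prod-H₁ (zero ∷ xs) = trans (*-congˡ (prod-H₁ xs))
    (solve 2 (λ x y → con (1 , 0) :* (x :* y) := x :* (con (1 , 0) :* y)) refl _ _)
  prod-H₁ (suc x ∷ xs) = trans (*-cong (H₁≈c*wt x) (prod-H₁ xs))
    (solve 4 (λ c w x y → c :* w :* (x :* y) := c :* x :* (w :* y)) refl _ _ _ _)

  prod-row : ∀ {l} f (v : Vec ℕ l) → prod (map f (Vec.toList v)) ≈ ∏ l (λ j → f (at 0 v j))
  prod-row f Vec.[] = refl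
  prod-row {suc l} f (x Vec.∷ v) = trans (*-congˡ (prod-row f v)) (sym (∏-∷ l (λ j → f (at 0 (x Vec.∷ v) j))))

  prod-rows : ∀ {l r} f (M : Vec (Vec ℕ l) r) →
    prod (map f (concatMap Vec.toList (Vec.toList M))) ≈ ∏ r (λ i → ∏ l (λ j → f (cell M i j)))
  prod-rows f Vec.[] = refl
  prod-rows {l} {suc r} f (v Vec.∷ M) = begin
    prod (map f (Vec.toList v ++ concatMap Vec.toList (Vec.toList M)))
      ≡⟨ ≡.cong prod (map-++ f (Vec.toList v) (concatMap Vec.toList (Vec.toList M))) ⟩
    prod (map f (Vec.toList v) ++ map f (concatMap Vec.toList (Vec.toList M)))
      ≈⟨ prod-++ (map f (Vec.toList v)) _ ⟩
    prod (map f (Vec.toList v)) * prod (map f (concatMap Vec.toList (Vec.toList M)))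
      ≈⟨ *-cong (prod-row f v) (prod-rows f M) ⟩
    ∏ l (λ j → f (at 0 v j)) * ∏ r (λ i → ∏ l (λ j → f (cell M i j)))
      ≈⟨ ∏-∷ r (λ i → ∏ l (λ j → f (cell (v Vec.∷ M) i j))) ⟨
    ∏ (suc r) (λ i → ∏ l (λ j → f (cell (v Vec.∷ M) i j))) ∎

  prod-allFin : ∀ n (f : Fin n → Carrier) g → (∀ k → f k ≈ g (toℕ k)) → prod (map f (allFin n)) ≈ ∏ n g
  prod-allFin zero f g h = refl
  prod-allFin (suc n) f g h = begin
    f Fin.zero * prod (map f (List.tabulate Fin.suc))
      ≡⟨ ≡.cong (λ xs → f Fin.zero * prod xs) (≡.trans (map-tabulate Fin.suc f)
          (≡.sym (map-tabulate id (f ∘ Fin.suc)))) ⟩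
    f Fin.zero * prod (map (f ∘ Fin.suc) (allFin n))
      ≈⟨ *-cong (h Fin.zero) (prod-allFin n (f ∘ Fin.suc) (g ∘ suc) (h ∘ Fin.suc)) ⟩
    g 0 * ∏ n (g ∘ suc) ≈⟨ ∏-∷ n g ⟨
    ∏ (suc n) g ∎

  ∏-^ : ∀ n x f → ∏ n (λ i → x ^ f i) ≈ x ^ total n f
  ∏-^ zero x f = refl
  ∏-^ (suc n) x f = trans (*-congʳ (∏-^ n x f)) (sym (^-homo-* x (total n f) (f n)))

  foldr-map≈sumOver : ∀ {A : Set} (f : A → Carrier) xs → foldr _+_ 0# (map f xs) ≈ sumOver xs f
  foldr-map≈sumOver f [] = refl
  foldr-map≈sumOver f (x ∷ xs) = +-congˡ (foldr-map≈sumOver f xs)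

  sumOver-filterᵇ : ∀ {A : Set} (p : A → Bool) f xs → sumOver (filterᵇ p xs) f ≈ sumOver xs (λ x → guard (p x) (f x))
  sumOver-filterᵇ p f [] = refl
  sumOver-filterᵇ p f (x ∷ xs) with p x
  ... | true = +-congˡ (sumOver-filterᵇ p f xs)
  ... | false = trans (sumOver-filterᵇ p f xs) (sym (+-identityˡ _))

  flowWeight : ∀ n → Mat (suc n) → Carrier
  flowWeight n M = c ^ (positives (allEntries M) ∸ n) * prod (map wt (allEntries M))

  module _ (n : ℕ) (adj : Fin (suc n) → Fin (suc n) → Bool) (threshold : IsThreshold adj)
    (labelled : ReverseDegreeLabeled adj)
    (a : Fin n → ℕ) (a-pos : ∀ k → 0 < a k) where

    private
      D′ = degreeData adj threshold labelled
      d = extend (deg adj)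
      e = extend (vtx a)
      B = sumFin n a
    open DegreeData D′ using (outdeg)
    open RowSums QR B
    open FlowSums QR B (suc n) outdeg
    open ThresholdFlowSum QR B n d D′

    private
      positive : Positive (suc n) e
      positive (suc j) _ (s≤s j<n) with toℕ-surjective j<n
      ... | k , ≡.refl rewrite extend-toℕ (vtx a) (Fin.suc k) = a-pos k

      total≤B : total (suc n) e ≤ B
      total≤B = ℕₚ.≤-reflexive (≡.trans (total-∷ n e)
        (≡.sym (sumFin≡total n a (e ∘ suc) (λ k → ≡.sym (extend-toℕ (vtx a) (Fin.suc k))))))

    -- The factor `c ^ n` completes the exponent of c in each weight to the number of positive
    -- entries, one c for each, which is what turns the weight into a product of values of `H 1`.
    c^n*flows : c ^ n * foldr _+_ 0# (map (flowWeight n) (flowPoints n adj a)) ≈ flowSum (suc n) e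
    c^n*flows = begin
      c ^ n * foldr _+_ 0# (map (flowWeight n) (flowPoints n adj a))
        ≈⟨ *-congˡ (trans (foldr-map≈sumOver (flowWeight n) (flowPoints n adj a))
            (sumOver-filterᵇ (isFlowᵇ n adj a) (flowWeight n) mats)) ⟩
      c ^ n * sumOver mats (λ M → guard (isFlowᵇ n adj a M) (flowWeight n M))
        ≈⟨ sumOver-distribˡ mats (c ^ n) (λ M → guard (isFlowᵇ n adj a M) (flowWeight n M)) ⟨
      sumOver mats (λ M → c ^ n * guard (isFlowᵇ n adj a M) (flowWeight n M)) ≈⟨ sumOver-cong mats term ⟩
      flowSum (suc n) e ∎
      where
      mats = allVecs rows (suc n)
      term : ∀ M → c ^ n * guard (isFlowᵇ n adj a M) (flowWeight n M)
        ≈ guard (flowᵇ (suc n) outdeg (suc n) (cell M) e) (∏ (suc n) (λ i → rowWeight (suc n) (cell M i)))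
      term M = begin
        c ^ n * guard (isFlowᵇ n adj a M) (flowWeight n M)
          ≡⟨ ≡.cong (λ b → c ^ n * guard b (flowWeight n M)) (isFlowᵇ≡flowᵇ adj threshold labelled a M) ⟩
        c ^ n * guard F (flowWeight n M) ≈⟨ guard-distribˡ F (c ^ n) (flowWeight n M) ⟨
        guard F (c ^ n * flowWeight n M) ≈⟨ guard-cong F value ⟩
        guard F (∏ (suc n) (λ i → rowWeight (suc n) (cell M i))) ∎
        where
        F = flowᵇ (suc n) outdeg (suc n) (cell M) e
        value : F ≡ true → c ^ n * flowWeight n M ≈ ∏ (suc n) (λ i → rowWeight (suc n) (cell M i))
        value valid = begin
          c ^ n * (c ^ (# ∸ n) * prod (map wt (allEntries M))) ≈⟨ *-assoc _ _ _ ⟨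
          c ^ n * c ^ (# ∸ n) * prod (map wt (allEntries M)) ≈⟨ *-congʳ (^-homo-* c n (# ∸ n)) ⟨
          c ^ (n ℕ.+ (# ∸ n)) * prod (map wt (allEntries M))
            ≡⟨ ≡.cong (λ z → c ^ z * prod (map wt (allEntries M)))
                (ℕₚ.m+[n∸m]≡n (positives-flow outdeg e M valid positive)) ⟩
          c ^ # * prod (map wt (allEntries M)) ≈⟨ prod-H₁ (allEntries M) ⟨
          prod (map (H 1) (allEntries M)) ≈⟨ prod-rows (H 1) M ⟩
          ∏ (suc n) (λ i → rowWeight (suc n) (cell M i)) ∎
          where
          # = positives (allEntries M)

    flows≈brackets : (b : Fin n → Carrier) → (∀ k → b k ≈ bracket e (suc (toℕ k))) →
      foldr _+_ 0# (map (flowWeight n) (flowPoints n adj a))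
        ≈ q ^ n * u ^ total n (λ i → outdeg (suc i) ℕ.* e (suc i)) * prod (map b (allFin n))
    flows≈brackets b b≈ = c^n-cancelˡ n (begin
      c ^ n * foldr _+_ 0# (map (flowWeight n) (flowPoints n adj a)) ≈⟨ c^n*flows ⟩
      flowSum (suc n) e ≈⟨ flowSum-brackets e total≤B positive ⟩
      ∏ n (λ i → ⟨ 1 ⟩ * ⟨ 1 ⟩ * (u ^ s i * bracket e (suc i)))
        ≈⟨ trans (∏-* n (λ _ → ⟨ 1 ⟩ * ⟨ 1 ⟩) (λ i → u ^ s i * bracket e (suc i)))
             (*-cong (trans (∏-const n (⟨ 1 ⟩ * ⟨ 1 ⟩)) (trans (^-congˡ n (sym c*q)) (^-distrib-* c q n)))
               (trans (∏-* n (λ i → u ^ s i) (λ i → bracket e (suc i))) (*-congʳ (∏-^ n u s)))) ⟩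
      c ^ n * q ^ n * (u ^ total n s * ∏ n (λ i → bracket e (suc i)))
        ≈⟨ *-congˡ (*-congˡ (prod-allFin n b (λ i → bracket e (suc i)) b≈)) ⟨
      c ^ n * q ^ n * (u ^ total n s * prod (map b (allFin n)))
        ≈⟨ solve 4 (λ c q u p → c :* q :* (u :* p) := c :* (q :* u :* p)) refl _ _ _ _ ⟩
      c ^ n * (q ^ n * u ^ total n s * prod (map b (allFin n))) ∎)
      where
      s : ℕ → ℕ
      s i = outdeg (suc i) ℕ.* e (suc i)

-- Specialisation to Laurent polynomials and the stated product

total-above : ∀ i (p : ℕ → Bool) k (e : ℕ → ℕ) →
  total k (λ j → if (i <ᵇ j) ∧ p j then e j else 0) ≡ above i k (λ j → if p j then e j else 0)
total-above i p zero e = ≡.refl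
total-above i p (suc k) e = ≡.cong₂ ℕ._+_ (total-above i p k e) (nested (i <ᵇ k) (p k))
  where
  nested : ∀ b b' → (if b ∧ b' then e k else 0) ≡ (if b then (if b' then e k else 0) else 0)
  nested true b' = ≡.refl
  nested false b' = ≡.refl

sumFin≡above : ∀ n (a : Fin n → ℕ) i d → d ≤ n →
  sumFin n (λ k → if (i <ᵇ suc (toℕ k)) ∧ (suc (toℕ k) ≤ᵇ d) then a k else 0) ≡ above i (suc d) (extend (vtx a))
sumFin≡above n a i d d≤n = begin
  sumFin n (λ k → if (i <ᵇ suc (toℕ k)) ∧ (suc (toℕ k) ≤ᵇ d) then a k else 0)
    ≡⟨ sumFin≡total n _ (g ∘ suc) (λ k → ≡.cong (if (i <ᵇ suc (toℕ k)) ∧ (suc (toℕ k) ≤ᵇ d) then_else 0)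
         (≡.sym (extend-toℕ (vtx a) (Fin.suc k)))) ⟩
  total n (g ∘ suc) ≡⟨ total-∷ n g ⟨
  total (suc n) g ≡⟨ total-above i (_≤ᵇ d) (suc n) e ⟩
  above i (suc n) h ≡⟨ above-vanish i (suc d) (suc n) h (s≤s d≤n)
    (λ j d<j _ → ≡.cong (if_then e j else 0) (≤ᵇ-false d<j)) ⟩
  above i (suc d) h
    ≡⟨ above-cong i (suc d) (λ j j≤d → ≡.cong (if_then e j else 0) (≤ᵇ-true (ℕₚ.≤-pred j≤d))) ⟩
  above i (suc d) e ∎
  where
  open ≡.≡-Reasoning
  e h g : ℕ → ℕ
  e = extend (vtx a)
  h j = if j ≤ᵇ d then e j else 0
  g j = if (i <ᵇ j) ∧ (j ≤ᵇ d) then e j else 0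

laurentQRing : QRing 0ℓ 0ℓ
laurentQRing = record
  { R = laurentRing
  ; q = qL
  ; u = qinvL
  ; q*u≈1 = CommutativeRing.refl laurentRing
  ; q^k-1-cancelˡ = Laurent.qL^k-1-cancelˡ
  }

open QRing laurentQRing using (_^_)
open PowerSeries laurentRing using (∑; geo)
open WeightedFlows laurentQRing using (wt; flowWeight; flows≈brackets)

^ᴸ≡^ : ∀ x n → x ^ᴸ n ≡ x ^ n
^ᴸ≡^ x zero = ≡.refl
^ᴸ≡^ x (suc n) = ≡.cong (x ⊗_) (^ᴸ≡^ x n)

sumLP≡∑ : ∀ (f h : ℕ → LP) → (∀ k → f k ≡ h k) → ∀ n g → sumLP (map f (applyUpTo g n)) ≡ ∑ n (h ∘ g)
sumLP≡∑ f h f≡h zero g = ≡.refl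
sumLP≡∑ f h f≡h (suc n) g = ≡.cong₂ _⊕_ (f≡h (g 0)) (sumLP≡∑ f h f≡h n (g ∘ suc))

qbr≡geo : ∀ x k → qbr x k ≡ geo x k
qbr≡geo x k = sumLP≡∑ (x ^ᴸ_) (x ^_) (^ᴸ≡^ x) k id

wtq≡wt : ∀ b → wtq b ≡ wt b
wtq≡wt zero = ≡.refl
wtq≡wt (suc b) = sumLP≡∑ (λ k → (qL ^ᴸ (b ∸ k)) ⊗ (qinvL ^ᴸ k)) (λ k → qL ^ (b ∸ k) ⊗ qinvL ^ k)
  (λ k → ≡.cong₂ _⊗_ (^ᴸ≡^ qL (b ∸ k)) (^ᴸ≡^ qinvL k)) (suc b) id

wtFlow≡flowWeight : ∀ n M → wtFlow n M ≡ flowWeight n M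
wtFlow≡flowWeight n M = ≡.cong₂ _⊗_ (^ᴸ≡^ cfactor (positives (allEntries M) ∸ n))
    (≡.cong prodLP (map-cong wtq≡wt (allEntries M)))

module _ (n : ℕ) (adj : Fin (suc n) → Fin (suc n) → Bool) (threshold : IsThreshold adj)
  (labelled : ReverseDegreeLabeled adj)
  (a : Fin n → ℕ) where

  private
    D = degreeData adj threshold labelled
    d = extend (deg adj)
    e = extend (vtx a)
  open DegreeData D using (outdeg)
  open ThresholdFlowSum laurentQRing (sumFin n a) n d D using (bracket)

  bfac≡bracket : ∀ k → bfac n adj a k ≡ bracket e (suc (toℕ k))
  bfac≡bracket k rewrite extend-toℕ (deg adj) (Fin.suc k) | extend-toℕ (vtx a) (Fin.suc k) =
    cases (suc (toℕ k) <ᵇ deg adj (Fin.suc k)) (deg adj (Fin.suc k) <ᵇ suc (toℕ k))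
      (≡.trans (≡.cong (λ s → qbr qL (suc i ℕ.* a k ℕ.+ s)) (sumFin≡above n a i δ δ≤n))
          (qbr≡geo qL (suc i ℕ.* a k ℕ.+ above i (suc δ) e)))
      (≡.cong₂ _⊗_ (power δ) (qbr≡geo qL δ))
      (power i)
    where
    i = suc (toℕ k)
    δ = deg adj (Fin.suc k)
    δ≤n : δ ≤ n
    δ≤n = ℕₚ.≤-pred (Threshold.deg<N adj threshold labelled (Fin.suc k))
    power : ∀ j → qbr (qL ^ᴸ suc j) (a k) ≡ geo (qL ^ suc j) (a k)
    power j = ≡.trans (qbr≡geo (qL ^ᴸ suc j) (a k)) (≡.cong (λ x → geo x (a k)) (^ᴸ≡^ qL (suc j)))
    cases : ∀ b b' {x x' y y' z z' : LP} → x ≡ x' → y ≡ y' → z ≡ z' →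
      (if b then x else if b' then y else z) ≡ (if b then x' else if b' then y' else z')
    cases b b' ≡.refl ≡.refl ≡.refl = ≡.refl

  sumFin≡total-outdeg : sumFin n (λ k → deg adj (Fin.suc k) ℕ.⊓ suc (toℕ k) ℕ.* a k)
    ≡ total n (λ i → outdeg (suc i) ℕ.* e (suc i))
  sumFin≡total-outdeg = sumFin≡total n _ (λ i → outdeg (suc i) ℕ.* e (suc i)) (λ k →
    ≡.cong₂ (λ x y → x ℕ.⊓ suc (toℕ k) ℕ.* y) (≡.sym (extend-toℕ (deg adj) (Fin.suc k)))
        (≡.sym (extend-toℕ (vtx a) (Fin.suc k))))

monomial : ∀ n s → (qL ^ n) ⊗ (qinvL ^ s) ≃ mono (+ 1) (ℤ.- (+ s ℤ.- + n))
monomial n s = trans (*-cong (Laurent.qL^ n) (Laurent.qinvL^ s))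
  (reflexive (≡.cong (mono (+ 1)) (≡.trans (ℤₚ.+-comm (+ n) (ℤ.- + s))
    (≡.sym (≡.trans (ℤₚ.neg-distrib-+ (+ s) (ℤ.- + n)) (≡.cong (ℤ._+_ (ℤ.- + s)) (ℤₚ.neg-involutive (+ n))))))))
  where open CommutativeRing laurentRing using (trans; *-cong; reflexive)

theorem5p2 : (n : ℕ) (adj : Fin (suc n) → Fin (suc n) → Bool) →
    IsThreshold adj → ReverseDegreeLabeled adj →
    (a : Fin n → ℕ) → (∀ k → 0 < a k) →
    Ehr n adj a ≈ᴸ RHS n adj a
theorem5p2 n adj threshold labelled a a-pos = coeffs (begin
  Ehr n adj a ≡⟨ ≡.cong sumLP (map-cong (wtFlow≡flowWeight n) (flowPoints n adj a)) ⟩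
  sumLP (map (flowWeight n) (flowPoints n adj a))
    ≈⟨ flows≈brackets n adj threshold labelled a a-pos (bfac n adj a)
        (λ k → reflexive (bfac≡bracket n adj threshold labelled a k)) ⟩
  (qL ^ n) ⊗ (qinvL ^ total n (λ i → outdeg (suc i) ℕ.* extend (vtx a) (suc i))) ⊗ b
    ≡⟨ ≡.cong (λ s → (qL ^ n) ⊗ (qinvL ^ s) ⊗ b) (sumFin≡total-outdeg n adj threshold labelled a) ⟨
  (qL ^ n) ⊗ (qinvL ^ s) ⊗ b ≈⟨ *-congʳ {b} (monomial n s) ⟩
  RHS n adj a ∎)
  where
  open CommutativeRing laurentRing using (setoid; reflexive; *-congʳ)
  open import Relation.Binary.Reasoning.Setoid setoid
  open DegreeData (degreeData adj threshold labelled) using (outdeg)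
  s = sumFin n (λ k → deg adj (Fin.suc k) ℕ.⊓ suc (toℕ k) ℕ.* a k)
  b = prodLP (map (bfac n adj a) (allFin n))
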